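{- There exists an infinite family of simple arrangements of pseudocircles whose arrangement graphs have chromatic number $4$, each of which is obtained from an intersecting arrangement of pseudocircles by adding only one additional pseudocircle.
   Context: An arrangement of pseudocircles is a finite family of simple closed curves on the sphere (or in the plane) such that each pair intersects at most twice, crossing at intersection points. It is simple if no three curves pass through a common point, and intersecting if every pair of curves intersects. The arrangement graph is the plane graph whose vertices are the intersection points and whose edges are the pieces into which the curves are subdivided. -}

module Defs where

open import Data.Nat using (ℕ; zero; suc; _+_; _<_; _≤ᵇ_)
open import Data.Fin using (Fin; toℕ)
open import Data.Bool using (Bool; true; false)
open import Data.List using (List; []; _∷_; length; filter; upTo; allFin)
open import Data.Product using (Σ; ∃; _×_; _,_)
open import Data.Sum using (_⊎_)
open import Relation.Nullary using (¬_)
open import Relation.Binary.PropositionalEquality using (_≡_; _≢_)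
open import Data.Bool.Properties using (T?)
open import Data.Bool using (T)

iter : {A : Set} → (A → A) → ℕ → A → A
iter f zero    x = x
iter f (suc k) x = f (iter f k x)

-- d' lies in the orbit of d under π (for π a bijection of Fin m)
InOrbit : {m : ℕ} → (Fin m → Fin m) → Fin m → Fin m → Set
InOrbit π d d' = ∃ λ k → iter π k d ≡ d'

allB : {A : Set} → (A → Bool) → List A → Bool
allB p []       = true
allB p (x ∷ xs) with p x
... | true  = allB p xs
... | false = false

isOrbitMin : {m : ℕ} → (Fin m → Fin m) → Fin m → Bool
isOrbitMin {m} π d = allB (λ k → toℕ d ≤ᵇ toℕ (iter π k d)) (upTo m)

orbitCount : {m : ℕ} → (Fin m → Fin m) → ℕ
orbitCount {m} π = length (filter (λ d → T? (isOrbitMin π d)) (allFin m))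

data Reach {m : ℕ} (σ α : Fin m → Fin m) : Fin m → Fin m → Set where
  here  : ∀ {d} → Reach σ α d d
  stepσ : ∀ {d e} → Reach σ α (σ d) e → Reach σ α d e
  stepα : ∀ {d e} → Reach σ α (α d) e → Reach σ α d e

-- Simple arrangements of pseudocircles on the sphere, encoded by their
-- arrangement graph as a plane (genus 0) combinatorial map on m darts.
--   * vertices  = orbits of σ  (the rotation at a crossing), all of size 4
--   * edges     = orbits of α  (fixed-point-free involution)
--   * faces     = orbits of σ ∘ α
--   * a pseudocircle is traced by going "straight through" each crossing:
--     the dart following d along its curve is τ d = σ (σ (α d)).

record ArrangementMap (m : ℕ) : Set where
  field
    σ α : Fin m → Fin m

  τ : Fin m → Fin m
  τ d = σ (σ (α d))

  -- two darts lie on the same pseudocircle (in either direction)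
  SameCurve : Fin m → Fin m → Set
  SameCurve d d' = InOrbit τ d d' ⊎ InOrbit τ (α d) d'

  SameVertex : Fin m → Fin m → Set
  SameVertex d d' = InOrbit σ d d'

  MeetAt : Fin m → Fin m → Fin m → Set
  MeetAt d e x = ∃ λ a → ∃ λ b →
    SameCurve d a × SameCurve e b × SameVertex x a × SameVertex x b

  field
    α-invol   : ∀ d → α (α d) ≡ d
    α-nofix   : ∀ d → α d ≢ d
    -- every vertex has degree exactly 4 (simple: exactly two curves cross)
    σ⁴        : ∀ d → σ (σ (σ (σ d))) ≡ d
    σ-nofix   : ∀ d → σ d ≢ d
    σ²-nofix  : ∀ d → σ (σ d) ≢ d
    -- the arrangement graph is connected and embedded in the sphere
    connected : ∀ d e → Reach σ α d e
    euler     : orbitCount σ + orbitCount (λ d → σ (α d)) ≡ orbitCount α + 2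
    -- at each crossing the two curves are distinct (curves are simple)
    cross-distinct : ∀ d → ¬ SameCurve d (σ d)
    at-most-twice  : ∀ d e → ¬ SameCurve d e →
      ¬ (∃ λ x → ∃ λ y → ∃ λ z →
           MeetAt d e x × MeetAt d e y × MeetAt d e z ×
           ¬ SameVertex x y × ¬ SameVertex x z × ¬ SameVertex y z)

open ArrangementMap public

-- The arrangement is obtained from an intersecting arrangement by adding
-- one pseudocircle: there is a pseudocircle (through dart c) such that
-- any two distinct pseudocircles other than it intersect.
IntersectingPlusOne : {m : ℕ} → ArrangementMap m → Set
IntersectingPlusOne {m} A = ∃ λ (c : Fin m) → ∀ d e →
  ¬ SameCurve A d c → ¬ SameCurve A e c → ¬ SameCurve A d e →
  ∃ λ x → MeetAt A d e x

-- proper k-colouring of the arrangement graph (colours are constant on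
-- the darts of a vertex, and the two ends of every edge get different colours)
ProperColouring : {m : ℕ} → ArrangementMap m → (k : ℕ) → (Fin m → Fin k) → Set
ProperColouring A k f = (∀ d → f (σ A d) ≡ f d) × (∀ d → f (α A d) ≢ f d)

Colourable : {m : ℕ} → ArrangementMap m → ℕ → Set
Colourable A k = ∃ λ f → ProperColouring A k f

ChromaticNumber : {m : ℕ} → ArrangementMap m → ℕ → Set
ChromaticNumber A k = Colourable A k × (∀ j → j < k → ¬ Colourable A j)

{-# OPTIONS --safe #-}
module Submission where

-- If one class of the 2-coloured faces of an arrangement consists of triangles
-- only, the arrangement graph is the medial graph of a cubic plane map, and the
-- pseudocircles are the zigzags of that map.  Starting from the tetrahedron, all
-- zigzags are replaced by two parallel copies which are shifted so that all
-- these faces remain triangles; copies of the same zigzag cross at two marked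
-- vertices.  This doubles the number of pseudocircles and keeps them pairwise
-- intersecting.  A small circle is then drawn around a pentagonal face of the
-- other class.  Inside it the two classes are exchanged, so the distinguished
-- faces are now triangles and a single pentagon.  In a proper 3-colouring every
-- triangle contains each colour once and every vertex lies on two distinguished
-- faces, so the three colours occur with the same parity on the pentagon; but a
-- proper 3-colouring of a pentagon uses the colours 2, 2 and 1 times.

-- A vertex colouring of the medial graph is an edge colouring of the map in which edges consecutive
-- around a vertex differ; at cubic vertices this is a Tait colouring, and the parity argument
-- counts the darts of one colour. A triangle or a quadrilateral would give no contradiction: their
-- colours can occur 1, 1, 1 or 2, 2, 0 times. The tetrahedron has no pentagon. Doubling puts a face
-- in place of every edge, of size 6, 5 or 4 according to whether 0, 1 or 2 ends of the edge are
-- marked, so an edge with one marked end, a `seam`, supplies it. The five curves along it are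
-- different, hence each crosses the small circle exactly twice. Parallel copies of a closed curve
-- would be disjoint if they did not cross at two marked arcs. Since a zigzag bends alternately to
-- both sides, the inner and the outer copy exchange roles on every edge, and again at marked arcs;
-- the bits of `Attr` give each copy one name all along. That four colours suffice is shown by an
-- explicit colouring carried through every construction.

open import Defs
open import Data.Nat using (ℕ; _<_)
open import Data.Product using (∃; _×_)

open import Data.Nat as ℕ using (zero; suc; _+_; _*_; _≤_; _≤ᵇ_; z≤n; s≤s; _%_; _/_)
import Data.Nat.Properties as ℕₚ
open import Data.Nat.DivMod using (m≡m%n+[m/n]*n; m%n<n)
open import Data.Nat.Tactic.RingSolver using (solve-∀)
open import Data.Fin as Fin using (Fin; toℕ; zero; suc; inject≤; inject₁; splitAt)
open import Data.Fin.Patterns using (0F; 1F; 2F; 3F; 4F; 5F)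
open import Data.Fin.Permutation using (Permutation)
import Data.Fin.Properties as Finₚ
open import Data.Bool using (Bool; true; false; not; T; _xor_)
import Data.Bool.Properties as Boolₚ
open import Data.Unit using (tt)
open import Data.Empty using (⊥; ⊥-elim)
open import Data.Maybe using (Maybe; just; nothing)
open import Data.Maybe.Properties using (just-injective) renaming (≡-dec to maybe-dec)
open import Data.List using (List; []; _∷_; length; filter; upTo; allFin; lookup)
open import Data.List.Membership.Propositional using (_∈_)
open import Data.List.Membership.Propositional.Properties using (∈-lookup; ∈-filter⁺; ∈-filter⁻; ∈-allFin; ∈-upTo⁺)
open import Data.List.Relation.Unary.All as All using ()
open import Data.List.Relation.Unary.AllPairs using (_∷_)
open import Data.List.Relation.Unary.Any using (here; there; index)
open import Data.List.Relation.Unary.Any.Properties using (lookup-index)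
open import Data.List.Relation.Unary.Unique.Propositional using (Unique)
open import Data.List.Relation.Unary.Unique.Propositional.Properties using (filter⁺; allFin⁺)
open import Data.Product using (_,_; proj₁; proj₂)
open import Data.Product.Function.NonDependent.Propositional using (_×-↔_)
open import Data.Product.Properties using (≡-dec)
open import Data.Sum using (_⊎_; inj₁; inj₂)
open import Data.Sum.Function.Propositional using (_⊎-↔_)
open import Algebra.Properties.CommutativeMonoid.Sum ℕₚ.+-0-commutativeMonoid
  using (sum; sum-cong-≗; sum-permute; ∑-distrib-+)
open import Function using (_∘_; _↔_; Inverse; Injective; mk↔ₛ′)
open import Function.Properties.Inverse using (↔-refl; ↔-sym; ↔-trans; ↔⇒↣)
open import Relation.Nullary using (¬_; Dec; yes; no; ¬?; _×-dec_; _→-dec_; _⊎-dec_)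
open import Relation.Nullary.Decidable using (toWitness; via-injection)
open import Relation.Binary.PropositionalEquality

-- Orbits of permutations

-- Certificate that `B` indexes the orbits of `π`. Reaching the representative forwards is enough:
-- for a permutation of a finite set, going forwards long enough also goes back.
record Orbits {A : Set} (π : A → A) (B : Set) : Set where
  field
    cls     : A → B
    rep     : B → A
    cls-π   : ∀ a → cls (π a) ≡ cls a
    cls-rep : ∀ b → cls (rep b) ≡ b
    reach   : ∀ a → ∃ λ k → iter π k a ≡ rep (cls a)

  cls-iter : ∀ k a → cls (iter π k a) ≡ cls a
  cls-iter zero    a = refl
  cls-iter (suc k) a = trans (cls-π _) (cls-iter k a)

module _ {A : Set} (π : A → A) where

  iter-+ : ∀ a b x → iter π (a + b) x ≡ iter π a (iter π b x)
  iter-+ zero    b x = refl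
  iter-+ (suc a) b x = cong π (iter-+ a b x)

  iter-injective : Injective _≡_ _≡_ π → ∀ k {x y} → iter π k x ≡ iter π k y → x ≡ y
  iter-injective inj zero    e = e
  iter-injective inj (suc k) e = iter-injective inj k (inj e)

  iter-period : ∀ {p x} → iter π p x ≡ x → ∀ q → iter π (q * p) x ≡ x
  iter-period         e zero    = refl
  iter-period {p} {x} e (suc q) =
    trans (iter-+ p (q * p) x) (trans (cong (iter π p) (iter-period e q)) e)

module FiniteOrbits {m : ℕ} (π : Fin m → Fin m) (inj : Injective _≡_ _≡_ π) where

  -- Two of the first `m + 1` iterates coincide by the pigeonhole principle, and injectivity cancels
  -- their common part.
  period : ∀ d → ∃ λ p → suc p ≤ m × iter π (suc p) d ≡ d
  period d with Finₚ.pigeonhole (ℕₚ.n<1+n m) (λ i → iter π (toℕ i) d)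
  ... | i , j , i<j , e with ℕₚ.m≤n⇒∃[o]m+o≡n i<j
  ... | p , eq = p , bound , sym (iter-injective π inj (toℕ i) (trans e (trans
        (cong (λ n → iter π n d) (trans (sym eq) (sym (ℕₚ.+-suc (toℕ i) p))))
        (iter-+ π (toℕ i) (suc p) d))))
    where
      bound : suc p ≤ m
      bound = ℕₚ.≤-trans (s≤s (ℕₚ.m≤n+m p (toℕ i)))
                (ℕₚ.≤-trans (ℕₚ.≤-reflexive eq) (ℕₚ.≤-pred (Finₚ.toℕ<n j)))

  -- Reduces the exponent modulo the period. The bound matters because `isOrbitMin` inspects only
  -- the first `m` iterates.
  orbit-bound : ∀ {d e} → InOrbit π d e → ∃ λ k → k < m × iter π k d ≡ e
  orbit-bound {d} (k , refl) with period d
  ... | p , p<m , e = k % suc p , ℕₚ.<-≤-trans (m%n<n k (suc p)) p<m , sym (trans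
        (cong (λ n → iter π n d) (m≡m%n+[m/n]*n k (suc p)))
        (trans (iter-+ π (k % suc p) _ d)
               (cong (iter π (k % suc p)) (iter-period π e (k / suc p)))))

  -- With period `suc p`, another `k * p` steps after the first `k` complete `k` full rounds.
  orbit-sym : ∀ {d e} → InOrbit π d e → InOrbit π e d
  orbit-sym {d} (k , refl) with period d
  ... | p , _ , e = k * p , trans (sym (iter-+ π (k * p) k d))
        (trans (cong (λ n → iter π n d) (trans (ℕₚ.+-comm (k * p) k) (sym (ℕₚ.*-suc k p))))
               (iter-period π e k))

orbit-trans : ∀ {m} {π : Fin m → Fin m} {a b c} → InOrbit π a b → InOrbit π b c → InOrbit π a c
orbit-trans {π = π} {a} (k , refl) (l , e) = l + k , trans (iter-+ π l k a) e

allB-sound : ∀ {A : Set} (p : A → Bool) {x} xs → T (allB p xs) → x ∈ xs → T (p x)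
allB-sound p (y ∷ xs) t x∈ with p y in eq
allB-sound p (y ∷ xs) t (here refl) | true = subst T (sym eq) tt
allB-sound p (y ∷ xs) t (there x∈)  | true = allB-sound p xs t x∈
allB-sound p (y ∷ xs) () x∈         | false

allB-complete : ∀ {A : Set} (p : A → Bool) → (∀ x → T (p x)) → ∀ xs → T (allB p xs)
allB-complete p h []       = tt
allB-complete p h (y ∷ xs) with p y | h y
... | true | _ = allB-complete p h xs

lookup-injective : ∀ {A : Set} {xs : List A} → Unique xs →
  ∀ i j → lookup xs i ≡ lookup xs j → i ≡ j
lookup-injective (_ ∷ u)  zero    zero    e = refl
lookup-injective {xs = x ∷ xs} (px ∷ u) zero    (suc j) e = ⊥-elim (All.lookup px (∈-lookup j) e)
lookup-injective {xs = x ∷ xs} (px ∷ u) (suc i) zero    e = ⊥-elim (All.lookup px (∈-lookup i) (sym e))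
lookup-injective (_ ∷ u)  (suc i) (suc j) e = cong suc (lookup-injective u i j e)

least : ∀ {m} (P : Fin m → Set) → (∀ i → Dec (P i)) → ∃ P →
  ∃ λ i → P i × (∀ j → P j → toℕ i ≤ toℕ j)
least {suc m} P P? (i , pi) with P? zero
... | yes p0 = zero , p0 , λ _ _ → z≤n
least {suc m} P P? (zero  , pi) | no ¬p0 = ⊥-elim (¬p0 pi)
least {suc m} P P? (suc i , pi) | no ¬p0 with least (P ∘ suc) (P? ∘ suc) (i , pi)
... | j , pj , min = suc j , pj , λ where
        zero    p0 → ⊥-elim (¬p0 p0)
        (suc k) pk → s≤s (min k pk)

module _ {m n : ℕ} (π : Fin m → Fin m) (inj : Injective _≡_ _≡_ π) (O : Orbits π (Fin n)) where
  open Orbits O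
  open FiniteOrbits π inj

  private
    L : List (Fin m)
    L = filter (λ d → Boolₚ.T? (isOrbitMin π d)) (allFin m)

    unique : Unique L
    unique = filter⁺ (λ d → Boolₚ.T? (isOrbitMin π d)) (allFin⁺ m)

    minimal : ∀ i → T (isOrbitMin π (lookup L i))
    minimal i = proj₂ (∈-filter⁻ (λ d → Boolₚ.T? (isOrbitMin π d)) {xs = allFin m} (∈-lookup i))

    same-class : ∀ {d e} → cls d ≡ cls e → InOrbit π d e
    same-class {d} {e} eq with reach d | reach e
    ... | k , p | l , q = orbit-trans (k , trans p (cong rep eq)) (orbit-sym (l , q))

    min≤ : ∀ {d e} → T (isOrbitMin π d) → cls d ≡ cls e → toℕ d ≤ toℕ e
    min≤ {d} t eq with orbit-bound (same-class eq)
    ... | k , k<m , refl = ℕₚ.≤ᵇ⇒≤ _ _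
          (allB-sound (λ k → toℕ d ≤ᵇ toℕ (iter π k d)) (upTo m) t (∈-upTo⁺ k<m))

    below : length L ≤ n
    below = Finₚ.injective⇒≤ {f = cls ∘ lookup L} λ {i} {j} eq →
      lookup-injective unique i j (Finₚ.toℕ-injective
        (ℕₚ.≤-antisym (min≤ (minimal i) eq) (min≤ (minimal j) (sym eq))))

    minimum : ∀ j → ∃ λ d → cls d ≡ j × d ∈ L
    minimum j with least (λ d → cls d ≡ j) (λ d → cls d Finₚ.≟ j) (rep j , cls-rep j)
    ... | d , refl , min = d , refl , ∈-filter⁺ (λ d → Boolₚ.T? (isOrbitMin π d)) (∈-allFin d)
          (allB-complete _ (λ k → ℕₚ.≤⇒≤ᵇ (min (iter π k d) (cls-iter k d))) (upTo m))

    above : n ≤ length L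
    above = Finₚ.injective⇒≤ {f = λ j → index (proj₂ (proj₂ (minimum j)))} λ {i} {j} eq →
      trans (sym (proj₁ (proj₂ (minimum i)))) (trans
        (cong cls (trans (lookup-index (proj₂ (proj₂ (minimum i)))) (trans (cong (lookup L) eq)
          (sym (lookup-index (proj₂ (proj₂ (minimum j))))))))
        (proj₁ (proj₂ (minimum j))))

  -- The counted list holds exactly the least element of each class. Two listed elements of one
  -- class bound each other, so the list injects into the classes; the least element of a class
  -- passes the test, so the classes inject into the list.
  orbitCount-orbits : orbitCount π ≡ n
  orbitCount-orbits = ℕₚ.≤-antisym below above

conj : ∀ {A B : Set} → A ↔ B → (A → A) → B → B
conj f π b = Inverse.to f (π (Inverse.from f b))

module _ {A B : Set} (f : A ↔ B) where
  open Inverse f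

  iter-conj : ∀ (π : A → A) k b → iter (conj f π) k b ≡ to (iter π k (from b))
  iter-conj π zero    b = sym (strictlyInverseˡ b)
  iter-conj π (suc k) b = cong (to ∘ π) (trans (cong from (iter-conj π k b)) (strictlyInverseʳ _))

  orbits-conj : ∀ {π : A → A} {C D} → C ↔ D → Orbits π C → Orbits (conj f π) D
  orbits-conj {π} g O = record
    { cls = λ b → G.to (O.cls (from b)) ; rep = λ d → to (O.rep (G.from d))
    ; cls-π = λ b → cong G.to (trans (cong O.cls (strictlyInverseʳ _)) (O.cls-π _))
    ; cls-rep = λ d → trans (cong G.to (trans (cong O.cls (strictlyInverseʳ _)) (O.cls-rep _))) (G.strictlyInverseˡ d)
    ; reach = λ b → proj₁ (O.reach (from b)) , trans (iter-conj π (proj₁ (O.reach (from b))) b)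
        (cong to (trans (proj₂ (O.reach (from b))) (cong O.rep (sym (G.strictlyInverseʳ _)))))
    }
    where module O = Orbits O
          module G = Inverse g

-- Plane maps and their medial arrangements

orbits-cong : ∀ {A B : Set} {π π' : A → A} → (∀ a → π a ≡ π' a) → Orbits π B → Orbits π' B
orbits-cong {π = π} {π'} e O = record
  { cls = cls ; rep = rep ; cls-π = λ a → trans (cong cls (sym (e a))) (cls-π a) ; cls-rep = cls-rep
  ; reach = λ a → proj₁ (reach a) , trans (sym (same (proj₁ (reach a)) a)) (proj₂ (reach a)) }
  where
    open Orbits O
    same : ∀ k a → iter π k a ≡ iter π' k a
    same zero    a = refl
    same (suc k) a = trans (e _) (cong π' (same k a))

-- Curves traced by going straight ahead

module Straight {m : ℕ} (σ α : Fin m → Fin m)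
  (σ⁴ : ∀ d → σ (σ (σ (σ d))) ≡ d) (α² : ∀ d → α (α d) ≡ d) where

  adv : Fin m → Fin m
  adv d = σ (σ (α d))

  Same : Fin m → Fin m → Set
  Same d e = InOrbit adv d e ⊎ InOrbit adv (α d) e

  σ-injective : Injective _≡_ _≡_ σ
  σ-injective {x} {y} e = trans (sym (σ⁴ x)) (trans (cong (σ ∘ σ ∘ σ) e) (σ⁴ y))

  α-injective : Injective _≡_ _≡_ α
  α-injective {x} {y} e = trans (sym (α² x)) (trans (cong α e) (α² y))

  adv-injective : Injective _≡_ _≡_ adv
  adv-injective = α-injective ∘ σ-injective ∘ σ-injective

  open FiniteOrbits adv adv-injective

  -- Reversing darts conjugates `adv` to its inverse. This is what makes `Same`, which may reverse
  -- only its first argument, transitive.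
  adv-reverse : ∀ d → adv (α (adv d)) ≡ α d
  adv-reverse d = trans (cong (σ ∘ σ) (α² (adv d))) (σ⁴ (α d))

  reverse-iter : ∀ k d → iter adv k (α (iter adv k d)) ≡ α d
  reverse-iter zero    d = refl
  reverse-iter (suc k) d = trans (shift k _) (trans (cong (iter adv k) (adv-reverse _)) (reverse-iter k d))
    where
      shift : ∀ k x → adv (iter adv k x) ≡ iter adv k (adv x)
      shift zero    x = refl
      shift (suc k) x = cong adv (shift k x)

  orbit-reverse : ∀ {d e} → InOrbit adv d e → InOrbit adv (α e) (α d)
  orbit-reverse {d} (k , refl) = k , reverse-iter k d

  same-refl : ∀ {d} → Same d d
  same-refl = inj₁ (0 , refl)

  same-trans : ∀ {d e f} → Same d e → Same e f → Same d f
  same-trans (inj₁ p) (inj₁ q) = inj₁ (orbit-trans p q)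
  same-trans (inj₁ p) (inj₂ q) = inj₂ (orbit-trans (orbit-sym (orbit-reverse p)) q)
  same-trans (inj₂ p) (inj₁ q) = inj₂ (orbit-trans p q)
  same-trans {d} (inj₂ p) (inj₂ q) =
    inj₁ (orbit-trans (orbit-sym (subst (InOrbit adv _) (α² d) (orbit-reverse p))) q)

  same-α : ∀ {d} → Same d (α d)
  same-α = inj₂ (0 , refl)

  same-adv : ∀ {d} → Same d (adv d)
  same-adv = inj₁ (1 , refl)

-- Arcs carry no direction here: `viaι` continues across the end of the arc at `k`, `viaρ` across
-- its end at `rot k`.
data Zig {K : Set} (rot rot⁻ ι : K → K) : K → K → Set where
  done : ∀ {k} → Zig rot rot⁻ ι k k
  viaι : ∀ {k j} → Zig rot rot⁻ ι (ι k) j → Zig rot rot⁻ ι k j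
  viaρ : ∀ {k j} → Zig rot rot⁻ ι (rot⁻ (ι (rot k))) j → Zig rot rot⁻ ι k j

zig-trans : ∀ {K} {rot rot⁻ ι : K → K} {i j k} →
  Zig rot rot⁻ ι i j → Zig rot rot⁻ ι j k → Zig rot rot⁻ ι i k
zig-trans done     q = q
zig-trans (viaι p) q = viaι (zig-trans p q)
zig-trans (viaρ p) q = viaρ (zig-trans p q)

-- A plane map with darts K: ι joins the two darts of an edge and rot is the
-- next dart around a vertex.  The dart k also names the arc of the medial graph
-- that joins the edges of k and rot k, and lab k is the curve containing it;
-- the two arcs that continue it are ι k and rot⁻ (ι (rot k)).
record PlaneMap : Set₁ where
  field
    K V E F C : Set
    #V #E #F  : ℕ
    K↔ : K ↔ Fin (#E + #E)
    V↔ : V ↔ Fin #V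
    E↔ : E ↔ Fin #E
    F↔ : F ↔ Fin #F
    eulerian : #V + #F ≡ #E + 2
    rot rot⁻ ι : K → K
    rot-rot⁻ : ∀ k → rot (rot⁻ k) ≡ k
    rot⁻-rot : ∀ k → rot⁻ (rot k) ≡ k
    ι-ι      : ∀ k → ι (ι k) ≡ k
    ι-nofix  : ∀ k → ι k ≢ k
    vertices : Orbits rot V
    edges    : Orbits ι E
    faces    : Orbits (λ k → rot⁻ (ι k)) F

  edge : K → E
  edge = Orbits.cls edges

  field
    _≟_    : (a b : C) → Dec (a ≡ b)
    lab    : K → C
    lab-ι  : ∀ k → lab (ι k) ≡ lab k
    lab-ρ  : ∀ k → lab (rot⁻ (ι k)) ≡ lab (rot⁻ k)
    lab-≢  : ∀ k → lab k ≢ lab (rot⁻ k)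
    zig    : ∀ {k j} → lab k ≡ lab j → Zig rot rot⁻ ι k j

  -- The crossing on the edge of `k` lies on the two arcs beside `k`: arc `k` follows it in the
  -- rotation and arc `rot⁻ k` precedes it.
  Meets : C → C → K → Set
  Meets a b k = (lab k ≡ a × lab (rot⁻ k) ≡ b) ⊎ (lab k ≡ b × lab (rot⁻ k) ≡ a)

  field
    two  : ∀ {a b} → a ≢ b → ∀ {i j k} → Meets a b i → Meets a b j → Meets a b k →
           edge i ≡ edge j ⊎ edge i ≡ edge k ⊎ edge j ≡ edge k
    c    : C
    meet : ∀ {a b} → a ≢ b → a ≢ c → b ≢ c → ∃ (Meets a b)
    meet-c : ∃ λ b → b ≢ c × ∃ (Meets c b)

  -- Vertices of the medial graph are edges of the map, and its edges join consecutive edges around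
  -- a vertex; for cubic maps these are the Tait colourings.
  Proper : (n : ℕ) → (K → Fin n) → Set
  Proper n g = (∀ k → g (ι k) ≡ g k) × (∀ k → g (rot k) ≢ g k)

module Medial (M : PlaneMap) where
  open PlaneMap M

  -- `(k , true)` is the dart of arc `k` at the crossing on the edge of `k`, and `(k , false)` the
  -- one at the crossing on the edge of `rot k`.
  D : Set
  D = K × Bool

  σ̂ α̂ : D → D
  σ̂ (k , true)  = rot⁻ (ι k) , false
  σ̂ (k , false) = rot k , true
  α̂ (k , b)     = k , not b

  #D : ℕ
  #D = (#E + #E) * 2

  D↔ : D ↔ Fin #D
  D↔ = ↔-trans (K↔ ×-↔ ↔-sym Finₚ.2↔Bool) (↔-sym Finₚ.*↔×)

  open Inverse D↔

  σ' α' : Fin #D → Fin #D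
  σ' = conj D↔ σ̂
  α' = conj D↔ α̂

  σ̂² : ∀ k → σ̂ (σ̂ (k , true)) ≡ (ι k , true)
  σ̂² k = cong (_, true) (rot-rot⁻ (ι k))

  σ̂⁴ : ∀ d → σ̂ (σ̂ (σ̂ (σ̂ d))) ≡ d
  σ̂⁴ (k , true)  = trans (cong (σ̂ ∘ σ̂) (σ̂² k)) (trans (σ̂² (ι k)) (cong (_, true) (ι-ι k)))
  σ̂⁴ (k , false) = cong (_, false) (trans (cong (rot⁻ ∘ ι) (rot-rot⁻ _)) (trans (cong rot⁻ (ι-ι _)) (rot⁻-rot k)))

  α̂² : ∀ d → α̂ (α̂ d) ≡ d
  α̂² (k , true)  = refl
  α̂² (k , false) = refl

  α̂-nofix : ∀ d → α̂ d ≢ d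
  α̂-nofix (k , true) ()
  α̂-nofix (k , false) ()

  σ̂-nofix : ∀ d → σ̂ d ≢ d
  σ̂-nofix (k , true) ()
  σ̂-nofix (k , false) ()

  σ̂²-nofix : ∀ d → σ̂ (σ̂ d) ≢ d
  σ̂²-nofix (k , true)  e = ι-nofix k (cong proj₁ (trans (sym (σ̂² k)) e))
  σ̂²-nofix (k , false) e = ι-nofix (rot k) (trans (sym (rot-rot⁻ _)) (cong (rot ∘ proj₁) e))

  ft : ∀ d → from (to d) ≡ d
  ft = strictlyInverseʳ

  tf : ∀ x → to (from x) ≡ x
  tf = strictlyInverseˡ

  σ⁴' : ∀ d → σ' (σ' (σ' (σ' d))) ≡ d
  σ⁴' d = trans (iter-conj D↔ σ̂ 4 d) (trans (cong to (σ̂⁴ (from d))) (tf d))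

  α²' : ∀ d → α' (α' d) ≡ d
  α²' d = trans (iter-conj D↔ α̂ 2 d) (trans (cong to (α̂² (from d))) (tf d))

  nofix : ∀ (π : D → D) → (∀ d → π d ≢ d) → ∀ x → to (π (from x)) ≢ x
  nofix π h x e = h (from x) (trans (sym (ft _)) (cong from e))

  open Straight σ' α' σ⁴' α²'

  φ-injective : Injective _≡_ _≡_ (σ' ∘ α')
  φ-injective = α-injective ∘ σ-injective

  edgeOf : D → K
  edgeOf (k , true)  = k
  edgeOf (k , false) = rot k

  private module VO = Orbits vertices
          module EO = Orbits edges
          module FO = Orbits faces

  σ-orbits : Orbits σ̂ E
  σ-orbits = record
    { cls = edge ∘ edgeOf ; rep = λ e → EO.rep e , true ; cls-π = cls-σ ; cls-rep = EO.cls-rep ; reach = reach }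
    where
      cls-σ : ∀ d → edge (edgeOf (σ̂ d)) ≡ edge (edgeOf d)
      cls-σ (k , true)  = trans (cong edge (rot-rot⁻ (ι k))) (EO.cls-π k)
      cls-σ (k , false) = refl
      double : ∀ n k → iter σ̂ (n + n) (k , true) ≡ (iter ι n k , true)
      double zero    k = refl
      double (suc n) k = trans (cong (λ p → iter σ̂ (suc p) (k , true)) (ℕₚ.+-suc n n))
                               (trans (cong (σ̂ ∘ σ̂) (double n k)) (σ̂² _))
      reach : ∀ d → ∃ λ n → iter σ̂ n d ≡ (EO.rep (edge (edgeOf d)) , true)
      reach (k , true) with EO.reach k
      ... | n , e = n + n , trans (double n k) (cong (_, true) e)
      reach (k , false) with EO.reach (rot k)
      ... | n , e = n + n + 1 , trans (iter-+ σ̂ (n + n) 1 (k , false)) (trans (double n (rot k)) (cong (_, true) e))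

  α-orbits : Orbits α̂ K
  α-orbits = record
    { cls = proj₁ ; rep = _, true ; cls-π = λ _ → refl ; cls-rep = λ _ → refl
    ; reach = λ { (k , true) → 0 , refl ; (k , false) → 1 , refl } }

  -- The face permutation preserves the bit: it acts as `rot` on the darts with `true` and as
  -- `rot⁻ ∘ ι` on those with `false`. These are the two colour classes of faces.
  φ-orbits : Orbits (σ̂ ∘ α̂) (V ⊎ F)
  φ-orbits = record
    { cls = cls ; rep = rep
    ; cls-π = λ { (k , true) → cong inj₁ (VO.cls-π k) ; (k , false) → cong inj₂ (FO.cls-π k) }
    ; cls-rep = λ { (inj₁ v) → cong inj₁ (VO.cls-rep v) ; (inj₂ f) → cong inj₂ (FO.cls-rep f) }
    ; reach = λ { (k , true)  → proj₁ (VO.reach k) , trans (sh (proj₁ (VO.reach k)) k) (cong (_, true) (proj₂ (VO.reach k)))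
                ; (k , false) → proj₁ (FO.reach k) , trans (un (proj₁ (FO.reach k)) k) (cong (_, false) (proj₂ (FO.reach k))) } }
    where
      cls : D → V ⊎ F
      cls (k , true)  = inj₁ (VO.cls k)
      cls (k , false) = inj₂ (FO.cls k)
      rep : V ⊎ F → D
      rep (inj₁ v) = VO.rep v , true
      rep (inj₂ f) = FO.rep f , false
      sh : ∀ n k → iter (σ̂ ∘ α̂) n (k , true) ≡ (iter rot n k , true)
      sh zero    k = refl
      sh (suc n) k = cong (σ̂ ∘ α̂) (sh n k)
      un : ∀ n k → iter (σ̂ ∘ α̂) n (k , false) ≡ (iter (rot⁻ ∘ ι) n k , false)
      un zero    k = refl
      un (suc n) k = cong (σ̂ ∘ α̂) (un n k)

  -- The medial map has `#E` vertices, `#E + #E` edges and `#V + #F` faces, so its Euler formula is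
  -- that of the map.
  euler' : orbitCount σ' + orbitCount (λ d → σ' (α' d)) ≡ orbitCount α' + 2
  euler' = begin
    orbitCount σ' + orbitCount (σ' ∘ α')
      ≡⟨ cong₂ _+_ (orbitCount-orbits σ' σ-injective (orbits-conj D↔ E↔ σ-orbits))
                   (orbitCount-orbits (σ' ∘ α') φ-injective
                     (orbits-cong (λ x → cong (to ∘ σ̂) (sym (ft _)))
                       (orbits-conj D↔ (↔-trans (V↔ ⊎-↔ F↔) (↔-sym Finₚ.+↔⊎)) φ-orbits))) ⟩
    #E + (#V + #F)  ≡⟨ cong (#E +_) eulerian ⟩
    #E + (#E + 2)   ≡⟨ sym (ℕₚ.+-assoc #E #E 2) ⟩
    #E + #E + 2     ≡⟨ cong (_+ 2) (sym (orbitCount-orbits α' α-injective (orbits-conj D↔ K↔ α-orbits))) ⟩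
    orbitCount α' + 2 ∎
    where open ≡-Reasoning

  label : Fin #D → C
  label x = lab (proj₁ (from x))

  label-conj : ∀ (π : D → D) → (∀ d → lab (proj₁ (π d)) ≡ lab (proj₁ d)) → ∀ x → label (to (π (from x))) ≡ label x
  label-conj π h x = trans (cong (lab ∘ proj₁) (ft _)) (h (from x))

  label-σ² : ∀ x → label (σ' (σ' x)) ≡ label x
  label-σ² x = trans (cong label (iter-conj D↔ σ̂ 2 x)) (label-conj (σ̂ ∘ σ̂) h x)
    where
      h : ∀ d → lab (proj₁ (σ̂ (σ̂ d))) ≡ lab (proj₁ d)
      h (k , true)  = trans (cong lab (rot-rot⁻ _)) (lab-ι k)
      h (k , false) = trans (lab-ρ (rot k)) (cong lab (rot⁻-rot k))

  label-α : ∀ x → label (α' x) ≡ label x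
  label-α = label-conj α̂ λ _ → refl

  label-orbit : ∀ {x y} → InOrbit adv x y → label y ≡ label x
  label-orbit (zero  , refl) = refl
  label-orbit (suc k , refl) = trans (trans (label-σ² _) (label-α _)) (label-orbit (k , refl))

  label-same : ∀ {x y} → Same x y → label y ≡ label x
  label-same (inj₁ p) = label-orbit p
  label-same (inj₂ p) = trans (label-orbit p) (label-α _)

  label-σ : ∀ x → label (σ' x) ≢ label x
  label-σ x e = h (from x) (trans (sym (cong (lab ∘ proj₁) (ft _))) e)
    where
      h : ∀ d → lab (proj₁ (σ̂ d)) ≢ lab (proj₁ d)
      h (k , true)  e = lab-≢ k (trans (sym e) (lab-ρ k))
      h (k , false) e = lab-≢ (rot k) (trans e (cong lab (sym (rot⁻-rot k))))

  step-adv : ∀ d → Same (to d) (to (σ̂ (σ̂ (α̂ d))))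
  step-adv d = subst (Same (to d)) eq same-adv
    where
      eq : adv (to d) ≡ to (σ̂ (σ̂ (α̂ d)))
      eq = trans (iter-conj D↔ σ̂ 2 _) (cong (to ∘ σ̂ ∘ σ̂) (trans (ft _) (cong α̂ (ft d))))

  step-α : ∀ d → Same (to d) (to (α̂ d))
  step-α d = subst (Same (to d)) (cong (to ∘ α̂) (ft d)) same-α

  zig-same : ∀ {k j} → Zig rot rot⁻ ι k j → Same (to (k , true)) (to (j , true))
  zig-same done = same-refl
  zig-same {k} (viaι p) = same-trans (step-α (k , true)) (same-trans
    (subst (Same (to (k , false)) ∘ to) (σ̂² k) (step-adv (k , false))) (zig-same p))
  zig-same {k} (viaρ p) = same-trans (step-adv (k , true)) (same-trans (step-α _) (zig-same p))

  to-true : ∀ k b → Same (to (k , b)) (to (k , true))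
  to-true k true  = same-refl
  to-true k false = step-α (k , false)

  from-true : ∀ k b → Same (to (k , true)) (to (k , b))
  from-true k true  = same-refl
  from-true k false = step-α (k , true)

  -- Arcs with equal labels are joined by a zigzag, and every zigzag step is a step of `adv` up to
  -- reversal. With `label-same`, labels become a complete invariant of curves, so all conditions on
  -- curves can be checked on labels.
  label⇒same : ∀ {x y} → label x ≡ label y → Same x y
  label⇒same {x} {y} e = subst₂ Same (tf x) (tf y)
    (same-trans (to-true _ _) (same-trans (zig-same (zig e)) (from-true _ _)))

  has : C → K → Set
  has a k = lab k ≡ a ⊎ lab (rot⁻ k) ≡ a

  has-ι : ∀ {a k} → has a (ι k) → has a k
  has-ι {k = k} (inj₁ e) = inj₁ (trans (sym (lab-ι k)) e)
  has-ι {k = k} (inj₂ e) = inj₂ (trans (sym (lab-ρ k)) e)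

  has-σ : ∀ {a} n x → has a (edgeOf (from (iter σ' n x))) → has a (edgeOf (from x))
  has-σ zero    x h = h
  has-σ {a} (suc n) x h = has-σ n x (lower (from (iter σ' n x)) (subst (has a ∘ edgeOf) (ft _) h))
    where
      lower : ∀ d → has a (edgeOf (σ̂ d)) → has a (edgeOf d)
      lower (k , true)  h = has-ι (subst (has a) (rot-rot⁻ _) h)
      lower (k , false) h = h

  has-label : ∀ x → has (label x) (edgeOf (from x))
  has-label x = h (from x)
    where
      h : ∀ d → has (lab (proj₁ d)) (edgeOf d)
      h (k , true)  = inj₁ refl
      h (k , false) = inj₂ (cong lab (rot⁻-rot k))

  has⇒meets : ∀ {a b k} → a ≢ b → has a k → has b k → Meets a b k
  has⇒meets ne (inj₁ p) (inj₁ q) = ⊥-elim (ne (trans (sym p) q))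
  has⇒meets ne (inj₁ p) (inj₂ q) = inj₁ (p , q)
  has⇒meets ne (inj₂ p) (inj₁ q) = inj₂ (q , p)
  has⇒meets ne (inj₂ p) (inj₂ q) = ⊥-elim (ne (trans (sym p) q))

  MeetsAt : Fin #D → Fin #D → Fin #D → Set
  MeetsAt d e x = ∃ λ a → ∃ λ b → Same d a × Same e b × InOrbit σ' x a × InOrbit σ' x b

  meetsAt⇒meets : ∀ {d e x} → label d ≢ label e → MeetsAt d e x → Meets (label d) (label e) (edgeOf (from x))
  meetsAt⇒meets {d} {e} {x} ne (a , b , da , eb , (k , refl) , (l , refl)) = has⇒meets ne
    (subst (λ z → has z (edgeOf (from x))) (label-same da) (has-σ k x (has-label a)))
    (subst (λ z → has z (edgeOf (from x))) (label-same eb) (has-σ l x (has-label b)))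

  same-vertex : ∀ {x y} → edge (edgeOf (from x)) ≡ edge (edgeOf (from y)) → InOrbit σ' x y
  same-vertex {x} {y} e = orbit-trans (reach' x) (subst (λ z → InOrbit σ' z y) (sym eq) (σO.orbit-sym (reach' y)))
    where
      module σO = FiniteOrbits σ' σ-injective
      rep = λ x → to (EO.rep (edge (edgeOf (from x))) , true)
      eq : rep x ≡ rep y
      eq = cong (λ z → to (EO.rep z , true)) e
      reach' : ∀ x → InOrbit σ' x (rep x)
      reach' x with Orbits.reach σ-orbits (from x)
      ... | n , e = n , trans (iter-conj D↔ σ̂ n x) (cong to e)

  reach-trans : ∀ {a b d} → Reach σ' α' a b → Reach σ' α' b d → Reach σ' α' a d
  reach-trans here      q = q
  reach-trans (stepσ p) q = stepσ (reach-trans p q)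
  reach-trans (stepα p) q = stepα (reach-trans p q)

  reach-orbit : ∀ {x y} → InOrbit adv x y → Reach σ' α' x y
  reach-orbit (zero  , refl) = here
  reach-orbit (suc k , refl) = reach-trans (reach-orbit (k , refl)) (stepα (stepσ (stepσ here)))

  reach-same : ∀ {x y} → Same x y → Reach σ' α' x y
  reach-same (inj₁ p) = reach-orbit p
  reach-same (inj₂ p) = stepα (reach-orbit p)

  reach-label : ∀ {x y} → label x ≡ label y → Reach σ' α' x y
  reach-label e = reach-same (label⇒same e)

  reach-meets : ∀ {x y} → ∃ (Meets (label x) (label y)) → Reach σ' α' x y
  reach-meets {x} {y} (k , inj₁ (p , q)) = reach-trans
    (reach-label {y = to (k , true)} (trans (sym p) (cong (lab ∘ proj₁) (sym (ft _)))))
    (stepσ (reach-label (trans (cong (lab ∘ proj₁) (trans (ft _) (cong σ̂ (ft _)))) (trans (lab-ρ k) q))))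
  reach-meets {x} {y} (k , inj₂ (p , q)) = reach-trans
    (reach-label {y = to (rot⁻ k , false)} (trans (sym q) (cong (lab ∘ proj₁) (sym (ft _)))))
    (stepσ (reach-label (trans (cong (lab ∘ proj₁) (trans (ft _) (cong σ̂ (ft _)))) (trans (cong lab (rot-rot⁻ k)) p))))

  swap-meets : ∀ {a b} → ∃ (Meets a b) → ∃ (Meets b a)
  swap-meets (k , inj₁ p) = k , inj₂ p
  swap-meets (k , inj₂ p) = k , inj₁ p

  labelled : ∀ {a b} → ∃ (Meets a b) → ∃ λ x → label x ≡ b
  labelled (k , inj₁ (p , q)) = to (rot⁻ k , true) , trans (cong (lab ∘ proj₁) (ft _)) q
  labelled (k , inj₂ (p , q)) = to (k , true) , trans (cong (lab ∘ proj₁) (ft _)) p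

  -- A curve other than `c` that meets `c` meets all curves; connectedness follows by routing
  -- everything through it.
  hub : Fin #D
  hub = proj₁ (labelled (proj₂ (proj₂ meet-c)))

  label-hub : label hub ≡ proj₁ meet-c
  label-hub = proj₂ (labelled (proj₂ (proj₂ meet-c)))

  near : ∀ x → label x ≡ label hub ⊎ ∃ (Meets (label x) (label hub))
  near x with label x ≟ label hub
  ... | yes e = inj₁ e
  ... | no ne with label x ≟ c
  ...   | yes e  = inj₂ (subst₂ (λ a b → ∃ (Meets a b)) (sym e) (sym label-hub) (proj₂ (proj₂ meet-c)))
  ...   | no ne' = inj₂ (meet ne ne' (λ e → proj₁ (proj₂ meet-c) (trans (sym label-hub) e)))

  connected' : ∀ x y → Reach σ' α' x y
  connected' x y = reach-trans (in-hub (near x)) (out-hub (near y))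
    where
      in-hub : label x ≡ label hub ⊎ ∃ (Meets (label x) (label hub)) → Reach σ' α' x hub
      in-hub (inj₁ e) = reach-label e
      in-hub (inj₂ e) = reach-meets e
      out-hub : label y ≡ label hub ⊎ ∃ (Meets (label y) (label hub)) → Reach σ' α' hub y
      out-hub (inj₁ e) = reach-label (sym e)
      out-hub (inj₂ e) = reach-meets (swap-meets e)

  arrangement : ArrangementMap #D
  arrangement = record
    { σ = σ' ; α = α' ; α-invol = α²' ; α-nofix = nofix α̂ α̂-nofix ; σ⁴ = σ⁴'
    ; σ-nofix = nofix σ̂ σ̂-nofix
    ; σ²-nofix = λ d e → nofix (σ̂ ∘ σ̂) σ̂²-nofix d (trans (sym (iter-conj D↔ σ̂ 2 d)) e)
    ; connected = connected' ; euler = euler'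
    ; cross-distinct = λ d s → label-σ d (label-same s)
    ; at-most-twice = λ d e ¬s (x , y , z , mx , my , mz , ¬xy , ¬xz , ¬yz) →
        let ne = λ eq → ¬s (label⇒same eq)
            m = λ {w} → meetsAt⇒meets {d} {e} {w} ne in
        case (two ne (m mx) (m my) (m mz)) (¬xy ∘ same-vertex) (¬xz ∘ same-vertex) (¬yz ∘ same-vertex)
    }
    where
      case : {A B G : Set} → A ⊎ B ⊎ G → ¬ A → ¬ B → ¬ G → ⊥
      case (inj₁ a)        f g h = f a
      case (inj₂ (inj₁ b)) f g h = g b
      case (inj₂ (inj₂ d)) f g h = h d

  intersecting : IntersectingPlusOne arrangement
  intersecting = ĉ , λ d e ¬dc ¬ec ¬de →
    at (meet (λ eq → ¬de (label⇒same eq)) (λ eq → ¬dc (label⇒same (trans eq (sym label-ĉ))))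
             (λ eq → ¬ec (label⇒same (trans eq (sym label-ĉ)))))
    where
      ĉ : Fin #D
      ĉ = proj₁ (labelled (swap-meets (proj₂ (proj₂ meet-c))))
      label-ĉ : label ĉ ≡ c
      label-ĉ = proj₂ (labelled (swap-meets (proj₂ (proj₂ meet-c))))
      label-to : ∀ d {a} → lab (proj₁ d) ≡ a → label (to d) ≡ a
      label-to d e = trans (cong (lab ∘ proj₁) (ft d)) e
      next : ∀ k → label (σ' (to (k , true))) ≡ lab (rot⁻ k)
      next k = trans (cong (lab ∘ proj₁) (trans (ft _) (cong σ̂ (ft _)))) (lab-ρ k)
      at : ∀ {d e} → ∃ (Meets (label d) (label e)) → ∃ (MeetAt arrangement d e)
      at (k , inj₁ (p , q)) = to (k , true) , to (k , true) , σ' (to (k , true)) ,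
        label⇒same (sym (label-to (k , true) p)) , label⇒same (sym (trans (next k) q)) , (0 , refl) , (1 , refl)
      at (k , inj₂ (p , q)) = to (k , true) , σ' (to (k , true)) , to (k , true) ,
        label⇒same (sym (trans (next k) q)) , label⇒same (sym (label-to (k , true) p)) , (1 , refl) , (0 , refl)

  colourable : ∀ {n} → ∃ (Proper n) → Colourable arrangement n
  colourable (g , g-ι , g-rot) = col ∘ from ,
    (λ x → trans (cong col (ft _)) (col-σ (from x))) , (λ x e → col-α (from x) (trans (sym (cong col (ft _))) e))
    where
      col : D → _
      col = g ∘ edgeOf
      col-σ : ∀ d → col (σ̂ d) ≡ col d
      col-σ (k , true)  = trans (cong g (rot-rot⁻ _)) (g-ι k)
      col-σ (k , false) = refl
      col-α : ∀ d → col (α̂ d) ≢ col d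
      col-α (k , true)  e = g-rot k e
      col-α (k , false) e = g-rot k (sym e)

  colourable⁻¹ : ∀ {n} → Colourable arrangement n → ∃ (Proper n)
  colourable⁻¹ (f , f-σ , f-α) = (λ k → f (to (k , true))) ,
    (λ k → trans (cong f (sym (trans (iter-conj D↔ σ̂ 2 _) (trans (cong (to ∘ σ̂ ∘ σ̂) (ft _)) (cong to (σ̂² k)))))) (trans (f-σ _) (f-σ _))) ,
    (λ k e → f-α (to (k , true)) (trans (trans (sym (f-σ _)) (cong f (cong (to ∘ σ̂) (trans (ft _) (cong α̂ (ft _)))))) e))

  -- Fewer than four colours embed into three, so excluding three excludes them all.
  chromatic : ∃ (Proper 4) → ¬ ∃ (Proper 3) → ChromaticNumber arrangement 4
  chromatic four ¬three = colourable four , λ j j<4 (f , f-σ , f-α) → ¬three (colourable⁻¹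
    ((λ d → inject≤ (f d) (ℕₚ.≤-pred j<4)) , (λ d → cong (λ x → inject≤ x (ℕₚ.≤-pred j<4)) (f-σ d)) ,
     (λ d e → f-α d (Finₚ.inject≤-injective (ℕₚ.≤-pred j<4) (ℕₚ.≤-pred j<4) _ _ e))))

-- Saturated maps and their doubling

r r⁻ : Fin 3 → Fin 3
r 0F = 1F
r 1F = 2F
r 2F = 0F
r⁻ 0F = 2F
r⁻ 1F = 0F
r⁻ 2F = 1F

r-r⁻ : ∀ i → r (r⁻ i) ≡ i
r-r⁻ 0F = refl
r-r⁻ 1F = refl
r-r⁻ 2F = refl

r⁻-r : ∀ i → r⁻ (r i) ≡ i
r⁻-r 0F = refl
r⁻-r 1F = refl
r⁻-r 2F = refl

r-r : ∀ i → r (r i) ≡ r⁻ i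
r-r 0F = refl
r-r 1F = refl
r-r 2F = refl

r⁻-r⁻ : ∀ i → r⁻ (r⁻ i) ≡ r i
r⁻-r⁻ 0F = refl
r⁻-r⁻ 1F = refl
r⁻-r⁻ 2F = refl

-- An arc of a zigzag at one of its ends.  The arc from k to turn k is traversed
-- in this direction if orient holds; side tells apart the two parts into which
-- the marked vertices divide the zigzag.  Among its two parallel copies, the one
-- called sign is nearer to the vertex of k; hence the name of the inner copy.
record Attr (C : Set) : Set where
  constructor attr
  field
    name   : C
    orient : Bool
    side   : Bool

  sign : Bool
  sign = orient xor side

open Attr

reverse twist : ∀ {C} → Attr C → Attr C
reverse (attr c o s) = attr c (not o) s
twist   (attr c o s) = attr c o (not s)

inner outer : ∀ {C} → Attr C → Attr (C × Bool)
inner b = attr (name b , sign b) (orient b) (side b)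
outer b = attr (name b , not (sign b)) (orient b) (side b)

reverse² : ∀ {C} (b : Attr C) → reverse (reverse b) ≡ b
reverse² (attr c true  s) = refl
reverse² (attr c false s) = refl

-- A zigzag bends in opposite directions at the two ends of an edge, so the copy nearer to one end
-- is farther from the other.
inner-reverse : ∀ {C} (b : Attr C) → inner (reverse b) ≡ reverse (outer b)
inner-reverse (attr c true  true)  = refl
inner-reverse (attr c true  false) = refl
inner-reverse (attr c false true)  = refl
inner-reverse (attr c false false) = refl

outer-reverse : ∀ {C} (b : Attr C) → outer (reverse b) ≡ reverse (inner b)
outer-reverse (attr c true  true)  = refl
outer-reverse (attr c true  false) = refl
outer-reverse (attr c false true)  = refl
outer-reverse (attr c false false) = refl

-- The other way to exchange the roles: passing a marked arc, where the two copies cross.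
inner-twist : ∀ {C} (b : Attr C) → inner (twist b) ≡ twist (outer b)
inner-twist (attr c true  true)  = refl
inner-twist (attr c true  false) = refl
inner-twist (attr c false true)  = refl
inner-twist (attr c false false) = refl

outer-twist : ∀ {C} (b : Attr C) → outer (twist b) ≡ twist (inner b)
outer-twist (attr c true  true)  = refl
outer-twist (attr c true  false) = refl
outer-twist (attr c false true)  = refl
outer-twist (attr c false false) = refl

sign-reverse : ∀ {C} (b : Attr C) → sign (reverse b) ≡ not (sign b)
sign-reverse b = cong (proj₂ ∘ name) (inner-reverse b)

sign-twist : ∀ {C} (b : Attr C) → sign (twist b) ≡ not (sign b)
sign-twist b = cong (proj₂ ∘ name) (inner-twist b)

not-≢ : ∀ {b} → b ≢ not b
not-≢ {true}  ()
not-≢ {false} ()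

module _ {A : Set} (π : A → A) where

  Leads : A → A → Set
  Leads a b = ∃ λ k → iter π k a ≡ b

  leads-trans : ∀ {a b c} → Leads a b → Leads b c → Leads a c
  leads-trans {a} (k , refl) (l , e) = l + k , trans (iter-+ π l k a) e

-- Every iterate of an involution is the identity or `ι`, so a class has at most two elements.
involution-class : ∀ {K E : Set} {ι : K → K} → (∀ k → ι (ι k) ≡ k) → (O : Orbits ι E) →
  ∀ {j k} → Orbits.cls O j ≡ Orbits.cls O k → j ≡ k ⊎ j ≡ ι k
involution-class {ι = ι} ι-ι O {j} {k} e = compare (pos j (proj₁ (reach j)) (proj₂ (reach j))) (pos k (proj₁ (reach k)) (proj₂ (reach k)))
  where
    open Orbits O
    pos : ∀ j n {x} → iter ι n j ≡ x → j ≡ x ⊎ j ≡ ι x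
    pos j zero refl = inj₁ refl
    pos j (suc n) refl with pos j n refl
    ... | inj₁ e = inj₂ (trans e (sym (ι-ι _)))
    ... | inj₂ e = inj₁ e
    flip : ∀ {x y} → x ≡ ι y → y ≡ ι x
    flip e = trans (sym (ι-ι _)) (cong ι (sym e))
    compare : j ≡ rep (cls j) ⊎ j ≡ ι (rep (cls j)) → k ≡ rep (cls k) ⊎ k ≡ ι (rep (cls k)) → j ≡ k ⊎ j ≡ ι k
    compare p q rewrite e with p | q
    ... | inj₁ p | inj₁ q = inj₁ (trans p (sym q))
    ... | inj₁ p | inj₂ q = inj₂ (trans p (flip q))
    ... | inj₂ p | inj₁ q = inj₂ (trans p (cong ι (sym q)))
    ... | inj₂ p | inj₂ q = inj₁ (trans p (sym q))

module _ {K : Set} {rot rot⁻ ι : K → K} (ι-ι : ∀ k → ι (ι k) ≡ k)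
         (rot-rot⁻ : ∀ k → rot (rot⁻ k) ≡ k) (rot⁻-rot : ∀ k → rot⁻ (rot k) ≡ k) where
  -- Both moves are involutions, so a walk can be retraced.
  zig-sym : ∀ {j k} → Zig rot rot⁻ ι j k → Zig rot rot⁻ ι k j
  zig-sym done = done
  zig-sym {j} (viaι p) = zig-trans (zig-sym p) (viaι (subst (λ x → Zig rot rot⁻ ι x j) (sym (ι-ι j)) done))
  zig-sym {j} (viaρ p) = zig-trans (zig-sym p) (viaρ (subst (λ x → Zig rot rot⁻ ι x j)
    (sym (trans (cong (rot⁻ ∘ ι) (rot-rot⁻ _)) (trans (cong rot⁻ (ι-ι _)) (rot⁻-rot j)))) done))

Triangles : Set → Set → Set
Triangles Y X = (Y ⊎ X) × Fin 3

turn turn⁻ : ∀ {T : Set} → T × Fin 3 → T × Fin 3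
turn  (t , i) = t , r i
turn⁻ (t , i) = t , r⁻ i

turn-turn⁻ : ∀ {T : Set} (k : T × Fin 3) → turn (turn⁻ k) ≡ k
turn-turn⁻ (t , i) = cong (t ,_) (r-r⁻ i)

turn⁻-turn : ∀ {T : Set} (k : T × Fin 3) → turn⁻ (turn k) ≡ k
turn⁻-turn (t , i) = cong (t ,_) (r⁻-r i)

turn-turn : ∀ {T : Set} (k : T × Fin 3) → turn (turn k) ≡ turn⁻ k
turn-turn (t , i) = cong (t ,_) (r-r i)

turn⁻-turn⁻ : ∀ {T : Set} (k : T × Fin 3) → turn⁻ (turn⁻ k) ≡ turn k
turn⁻-turn⁻ (t , i) = cong (t ,_) (r⁻-r⁻ i)

pattern plain y i  = inj₁ y , i
pattern marked x i = inj₂ x , i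

-- A cubic plane map whose zigzags cross pairwise exactly twice.  The vertices
-- in X are marked so that every zigzag has exactly two arcs at marked vertices;
-- there its two parallel copies will cross.
record Saturated : Set₁ where
  field
    Y X E F C : Set
    #Y #X #E #F : ℕ
    Y↔ : Y ↔ Fin #Y
    X↔ : X ↔ Fin #X
    E↔ : E ↔ Fin #E
    F↔ : F ↔ Fin #F
    eulerian  : #Y + #X + #F ≡ #E + 2
    handshake : #E + #E ≡ (#Y + #X) * 3

  K : Set
  K = Triangles Y X

  field
    ι     : K → K
    ι-ι   : ∀ k → ι (ι k) ≡ k
    edges : Orbits ι E
    faces : Orbits (turn⁻ ∘ ι) F
    _≟_   : (a b : C) → Dec (a ≡ b)
    -- start k describes the arc from k to turn k at k, end k the arc from turn⁻ k to k at k
    start end : K → Attr C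
    start-ι    : ∀ k → start (ι k) ≡ reverse (start k)
    end-ι      : ∀ k → end (ι k) ≡ reverse (end k)
    end-plain  : ∀ y i → end (plain y (r i)) ≡ start (plain y i)
    end-marked : ∀ x i → end (marked x (r i)) ≡ twist (start (marked x i))

  edge : K → E
  edge = Orbits.cls edges

  before : K → C
  before k = name (end k)

  after : K → C
  after k = name (start k)

  Meets : C → C → K → Set
  Meets a b k = (after k ≡ a × before k ≡ b) ⊎ (after k ≡ b × before k ≡ a)

  field
    cross : ∀ k → after k ≢ before k
    zig   : ∀ {k j} → after k ≡ after j → Zig turn turn⁻ ι k j
    two   : ∀ {a b} → a ≢ b → ∀ {i j k} → Meets a b i → Meets a b j → Meets a b k →
            edge i ≡ edge j ⊎ edge i ≡ edge k ⊎ edge j ≡ edge k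
    meet  : ∀ {a b} → a ≢ b → ∃ (Meets a b)
    -- The copies of a zigzag will cross at its marked arcs: at most two of these means at most two
    -- crossings, and having one means that the copies intersect.
    two-marked  : ∀ {a x y z i j k} → after (marked x i) ≡ a → after (marked y j) ≡ a → after (marked z k) ≡ a →
                  (x , i) ≡ (y , j) ⊎ (x , i) ≡ (z , k) ⊎ (y , j) ≡ (z , k)
    some-marked : ∀ a → ∃ λ x → ∃ λ i → after (marked x i) ≡ a
    colour      : K → Fin 4
    colour-ι    : ∀ k → colour (ι k) ≡ colour k
    colour-turn : ∀ k → colour (turn k) ≢ colour k
    -- After doubling, the face in place of this edge is the pentagon to be encircled.
    seam : ∃ λ y → ∃ λ i → ∃ λ x → ∃ λ j → ι (plain y i) ≡ marked x j

  after-ι : ∀ k → after (ι k) ≡ after k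
  after-ι k = cong name (start-ι k)

  before-ι : ∀ k → before (ι k) ≡ before k
  before-ι k = cong name (end-ι k)

  before-turn : ∀ k → before (turn k) ≡ after k
  before-turn (plain y i)  = cong name (end-plain y i)
  before-turn (marked x i) = cong name (end-marked x i)

abstract
  -- Abstract, so that a chosen colour stays opaque and is known only through its three
  -- inequalities.
  free : ∀ a b c → ∃ λ (d : Fin 4) → d ≢ a × d ≢ b × d ≢ c
  free = toWitness {a? = Finₚ.all? λ a → Finₚ.all? λ b → Finₚ.all? λ c → Finₚ.any? λ d →
    ¬? (d Finₚ.≟ a) ×-dec ¬? (d Finₚ.≟ b) ×-dec ¬? (d Finₚ.≟ c)} _

avoid : Fin 4 → Fin 4 → Fin 4 → Fin 4
avoid-≢ : ∀ a b c → avoid a b c ≢ a × avoid a b c ≢ b × avoid a b c ≢ c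

avoid a b c = proj₁ (free a b c)
avoid-≢ a b c = proj₂ (free a b c)

module Doubling (S : Saturated) where
  open Saturated S

  -- The darts of the doubled map.  Every corner of a plain vertex y is cut off
  -- by a new vertex with darts sD (towards y), eD and nD (parallel to the two
  -- old darts at that corner); cD are the remaining darts at y.  A marked vertex
  -- becomes a hexagon, with two new vertices in every corner: one has the darts
  -- eD, p1, z1 and the other has nD, z2, p2.
  data Dart : Set where
    eD nD : K → Dart
    cD sD : Y → Fin 3 → Dart
    p1 p2 z1 z2 : X → Fin 3 → Dart

  -- An old edge becomes two parallel edges: `eD k` leaves corner `k` along the edge of `k` and
  -- arrives as the `nD` dart of the corner just before `ι k`. Around a hexagon the `p` edges and
  -- the `z` edges alternate.
  spin spin⁻ flip : Dart → Dart
  spin (eD (plain y i))  = nD (plain y i)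
  spin (eD (marked x i)) = p1 x i
  spin (nD (plain y i))  = sD y i
  spin (nD (marked x i)) = z2 x i
  spin (cD y i) = cD y (r i)
  spin (sD y i) = eD (plain y i)
  spin (p1 x i) = z1 x i
  spin (p2 x i) = nD (marked x i)
  spin (z1 x i) = eD (marked x i)
  spin (z2 x i) = p2 x i

  spin⁻ (eD (plain y i))  = sD y i
  spin⁻ (eD (marked x i)) = z1 x i
  spin⁻ (nD (plain y i))  = eD (plain y i)
  spin⁻ (nD (marked x i)) = p2 x i
  spin⁻ (cD y i) = cD y (r⁻ i)
  spin⁻ (sD y i) = nD (plain y i)
  spin⁻ (p1 x i) = eD (marked x i)
  spin⁻ (p2 x i) = z2 x i
  spin⁻ (z1 x i) = p1 x i
  spin⁻ (z2 x i) = nD (marked x i)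

  flip (eD k)   = nD (turn⁻ (ι k))
  flip (nD k)   = eD (ι (turn k))
  flip (cD y i) = sD y i
  flip (sD y i) = cD y i
  flip (p1 x i) = p2 x i
  flip (p2 x i) = p1 x i
  flip (z1 x i) = z2 x (r⁻ i)
  flip (z2 x i) = z1 x (r i)

  spin-spin⁻ : ∀ j → spin (spin⁻ j) ≡ j
  spin-spin⁻ (eD (plain y i))  = refl
  spin-spin⁻ (eD (marked x i)) = refl
  spin-spin⁻ (nD (plain y i))  = refl
  spin-spin⁻ (nD (marked x i)) = refl
  spin-spin⁻ (cD y i) = cong (cD y) (r-r⁻ i)
  spin-spin⁻ (sD y i) = refl
  spin-spin⁻ (p1 x i) = refl
  spin-spin⁻ (p2 x i) = refl
  spin-spin⁻ (z1 x i) = refl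
  spin-spin⁻ (z2 x i) = refl

  spin⁻-spin : ∀ j → spin⁻ (spin j) ≡ j
  spin⁻-spin (eD (plain y i))  = refl
  spin⁻-spin (eD (marked x i)) = refl
  spin⁻-spin (nD (plain y i))  = refl
  spin⁻-spin (nD (marked x i)) = refl
  spin⁻-spin (cD y i) = cong (cD y) (r⁻-r i)
  spin⁻-spin (sD y i) = refl
  spin⁻-spin (p1 x i) = refl
  spin⁻-spin (p2 x i) = refl
  spin⁻-spin (z1 x i) = refl
  spin⁻-spin (z2 x i) = refl

  flip-flip : ∀ j → flip (flip j) ≡ j
  flip-flip (eD k)   = cong eD (trans (cong ι (turn-turn⁻ _)) (ι-ι k))
  flip-flip (nD k)   = cong nD (trans (cong turn⁻ (ι-ι _)) (turn⁻-turn k))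
  flip-flip (cD y i) = refl
  flip-flip (sD y i) = refl
  flip-flip (p1 x i) = refl
  flip-flip (p2 x i) = refl
  flip-flip (z1 x i) = cong (z1 x) (r-r⁻ i)
  flip-flip (z2 x i) = cong (z2 x) (r⁻-r i)

  -- In the parallel copies the side changes at the new marked vertices instead
  -- of at the crossing of p1 and p2, whence the twists.
  startP endP startZ endZ : X → Fin 3 → Attr (C × Bool)
  startP x 0F = reverse (twist (inner (start (marked x 0F))))
  startP x 1F = reverse (twist (inner (start (marked x 1F))))
  startP x 2F = reverse (inner (start (marked x 2F)))
  endP x 0F = outer (start (marked x 0F))
  endP x 1F = twist (outer (start (marked x 1F)))
  endP x 2F = outer (start (marked x 2F))
  startZ x 0F = reverse (outer (start (marked x 0F)))
  startZ x 1F = reverse (twist (outer (start (marked x 1F))))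
  startZ x 2F = reverse (twist (outer (start (marked x 2F))))
  endZ x 0F = inner (start (marked x 1F))
  endZ x 1F = inner (start (marked x 2F))
  endZ x 2F = twist (inner (start (marked x 0F)))

  startD endD : Dart → Attr (C × Bool)
  startD (eD k)   = outer (start k)
  startD (nD k)   = inner (start (turn k))
  startD (cD y i) = reverse (inner (start (plain y (r⁻ i))))
  startD (sD y i) = inner (start (plain y (r⁻ i)))
  startD (p1 x i) = startP x i
  startD (p2 x i) = reverse (startP x i)
  startD (z1 x i) = reverse (startZ x (r⁻ i))
  startD (z2 x i) = startZ x i
  endD (eD k)   = inner (end k)
  endD (nD k)   = outer (end (turn k))
  endD (cD y i) = reverse (inner (start (plain y (r i))))
  endD (sD y i) = inner (start (plain y (r i)))
  endD (p1 x i) = endP x i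
  endD (p2 x i) = reverse (endP x i)
  endD (z1 x i) = reverse (endZ x (r⁻ i))
  endD (z2 x i) = endZ x i

  startD-flip : ∀ j → startD (flip j) ≡ reverse (startD j)
  startD-flip (eD k)   = trans (cong (inner ∘ start) (turn-turn⁻ (ι k))) (trans (cong inner (start-ι k)) (inner-reverse (start k)))
  startD-flip (nD k)   = trans (cong outer (start-ι (turn k))) (outer-reverse (start (turn k)))
  startD-flip (cD y i) = sym (reverse² _)
  startD-flip (sD y i) = refl
  startD-flip (p1 x i) = refl
  startD-flip (p2 x i) = sym (reverse² _)
  startD-flip (z1 x i) = sym (reverse² _)
  startD-flip (z2 x i) = cong (reverse ∘ startZ x) (r⁻-r i)

  endD-flip : ∀ j → endD (flip j) ≡ reverse (endD j)
  endD-flip (eD k)   = trans (cong (outer ∘ end) (turn-turn⁻ (ι k))) (trans (cong outer (end-ι k)) (outer-reverse (end k)))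
  endD-flip (nD k)   = trans (cong inner (end-ι (turn k))) (inner-reverse (end (turn k)))
  endD-flip (cD y i) = sym (reverse² _)
  endD-flip (sD y i) = refl
  endD-flip (p1 x i) = refl
  endD-flip (p2 x i) = sym (reverse² _)
  endD-flip (z1 x i) = sym (reverse² _)
  endD-flip (z2 x i) = cong (reverse ∘ endZ x) (r⁻-r i)

  -- The three arcs at an old marked vertex have six copies in all, so two of the six hexagon
  -- vertices have to be marked again. The opposite corners `hex11` and `hex22` work: among the six
  -- arcs there, each copy occurs once.
  Y' X' : Set
  Y' = Y ⊎ (Y × Fin 3) ⊎ (X × Fin 4)
  X' = X × Fin 2

  K' : Set
  K' = Triangles Y' X'

  pattern centre y = inj₁ (inj₁ y)
  pattern corner y i = inj₁ (inj₂ (inj₁ (y , i)))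
  pattern hex01 x = inj₁ (inj₂ (inj₂ (x , 0F)))
  pattern hex02 x = inj₁ (inj₂ (inj₂ (x , 1F)))
  pattern hex12 x = inj₁ (inj₂ (inj₂ (x , 2F)))
  pattern hex21 x = inj₁ (inj₂ (inj₂ (x , 3F)))
  pattern hex11 x = inj₂ (x , 0F)
  pattern hex22 x = inj₂ (x , 1F)

  dart : K' → Dart
  dart (centre y , i)    = cD y i
  dart (corner y i , 0F) = sD y i
  dart (corner y i , 1F) = eD (plain y i)
  dart (corner y i , 2F) = nD (plain y i)
  dart (hex01 x , 0F) = eD (marked x 0F)
  dart (hex01 x , 1F) = p1 x 0F
  dart (hex01 x , 2F) = z1 x 0F
  dart (hex11 x , 0F) = eD (marked x 1F)
  dart (hex11 x , 1F) = p1 x 1F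
  dart (hex11 x , 2F) = z1 x 1F
  dart (hex21 x , 0F) = eD (marked x 2F)
  dart (hex21 x , 1F) = p1 x 2F
  dart (hex21 x , 2F) = z1 x 2F
  dart (hex02 x , 0F) = nD (marked x 0F)
  dart (hex02 x , 1F) = z2 x 0F
  dart (hex02 x , 2F) = p2 x 0F
  dart (hex12 x , 0F) = nD (marked x 1F)
  dart (hex12 x , 1F) = z2 x 1F
  dart (hex12 x , 2F) = p2 x 1F
  dart (hex22 x , 0F) = nD (marked x 2F)
  dart (hex22 x , 1F) = z2 x 2F
  dart (hex22 x , 2F) = p2 x 2F

  hex1 hex2 : X → Fin 3 → Y' ⊎ X'
  hex1 x 0F = hex01 x
  hex1 x 1F = hex11 x
  hex1 x 2F = hex21 x
  hex2 x 0F = hex02 x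
  hex2 x 1F = hex12 x
  hex2 x 2F = hex22 x

  dart⁻ : Dart → K'
  dart⁻ (eD (plain y i))  = corner y i , 1F
  dart⁻ (eD (marked x i)) = hex1 x i , 0F
  dart⁻ (nD (plain y i))  = corner y i , 2F
  dart⁻ (nD (marked x i)) = hex2 x i , 0F
  dart⁻ (cD y i) = centre y , i
  dart⁻ (sD y i) = corner y i , 0F
  dart⁻ (p1 x i) = hex1 x i , 1F
  dart⁻ (p2 x i) = hex2 x i , 2F
  dart⁻ (z1 x i) = hex1 x i , 2F
  dart⁻ (z2 x i) = hex2 x i , 1F

  dart-dart⁻ : ∀ j → dart (dart⁻ j) ≡ j
  dart-dart⁻ (eD (plain y i))  = refl
  dart-dart⁻ (eD (marked x 0F)) = refl
  dart-dart⁻ (eD (marked x 1F)) = refl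
  dart-dart⁻ (eD (marked x 2F)) = refl
  dart-dart⁻ (nD (plain y i))  = refl
  dart-dart⁻ (nD (marked x 0F)) = refl
  dart-dart⁻ (nD (marked x 1F)) = refl
  dart-dart⁻ (nD (marked x 2F)) = refl
  dart-dart⁻ (cD y i) = refl
  dart-dart⁻ (sD y i) = refl
  dart-dart⁻ (p1 x 0F) = refl
  dart-dart⁻ (p1 x 1F) = refl
  dart-dart⁻ (p1 x 2F) = refl
  dart-dart⁻ (p2 x 0F) = refl
  dart-dart⁻ (p2 x 1F) = refl
  dart-dart⁻ (p2 x 2F) = refl
  dart-dart⁻ (z1 x 0F) = refl
  dart-dart⁻ (z1 x 1F) = refl
  dart-dart⁻ (z1 x 2F) = refl
  dart-dart⁻ (z2 x 0F) = refl
  dart-dart⁻ (z2 x 1F) = refl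
  dart-dart⁻ (z2 x 2F) = refl

  data Corner : K' → Set where
    centreᶜ : ∀ y i → Corner (centre y , i)
    cornerᶜ : ∀ y i j → Corner (corner y i , j)
    hex1ᶜ   : ∀ x i j → Corner (hex1 x i , j)
    hex2ᶜ   : ∀ x i j → Corner (hex2 x i , j)

  view : ∀ k → Corner k
  view (centre y , i)   = centreᶜ y i
  view (corner y i , j) = cornerᶜ y i j
  view (hex01 x , j) = hex1ᶜ x 0F j
  view (hex11 x , j) = hex1ᶜ x 1F j
  view (hex21 x , j) = hex1ᶜ x 2F j
  view (hex02 x , j) = hex2ᶜ x 0F j
  view (hex12 x , j) = hex2ᶜ x 1F j
  view (hex22 x , j) = hex2ᶜ x 2F j

  dart⁻-dart : ∀ k → dart⁻ (dart k) ≡ k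
  dart⁻-dart k with view k
  ... | centreᶜ y i = refl
  ... | cornerᶜ y i 0F = refl
  ... | cornerᶜ y i 1F = refl
  ... | cornerᶜ y i 2F = refl
  ... | hex1ᶜ x 0F 0F = refl
  ... | hex1ᶜ x 0F 1F = refl
  ... | hex1ᶜ x 0F 2F = refl
  ... | hex1ᶜ x 1F 0F = refl
  ... | hex1ᶜ x 1F 1F = refl
  ... | hex1ᶜ x 1F 2F = refl
  ... | hex1ᶜ x 2F 0F = refl
  ... | hex1ᶜ x 2F 1F = refl
  ... | hex1ᶜ x 2F 2F = refl
  ... | hex2ᶜ x 0F 0F = refl
  ... | hex2ᶜ x 0F 1F = refl
  ... | hex2ᶜ x 0F 2F = refl
  ... | hex2ᶜ x 1F 0F = refl
  ... | hex2ᶜ x 1F 1F = refl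
  ... | hex2ᶜ x 1F 2F = refl
  ... | hex2ᶜ x 2F 0F = refl
  ... | hex2ᶜ x 2F 1F = refl
  ... | hex2ᶜ x 2F 2F = refl

  dart-turn : ∀ k → dart (turn k) ≡ spin (dart k)
  dart-turn k with view k
  ... | centreᶜ y i = refl
  ... | cornerᶜ y i 0F = refl
  ... | cornerᶜ y i 1F = refl
  ... | cornerᶜ y i 2F = refl
  ... | hex1ᶜ x 0F 0F = refl
  ... | hex1ᶜ x 0F 1F = refl
  ... | hex1ᶜ x 0F 2F = refl
  ... | hex1ᶜ x 1F 0F = refl
  ... | hex1ᶜ x 1F 1F = refl
  ... | hex1ᶜ x 1F 2F = refl
  ... | hex1ᶜ x 2F 0F = refl
  ... | hex1ᶜ x 2F 1F = refl
  ... | hex1ᶜ x 2F 2F = refl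
  ... | hex2ᶜ x 0F 0F = refl
  ... | hex2ᶜ x 0F 1F = refl
  ... | hex2ᶜ x 0F 2F = refl
  ... | hex2ᶜ x 1F 0F = refl
  ... | hex2ᶜ x 1F 1F = refl
  ... | hex2ᶜ x 1F 2F = refl
  ... | hex2ᶜ x 2F 0F = refl
  ... | hex2ᶜ x 2F 1F = refl
  ... | hex2ᶜ x 2F 2F = refl

  dart-turn⁻ : ∀ k → dart (turn⁻ k) ≡ spin⁻ (dart k)
  dart-turn⁻ (t , i) = trans (sym (spin⁻-spin _)) (cong spin⁻ (trans (sym (dart-turn (t , r⁻ i)))
    (cong (λ i → dart (t , i)) (r-r⁻ i))))

  -- The copies cross between a marked dart and the next one, so the copy that ends inside has
  -- started outside.
  inner-end : ∀ x i → inner (end (marked x (r i))) ≡ twist (outer (start (marked x i)))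
  inner-end x i = trans (cong inner (end-marked x i)) (inner-twist _)

  outer-end : ∀ x i → outer (end (marked x (r i))) ≡ twist (inner (start (marked x i)))
  outer-end x i = trans (cong outer (end-marked x i)) (outer-twist _)

  endD-plain : ∀ y i → endD (dart (plain y (r i))) ≡ startD (dart (plain y i))
  endD-plain (inj₁ y) i = cong (λ i → reverse (inner (start (plain y i)))) (r-r i)
  endD-plain (inj₂ (inj₁ (y , i))) 0F = cong inner (trans (cong (λ i → end (plain y i)) (sym (r-r⁻ i))) (end-plain y (r⁻ i)))
  endD-plain (inj₂ (inj₁ (y , i))) 1F = cong outer (end-plain y i)
  endD-plain (inj₂ (inj₁ (y , i))) 2F = refl
  endD-plain (inj₂ (inj₂ (x , 0F))) 0F = refl
  endD-plain (inj₂ (inj₂ (x , 0F))) 1F = refl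
  endD-plain (inj₂ (inj₂ (x , 0F))) 2F = trans (inner-end x 2F) (sym (reverse² _))
  endD-plain (inj₂ (inj₂ (x , 1F))) 0F = refl
  endD-plain (inj₂ (inj₂ (x , 1F))) 1F = refl
  endD-plain (inj₂ (inj₂ (x , 1F))) 2F = trans (outer-end x 0F) (sym (reverse² _))
  endD-plain (inj₂ (inj₂ (x , 2F))) 0F = refl
  endD-plain (inj₂ (inj₂ (x , 2F))) 1F = refl
  endD-plain (inj₂ (inj₂ (x , 2F))) 2F = trans (outer-end x 1F) (sym (reverse² _))
  endD-plain (inj₂ (inj₂ (x , 3F))) 0F = refl
  endD-plain (inj₂ (inj₂ (x , 3F))) 1F = refl
  endD-plain (inj₂ (inj₂ (x , 3F))) 2F = trans (inner-end x 1F) (sym (reverse² _))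

  twist² : ∀ {C : Set} (b : Attr C) → twist (twist b) ≡ b
  twist² (attr c o true)  = refl
  twist² (attr c o false) = refl

  endD-marked : ∀ x i → endD (dart (marked x (r i))) ≡ twist (startD (dart (marked x i)))
  endD-marked (x , 0F) 0F = refl
  endD-marked (x , 0F) 1F = sym (twist² _)
  endD-marked (x , 0F) 2F = trans (inner-end x 0F) (cong twist (sym (reverse² _)))
  endD-marked (x , 1F) 0F = refl
  endD-marked (x , 1F) 1F = sym (twist² _)
  endD-marked (x , 1F) 2F = trans (outer-end x 2F) (cong twist (sym (reverse² _)))

  -- Edges and faces of the doubled map

  E' F' C' : Set
  E' = K ⊎ (K ⊎ (X × Fin 3))
  F' = F ⊎ (E ⊎ X)
  C' = C × Bool

  pattern parallel k = inj₁ k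
  pattern crossing k = inj₂ (inj₁ k)
  pattern swap x i   = inj₂ (inj₂ (x , i))

  -- Four edges replace an old edge, namely `parallel` and `crossing` for each of its two darts,
  -- because two copies cross two copies. A `swap` is the crossing of both copies of one arc at a
  -- marked vertex.
  edgeD : Dart → E'
  edgeD (eD k)   = parallel k
  edgeD (nD k)   = parallel (ι (turn k))
  edgeD (cD y i) = crossing (plain y (r⁻ i))
  edgeD (sD y i) = crossing (plain y (r⁻ i))
  edgeD (p1 x i) = swap x i
  edgeD (p2 x i) = swap x i
  edgeD (z1 x i) = crossing (marked x i)
  edgeD (z2 x i) = crossing (marked x (r i))

  baseD : E' → Dart
  baseD (parallel k) = eD k
  baseD (crossing (plain y i)) = cD y (r i)
  baseD (crossing (marked x i)) = z1 x i
  baseD (swap x i) = p1 x i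

  at-base : ∀ j → j ≡ baseD (edgeD j) ⊎ flip j ≡ baseD (edgeD j)
  at-base (eD k)   = inj₁ refl
  at-base (nD k)   = inj₂ refl
  at-base (cD y i) = inj₁ (cong (cD y) (sym (r-r⁻ i)))
  at-base (sD y i) = inj₂ (cong (cD y) (sym (r-r⁻ i)))
  at-base (p1 x i) = inj₁ refl
  at-base (p2 x i) = inj₂ refl
  at-base (z1 x i) = inj₁ refl
  at-base (z2 x i) = inj₂ refl

  edgesD : Orbits flip E'
  edgesD = record
    { cls = edgeD ; rep = baseD ; cls-π = cls-flip ; cls-rep = cls-base ; reach = reach }
    where
      cls-flip : ∀ j → edgeD (flip j) ≡ edgeD j
      cls-flip (eD k)   = cong parallel (trans (cong ι (turn-turn⁻ _)) (ι-ι k))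
      cls-flip (nD k)   = refl
      cls-flip (cD y i) = refl
      cls-flip (sD y i) = refl
      cls-flip (p1 x i) = refl
      cls-flip (p2 x i) = refl
      cls-flip (z1 x i) = cong (λ i → crossing (marked x i)) (r-r⁻ i)
      cls-flip (z2 x i) = refl
      cls-base : ∀ e → edgeD (baseD e) ≡ e
      cls-base (parallel k) = refl
      cls-base (crossing (plain y i)) = cong (λ i → crossing (plain y i)) (r⁻-r i)
      cls-base (crossing (marked x i)) = refl
      cls-base (swap x i) = refl
      reach : ∀ j → ∃ λ n → iter flip n j ≡ baseD (edgeD j)
      reach j with at-base j
      ... | inj₁ e = 0 , e
      ... | inj₂ e = 1 , e

  private module EO = Orbits edges
          module FO = Orbits faces

  follow : Dart → Dart
  follow = spin⁻ ∘ flip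

  -- Old faces survive, every old edge opens into a face, and every marked vertex into a hexagon.
  faceD : Dart → F'
  faceD (eD k)   = inj₁ (FO.cls k)
  faceD (nD k)   = inj₂ (inj₁ (edge (turn k)))
  faceD (cD y i) = inj₂ (inj₁ (edge (plain y (r i))))
  faceD (sD y i) = inj₂ (inj₁ (edge (plain y i)))
  faceD (p1 x i) = inj₂ (inj₂ x)
  faceD (p2 x i) = inj₁ (FO.cls (marked x i))
  faceD (z1 x i) = inj₂ (inj₁ (edge (marked x i)))
  faceD (z2 x i) = inj₂ (inj₂ x)

  cornerD : F' → Dart
  cornerD (inj₁ f) = eD (FO.rep f)
  cornerD (inj₂ (inj₁ e)) = nD (turn⁻ (EO.rep e))
  cornerD (inj₂ (inj₂ x)) = p1 x 0F

  facesD : Orbits follow F'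
  facesD = record
    { cls = faceD ; rep = cornerD ; cls-π = cls-follow ; cls-rep = cls-corner ; reach = reach }
    where
      faceD-spin⁻N : ∀ m → faceD (spin⁻ (nD m)) ≡ inj₁ (FO.cls m)
      faceD-spin⁻N (plain y i)  = refl
      faceD-spin⁻N (marked x i) = refl
      faceD-spin⁻E : ∀ m → faceD (spin⁻ (eD m)) ≡ inj₂ (inj₁ (edge m))
      faceD-spin⁻E (plain y i)  = refl
      faceD-spin⁻E (marked x i) = refl
      cls-follow : ∀ j → faceD (follow j) ≡ faceD j
      cls-follow (eD k)   = trans (faceD-spin⁻N _) (cong inj₁ (FO.cls-π k))
      cls-follow (nD k)   = trans (faceD-spin⁻E _) (cong (inj₂ ∘ inj₁) (EO.cls-π (turn k)))
      cls-follow (cD y i) = refl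
      cls-follow (sD y i) = cong (λ i → inj₂ (inj₁ (edge (plain y i)))) (r-r⁻ i)
      cls-follow (p1 x i) = refl
      cls-follow (p2 x i) = refl
      cls-follow (z1 x i) = cong (λ i → inj₂ (inj₁ (edge (marked x i)))) (r-r⁻ i)
      cls-follow (z2 x i) = refl
      cls-corner : ∀ f → faceD (cornerD f) ≡ f
      cls-corner (inj₁ f) = cong inj₁ (FO.cls-rep f)
      cls-corner (inj₂ (inj₁ e)) = cong (inj₂ ∘ inj₁) (trans (cong edge (turn-turn⁻ _)) (EO.cls-rep e))
      cls-corner (inj₂ (inj₂ x)) = refl

      step-E : ∀ m → Leads follow (spin⁻ (nD m)) (eD m)
      step-E (plain y i)  = 0 , refl
      step-E (marked x i) = 1 , refl
      old : ∀ n k → Leads follow (eD k) (eD (iter (turn⁻ ∘ ι) n k))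
      old zero    k = 0 , refl
      old (suc n) k = leads-trans follow (old n k) (leads-trans follow (1 , refl) (step-E _))
      step-N : ∀ m → Leads follow (spin⁻ (eD m)) (nD (turn⁻ m))
      step-N (plain y i)  = 2 , refl
      step-N (marked x i) = 1 , refl
      around : ∀ n k → Leads follow (nD (turn⁻ k)) (nD (turn⁻ (iter ι n k)))
      around zero    k = 0 , refl
      around (suc n) k = leads-trans follow (around n k) (leads-trans follow
        (1 , cong (spin⁻ ∘ eD ∘ ι) (turn-turn⁻ _)) (step-N _))

      reach-E : ∀ k → Leads follow (eD k) (cornerD (inj₁ (FO.cls k)))
      reach-E k = subst (λ m → Leads follow (eD k) (eD m)) (proj₂ (FO.reach k)) (old (proj₁ (FO.reach k)) k)
      reach-N : ∀ k → Leads follow (nD (turn⁻ k)) (cornerD (inj₂ (inj₁ (edge k))))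
      reach-N k = subst (λ m → Leads follow (nD (turn⁻ k)) (nD (turn⁻ m))) (proj₂ (EO.reach k)) (around (proj₁ (EO.reach k)) k)
      reach : ∀ j → Leads follow j (cornerD (faceD j))
      reach (eD k)   = reach-E k
      reach (nD k)   = subst (λ m → Leads follow (nD m) (cornerD (faceD (nD k)))) (turn⁻-turn k) (reach-N (turn k))
      reach (cD y i) = leads-trans follow (1 , refl) (reach (nD (plain y i)))
      reach (sD y i) = leads-trans follow (2 , refl) (reach-N (plain y i))
      reach (p1 x 0F) = 0 , refl
      reach (p1 x 1F) = 4 , refl
      reach (p1 x 2F) = 2 , refl
      reach (p2 x i) = leads-trans follow (1 , refl) (reach-E (marked x i))
      reach (z1 x i) = leads-trans follow (1 , refl) (reach-N (marked x i))
      reach (z2 x 0F) = 5 , refl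
      reach (z2 x 1F) = 3 , refl
      reach (z2 x 2F) = 1 , refl

  -- Curves and crossings of the doubled map

  afterD beforeD : Dart → C'
  afterD  = name ∘ startD
  beforeD = name ∘ endD

  after-turn : ∀ k → after (turn k) ≢ after k
  after-turn k e = cross (turn k) (trans e (sym (before-turn k)))

  afterD-flip : ∀ j → afterD (flip j) ≡ afterD j
  afterD-flip j = cong name (startD-flip j)

  beforeD-flip : ∀ j → beforeD (flip j) ≡ beforeD j
  beforeD-flip j = cong name (endD-flip j)

  nameP : ∀ x i → name (startP x i) ≡ (after (marked x i) , sign (start (marked x i)))
  nameP x 0F = refl
  nameP x 1F = refl
  nameP x 2F = refl

  nameP' : ∀ x i → name (endP x i) ≡ (after (marked x i) , not (sign (start (marked x i))))
  nameP' x 0F = refl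
  nameP' x 1F = refl
  nameP' x 2F = refl

  nameZ : ∀ x i → name (startZ x i) ≡ (after (marked x i) , not (sign (start (marked x i))))
  nameZ x 0F = refl
  nameZ x 1F = refl
  nameZ x 2F = refl

  nameZ' : ∀ x i → name (endZ x i) ≡ (after (marked x (r i)) , sign (start (marked x (r i))))
  nameZ' x 0F = refl
  nameZ' x 1F = refl
  nameZ' x 2F = refl

  -- At the copies of an old crossing the old curves already differ; at a swap the curve is the same
  -- and the copy bit differs.
  crossD : ∀ j → afterD j ≢ beforeD j
  crossD (eD k) e = cross k (cong proj₁ e)
  crossD (nD k) e = cross (turn k) (cong proj₁ e)
  crossD (cD y i) e = after-turn (plain y (r i)) (trans (cong (λ i → after (plain y i)) (r-r i)) (cong proj₁ e))
  crossD (sD y i) e = after-turn (plain y (r i)) (trans (cong (λ i → after (plain y i)) (r-r i)) (cong proj₁ e))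
  crossD (p1 x i) e = not-≢ (cong proj₂ (trans (sym (nameP x i)) (trans e (nameP' x i))))
  crossD (p2 x i) e = not-≢ (cong proj₂ (trans (sym (nameP x i)) (trans e (nameP' x i))))
  crossD (z1 x i) e = crossD (z2 x (r⁻ i)) e
  crossD (z2 x i) e = after-turn (marked x i) (cong proj₁ (trans (sym (nameZ' x i)) (trans (sym e) (nameZ x i))))

  beforeD-spin : ∀ j → beforeD (spin j) ≡ afterD j
  beforeD-spin j = trans (cong (beforeD ∘ spin) (sym (dart-dart⁻ j)))
    (trans (cong beforeD (sym (dart-turn (dart⁻ j)))) (trans (h (dart⁻ j)) (cong afterD (dart-dart⁻ j))))
    where
      h : ∀ k → beforeD (dart (turn k)) ≡ afterD (dart k)
      h (plain y i)  = cong name (endD-plain y i)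
      h (marked x i) = cong name (endD-marked x i)

  ZigD : Dart → Dart → Set
  ZigD = Zig spin spin⁻ flip

  afterD-ρ : ∀ j → afterD (spin⁻ (flip (spin j))) ≡ afterD j
  afterD-ρ j = trans (sym (beforeD-spin (spin⁻ (flip (spin j))))) (trans (cong beforeD (spin-spin⁻ (flip (spin j))))
    (trans (beforeD-flip (spin j)) (beforeD-spin j)))

  afterD-zig : ∀ {j k} → ZigD j k → afterD j ≡ afterD k
  afterD-zig done = refl
  afterD-zig {j} (viaι p) = trans (sym (afterD-flip j)) (afterD-zig p)
  afterD-zig {j} (viaρ p) = trans (sym (afterD-ρ j)) (afterD-zig p)

  zigD-sym : ∀ {j k} → ZigD j k → ZigD k j
  zigD-sym = zig-sym flip-flip spin-spin⁻ spin⁻-spin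

  select : Bool → Dart → Dart → Dart
  select true  a b = a
  select false a b = b

  -- The copy s of the arc after k at its beginning, and of the arc before k at its end.
  head tail : K → Bool → Dart
  head k s = select (s xor sign (start k)) (eD k) (eD (ι k))
  tail k s = select (s xor sign (end k)) (spin⁻ (nD (turn⁻ k))) (spin⁻ (eD k))

  xor-not : ∀ a b → a xor not b ≡ not (a xor b)
  xor-not true  b = refl
  xor-not false b = refl

  select-not : ∀ c {a b} → select (not c) a b ≡ select c b a
  select-not true  = refl
  select-not false = refl

  -- The inner copy at `k` is the outer copy at `ι k`, so both choices name the same dart.
  head-ι : ∀ k s → head (ι k) s ≡ head k s
  head-ι k s = trans (cong₂ (λ b j → select b (eD (ι k)) (eD j))
    (trans (cong (s xor_) (trans (cong sign (start-ι k)) (sign-reverse (start k)))) (xor-not s _)) (ι-ι k))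
    (select-not (s xor sign (start k)))

  tail-ι : ∀ k s → ZigD (tail k s) (tail (ι k) s)
  tail-ι k s = subst (ZigD (tail k s)) (sym eq) (h (s xor sign (end k)))
    where
      eq : tail (ι k) s ≡ select (s xor sign (end k)) (spin⁻ (eD (ι k))) (spin⁻ (nD (turn⁻ (ι k))))
      eq = trans (cong (λ b → select b _ _)
        (trans (cong (s xor_) (trans (cong sign (end-ι k)) (sign-reverse (end k)))) (xor-not s _)))
        (select-not (s xor sign (end k)))
      h : ∀ b → ZigD (select b (spin⁻ (nD (turn⁻ k))) (spin⁻ (eD k)))
                     (select b (spin⁻ (eD (ι k))) (spin⁻ (nD (turn⁻ (ι k)))))
      h true  = viaρ (subst (λ j → ZigD j (spin⁻ (eD (ι k))))
        (sym (trans (cong (spin⁻ ∘ flip) (spin-spin⁻ _)) (cong (spin⁻ ∘ eD ∘ ι) (turn-turn⁻ k)))) done)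
      h false = viaρ (subst (λ j → ZigD j (spin⁻ (nD (turn⁻ (ι k)))))
        (sym (cong (spin⁻ ∘ flip) (spin-spin⁻ _))) done)

  to-nD : ∀ k → ZigD (eD (ι k)) (nD (turn⁻ k))
  to-nD k = viaι (subst (λ m → ZigD (nD (turn⁻ m)) (nD (turn⁻ k))) (sym (ι-ι k)) done)

  -- Follows one copy through a corner. At a plain vertex the outer copy is a single arc while the
  -- inner one passes by the centre; at a marked vertex they exchange roles, whence the `not`.
  head-tail : ∀ k s → ZigD (head k s) (tail (turn k) s)
  head-tail (plain y i) s = subst (λ b → ZigD (head (plain y i) s) (select b _ _))
      (cong (λ a → s xor sign a) (sym (end-plain y i)))
      (subst (λ j → ZigD (head (plain y i) s) (select (s xor sign (start (plain y i))) (spin⁻ (nD (inj₁ y , j))) (sD y (r i))))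
        (sym (r⁻-r i)) (h (s xor sign (start (plain y i)))))
    where
      h : ∀ b → ZigD (select b (eD (plain y i)) (eD (ι (plain y i)))) (select b (eD (plain y i)) (sD y (r i)))
      h true  = done
      h false = zig-trans (to-nD (plain y i)) (viaρ (subst (λ j → ZigD (cD y j) (sD y (r i))) (sym (r⁻-r⁻ i)) (viaι done)))
  head-tail (marked x i) s = subst (λ b → ZigD (head (marked x i) s) (select b _ _))
      (sym (trans (cong (s xor_) (trans (cong sign (end-marked x i)) (sign-twist (start (marked x i))))) (xor-not s _)))
      (subst (λ j → ZigD (head (marked x i) s) (select (not (s xor sign (start (marked x i)))) (p2 x j) (z1 x (r i))))
        (sym (r⁻-r i)) (h (s xor sign (start (marked x i)))))
    where
      h : ∀ b → ZigD (select b (eD (marked x i)) (eD (ι (marked x i)))) (select (not b) (p2 x i) (z1 x (r i)))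
      h true  = viaρ (viaι done)
      h false = zig-trans (to-nD (marked x i)) (viaρ (subst (λ j → ZigD (p1 x j) (p2 x i)) (sym (r-r⁻ i)) (viaι done)))

  head-zig : ∀ {k j} → Zig turn turn⁻ ι k j → ∀ s → ZigD (head k s) (head j s)
  head-zig done s = done
  head-zig {k} (viaι p) s = zig-trans (subst (ZigD (head k s)) (sym (head-ι k s)) done) (head-zig p s)
  head-zig {k} (viaρ p) s = zig-trans (zig-trans (zig-trans (head-tail k s) (tail-ι (turn k) s))
    (subst (λ m → ZigD (tail m s) (head (turn⁻ (ι (turn k))) s)) (turn-turn⁻ _) (zigD-sym (head-tail (turn⁻ (ι (turn k))) s))))
    (head-zig p s)

  -- Every zigzag contains an arc `eD k`, so only these have to be compared.
  to-eD : ∀ j → ∃ λ k → ZigD j (eD k)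
  to-eD (eD k)   = k , done
  to-eD (nD k)   = ι (turn k) , viaι done
  to-eD (cD y i) = _ , viaρ (viaι done)
  to-eD (sD y i) = _ , viaι (proj₂ (to-eD (cD y i)))
  to-eD (p1 x i) = _ , viaρ (viaι done)
  to-eD (p2 x i) = _ , viaι (proj₂ (to-eD (p1 x i)))
  to-eD (z2 x i) = marked x i , viaρ done
  to-eD (z1 x i) = marked x (r⁻ i) , viaι (viaρ done)

  xor-cancel : ∀ a → not a xor a ≡ true
  xor-cancel true  = refl
  xor-cancel false = refl

  zigD : ∀ {j k} → afterD j ≡ afterD k → ZigD j k
  zigD {j} {k} e with to-eD j | to-eD k
  -- `eD` lies on the outer copy, so the copy to follow is the negated sign.
  ... | j' , p | k' , q = zig-trans p (zig-trans (subst₂ ZigD (at j' refl) (at k' (cong proj₂ (sym e')))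
          (head-zig (zig (cong proj₁ e')) (not (sign (start j'))))) (zigD-sym q))
    where
      e' : afterD (eD j') ≡ afterD (eD k')
      e' = trans (sym (afterD-zig p)) (trans e (afterD-zig q))
      at : ∀ m → not (sign (start m)) ≡ not (sign (start j')) → head m (not (sign (start j'))) ≡ eD m
      at m eq = cong (λ b → select b (eD m) (eD (ι m))) (trans (cong (_xor sign (start m)) (sym eq)) (xor-cancel (sign (start m))))

  MeetsD : C' → C' → Dart → Set
  MeetsD u v j = (afterD j ≡ u × beforeD j ≡ v) ⊎ (afterD j ≡ v × beforeD j ≡ u)

  meetsD-base : ∀ {u v} j → MeetsD u v j → MeetsD u v (baseD (edgeD j))
  meetsD-base {u} {v} j m with at-base j
  ... | inj₁ e = subst (MeetsD u v) e m
  ... | inj₂ e = subst (MeetsD u v) e (h m)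
    where
      h : MeetsD u v j → MeetsD u v (flip j)
      h (inj₁ (p , q)) = inj₁ (trans (afterD-flip j) p , trans (beforeD-flip j) q)
      h (inj₂ (p , q)) = inj₂ (trans (afterD-flip j) p , trans (beforeD-flip j) q)

  -- Two of the four crossings that replace the edge of k; those of ι k are the other two.
  crossingOf : K → Bool → E'
  crossingOf k true  = parallel k
  crossingOf k false = crossing k

  copyAfter : K → Bool → C'
  copyAfter k b = after k , b xor sign (start k)

  copyBefore : K → C'
  copyBefore k = before k , sign (end k)

  Copies : C' → C' → K → Bool → Set
  Copies u v k b = (copyAfter k b ≡ u × copyBefore k ≡ v) ⊎ (copyAfter k b ≡ v × copyBefore k ≡ u)

  before-marked : ∀ x i → copyBefore (marked x (r i)) ≡ name (startZ x i)
  before-marked x i = trans (cong (λ a → name a , sign a) (end-marked x i))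
    (trans (cong (after (marked x i) ,_) (sign-twist (start (marked x i)))) (sym (nameZ x i)))

  copies⇒meets : ∀ {u v} k b → Copies u v k b → MeetsD u v (baseD (crossingOf k b))
  copies⇒meets k true  m = m
  copies⇒meets (plain y i) false (inj₁ (p , q)) = inj₁ (trans (cong (λ i → name (inner (start (plain y i)))) (r⁻-r i)) p ,
    trans (cong (λ i → name (inner (start (plain y i)))) (r-r i)) (trans (sym (end-at y i)) q))
    where
      end-at : ∀ y i → copyBefore (plain y i) ≡ name (inner (start (plain y (r⁻ i))))
      end-at y i = trans (cong (λ i → copyBefore (plain y i)) (sym (r-r⁻ i))) (cong (λ a → name a , sign a) (end-plain y (r⁻ i)))
  copies⇒meets (plain y i) false (inj₂ m) with copies⇒meets (plain y i) false (inj₁ m)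
  ... | inj₁ m = inj₂ m
  ... | inj₂ m = inj₁ m
  copies⇒meets (marked x i) false (inj₁ (p , q)) = inj₂ (trans (sym (before-marked x (r⁻ i)))
      (trans (cong (λ i → copyBefore (marked x i)) (r-r⁻ i)) q) ,
    trans (nameZ' x (r⁻ i)) (trans (cong (λ i → copyAfter (marked x i) false) (r-r⁻ i)) p))
  copies⇒meets (marked x i) false (inj₂ m) with copies⇒meets (marked x i) false (inj₁ m)
  ... | inj₁ m = inj₂ m
  ... | inj₂ m = inj₁ m

  meets⇒copies : ∀ {u v} k b → MeetsD u v (baseD (crossingOf k b)) → Copies u v k b
  meets⇒copies k b m with copies⇒meets k b (inj₁ (refl , refl))
  meets⇒copies k b (inj₁ (p , q)) | inj₁ (p' , q') = inj₁ (trans (sym p') p , trans (sym q') q)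
  meets⇒copies k b (inj₂ (p , q)) | inj₁ (p' , q') = inj₂ (trans (sym p') p , trans (sym q') q)
  meets⇒copies k b (inj₁ (p , q)) | inj₂ (p' , q') = inj₂ (trans (sym q') q , trans (sym p') p)
  meets⇒copies k b (inj₂ (p , q)) | inj₂ (p' , q') = inj₁ (trans (sym q') q , trans (sym p') p)

  copies-ι : ∀ k → copyBefore (ι k) ≡ (before k , not (sign (end k)))
  copies-ι k = trans (cong (λ a → name a , sign a) (end-ι k)) (cong (before k ,_) (sign-reverse (end k)))

  xor-injective : ∀ {a b c} → a xor c ≡ b xor c → a ≡ b
  xor-injective {true}  {true}  e = refl
  xor-injective {false} {false} e = refl
  xor-injective {true}  {false} e = ⊥-elim (not-≢ (sym e))
  xor-injective {false} {true}  e = ⊥-elim (not-≢ e)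

  -- Among the four crossings that replace one edge, the copy of the curve before the dart tells `k`
  -- from `ι k`, and then the copy of the curve after it tells `parallel` from `crossing`. So a
  -- given pair of copies meets there only once.
  copies-unique : ∀ {u v} → u ≢ v → ∀ {j k a b} → edge j ≡ edge k → Copies u v j a → Copies u v k b →
    crossingOf j a ≡ crossingOf k b
  copies-unique {u} {v} ne {j} {k} e m n with involution-class ι-ι edges {j} {k} e
  copies-unique ne {k = k} {a} {b} _ m n | inj₁ refl = cong (crossingOf k) (h m n)
    where
      h : _ → _ → a ≡ b
      h (inj₁ (p , q)) (inj₁ (p' , q')) = xor-injective (cong proj₂ (trans p (sym p')))
      h (inj₂ (p , q)) (inj₂ (p' , q')) = xor-injective (cong proj₂ (trans p (sym p')))
      h (inj₁ (p , q)) (inj₂ (p' , q')) = ⊥-elim (ne (trans (sym q') q))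
      h (inj₂ (p , q)) (inj₁ (p' , q')) = ⊥-elim (ne (trans (sym q) q'))
  copies-unique ne {k = k} {a} {b} _ m n | inj₂ refl = ⊥-elim (h m n)
    where
      clash : copyBefore k ≢ copyBefore (ι k)
      clash e = not-≢ (cong proj₂ (trans e (copies-ι k)))
      mixed : copyAfter (ι k) a ≢ copyBefore k
      mixed e = cross k (trans (sym (after-ι k)) (cong proj₁ e))
      h : _ → _ → ⊥
      h (inj₁ (p , q)) (inj₁ (p' , q')) = clash (trans q' (sym q))
      h (inj₂ (p , q)) (inj₂ (p' , q')) = clash (trans q' (sym q))
      h (inj₁ (p , q)) (inj₂ (p' , q')) = mixed (trans p (sym q'))
      h (inj₂ (p , q)) (inj₁ (p' , q')) = mixed (trans p (sym q'))

  self-crossing : ∀ x i → proj₁ (afterD (p1 x i)) ≡ proj₁ (beforeD (p1 x i))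
  self-crossing x i = trans (cong proj₁ (nameP x i)) (sym (cong proj₁ (nameP' x i)))

  -- Copies of one zigzag meet only at swaps, which `two-marked` bounds. Copies of different zigzags
  -- meet only near old crossings, at most once near each, so the old bound carries over.
  twoD : ∀ {u v} → u ≢ v → ∀ {i j k} → MeetsD u v i → MeetsD u v j → MeetsD u v k →
         edgeD i ≡ edgeD j ⊎ edgeD i ≡ edgeD k ⊎ edgeD j ≡ edgeD k
  twoD {a , s} {b , t} ne {i} {j} {k} mi mj mk with a ≟ b
  ... | yes refl = self (at i mi) (at j mj) (at k mk)
    where
      data Swap (e : E') : Set where
        is : ∀ x i → after (marked x i) ≡ a → swap x i ≡ e → Swap e
      at' : ∀ e → MeetsD (a , s) (a , t) (baseD e) → Swap e
      corner' : ∀ k b → MeetsD (a , s) (a , t) (baseD (crossingOf k b)) → ⊥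
      corner' k b m with meets⇒copies k b m
      ... | inj₁ (p , q) = cross k (trans (cong proj₁ p) (sym (cong proj₁ q)))
      ... | inj₂ (p , q) = cross k (trans (cong proj₁ p) (sym (cong proj₁ q)))
      at' (parallel k) m = ⊥-elim (corner' k true m)
      at' (crossing k) m = ⊥-elim (corner' k false m)
      at' (swap x i) (inj₁ (p , q)) = is x i (cong proj₁ (trans (sym (nameP x i)) p)) refl
      at' (swap x i) (inj₂ (p , q)) = is x i (cong proj₁ (trans (sym (nameP x i)) p)) refl
      at : ∀ j → MeetsD (a , s) (a , t) j → Swap (edgeD j)
      at j m = at' (edgeD j) (meetsD-base j m)
      self : ∀ {e f g} → Swap e → Swap f → Swap g → e ≡ f ⊎ e ≡ g ⊎ f ≡ g
      self (is x i p refl) (is y j q refl) (is z k o refl) with two-marked p q o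
      ... | inj₁ refl = inj₁ refl
      ... | inj₂ (inj₁ refl) = inj₂ (inj₁ refl)
      ... | inj₂ (inj₂ refl) = inj₂ (inj₂ refl)
  ... | no a≢b = other (at i mi) (at j mj) (at k mk)
    where
      data Cross (e : E') : Set where
        is : ∀ k c → Copies (a , s) (b , t) k c → crossingOf k c ≡ e → Cross e
      at' : ∀ e → MeetsD (a , s) (b , t) (baseD e) → Cross e
      at' (parallel k) m = is k true (meets⇒copies k true m) refl
      at' (crossing k) m = is k false (meets⇒copies k false m) refl
      at' (swap x i) (inj₁ (p , q)) = ⊥-elim (a≢b (trans (sym (cong proj₁ p)) (trans (self-crossing x i) (cong proj₁ q))))
      at' (swap x i) (inj₂ (p , q)) = ⊥-elim (a≢b (trans (sym (cong proj₁ q)) (trans (sym (self-crossing x i)) (cong proj₁ p))))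
      at : ∀ j → MeetsD (a , s) (b , t) j → Cross (edgeD j)
      at j m = at' (edgeD j) (meetsD-base j m)
      below : ∀ {k c} → Copies (a , s) (b , t) k c → Meets a b k
      below (inj₁ (p , q)) = inj₁ (cong proj₁ p , cong proj₁ q)
      below (inj₂ (p , q)) = inj₂ (cong proj₁ p , cong proj₁ q)
      other : ∀ {e f g} → Cross e → Cross f → Cross g → e ≡ f ⊎ e ≡ g ⊎ f ≡ g
      other (is i a' p refl) (is j b' q refl) (is k c' o refl) with two a≢b (below {i} {a'} p) (below {j} {b'} q) (below {k} {c'} o)
      ... | inj₁ e = inj₁ (copies-unique ne e p q)
      ... | inj₂ (inj₁ e) = inj₂ (inj₁ (copies-unique ne e p o))
      ... | inj₂ (inj₂ e) = inj₂ (inj₂ (copies-unique ne e q o))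

  xor-solve : ∀ s b → (s xor b) xor b ≡ s
  xor-solve true  true  = refl
  xor-solve true  false = refl
  xor-solve false true  = refl
  xor-solve false false = refl

  either : ∀ (s t : Bool) → s ≡ t ⊎ not s ≡ t
  either true  true  = inj₁ refl
  either true  false = inj₂ refl
  either false true  = inj₂ refl
  either false false = inj₁ refl

  -- For two copies of one curve any swap serves. Otherwise an old crossing offers all four pairs of
  -- copies: the choice of `k` or `ι k` fixes one copy and the boolean of `crossingOf` the other.
  meetD : ∀ {u v} → u ≢ v → ∃ (MeetsD u v)
  meetD {a , s} {b , t} ne with a ≟ b
  ... | yes refl with some-marked a
  ...   | x , i , refl = p1 x i , h (either (sign (start (marked x i))) s) (either (sign (start (marked x i))) t)
    where
      h : _ → _ → MeetsD (a , s) (a , t) (p1 x i)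
      h (inj₁ refl) (inj₁ refl) = ⊥-elim (ne refl)
      h (inj₁ refl) (inj₂ refl) = inj₁ (nameP x i , nameP' x i)
      h (inj₂ refl) (inj₁ refl) = inj₂ (nameP x i , nameP' x i)
      h (inj₂ refl) (inj₂ refl) = ⊥-elim (ne refl)
  meetD {a , s} {b , t} ne | no a≢b = h (meet a≢b)
    where
      go : ∀ {a b s t} k → after k ≡ a → before k ≡ b → ∃ λ k → ∃ λ c → copyAfter k c ≡ (a , s) × copyBefore k ≡ (b , t)
      go {s = s} {t} k refl refl with either (sign (end k)) t
      ... | inj₁ refl = k , s xor sign (start k) , cong (after k ,_) (xor-solve s _) , refl
      ... | inj₂ refl = ι k , s xor sign (start (ι k)) ,
              trans (cong (after (ι k) ,_) (xor-solve s _)) (cong (_, s) (after-ι k)) , copies-ι k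
      h : ∃ (Meets a b) → ∃ (MeetsD (a , s) (b , t))
      h (k , inj₁ (p , q)) with go {s = s} {t} k p q
      ... | k , c , e = baseD (crossingOf k c) , copies⇒meets k c (inj₁ e)
      h (k , inj₂ (p , q)) with go {s = t} {s} k p q
      ... | k , c , e = baseD (crossingOf k c) , copies⇒meets k c (inj₂ e)

  -- Parallel edges keep the old colour. An edge opposite to an old dart takes its colour, which
  -- differs from the other two at that vertex; the `z` edges of a hexagon take a colour absent from
  -- the old marked vertex.
  colourD : Dart → Fin 4
  colourD (eD k)   = colour k
  colourD (nD k)   = colour (turn k)
  colourD (cD y i) = colour (plain y (r⁻ i))
  colourD (sD y i) = colour (plain y (r⁻ i))
  colourD (p1 x i) = colour (marked x (r⁻ i))
  colourD (p2 x i) = colour (marked x (r⁻ i))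
  colourD (z1 x i) = avoid (colour (marked x 0F)) (colour (marked x 1F)) (colour (marked x 2F))
  colourD (z2 x i) = avoid (colour (marked x 0F)) (colour (marked x 1F)) (colour (marked x 2F))

  colourD-flip : ∀ j → colourD (flip j) ≡ colourD j
  colourD-flip (eD k)   = trans (cong colour (turn-turn⁻ (ι k))) (colour-ι k)
  colourD-flip (nD k)   = colour-ι (turn k)
  colourD-flip (cD y i) = refl
  colourD-flip (sD y i) = refl
  colourD-flip (p1 x i) = refl
  colourD-flip (p2 x i) = refl
  colourD-flip (z1 x i) = refl
  colourD-flip (z2 x i) = refl

  colour-turn⁻ : ∀ t i → colour (t , i) ≢ colour (t , r⁻ i)
  colour-turn⁻ t i e = colour-turn (t , r⁻ i) (trans (cong (λ i → colour (t , i)) (r-r⁻ i)) e)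

  colour-turn² : ∀ t i → colour (t , r⁻ i) ≢ colour (t , r i)
  colour-turn² t i e = colour-turn (t , r i) (trans (cong (λ i → colour (t , i)) (r-r i)) e)

  spare : ∀ x i → avoid (colour (marked x 0F)) (colour (marked x 1F)) (colour (marked x 2F)) ≢ colour (marked x i)
  spare x 0F = proj₁ (avoid-≢ _ _ _)
  spare x 1F = proj₁ (proj₂ (avoid-≢ (colour (marked x 0F)) _ _))
  spare x 2F = proj₂ (proj₂ (avoid-≢ (colour (marked x 0F)) (colour (marked x 1F)) _))

  colourD-spin : ∀ j → colourD (spin j) ≢ colourD j
  colourD-spin (eD (plain y i))  = colour-turn (plain y i)
  colourD-spin (eD (marked x i)) = colour-turn⁻ (inj₂ x) i ∘ sym
  colourD-spin (nD (plain y i))  = colour-turn² (inj₁ y) i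
  colourD-spin (nD (marked x i)) = spare x (r i)
  colourD-spin (cD y i) = subst (λ j → colour (plain y j) ≢ colour (plain y (r⁻ i))) (sym (r⁻-r i)) (colour-turn⁻ (inj₁ y) i)
  colourD-spin (sD y i) = colour-turn⁻ (inj₁ y) i
  colourD-spin (p1 x i) = spare x (r⁻ i)
  colourD-spin (p2 x i) = colour-turn² (inj₂ x) i ∘ sym
  colourD-spin (z1 x i) = spare x i ∘ sym
  colourD-spin (z2 x i) = spare x (r⁻ i) ∘ sym

  -- The marked darts of the new map are the pairs of an old marked dart and a copy of its curve.
  origin : X' → Fin 3 → X × Fin 3
  origin (x , 0F) 0F = x , 1F
  origin (x , 0F) 1F = x , 1F
  origin (x , 0F) 2F = x , 0F
  origin (x , 1F) 0F = x , 0F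
  origin (x , 1F) 1F = x , 2F
  origin (x , 1F) 2F = x , 2F

  copy : X' → Fin 3 → Bool
  copy (x , 0F) 0F = true
  copy (x , 0F) 1F = false
  copy (x , 0F) 2F = true
  copy (x , 1F) 0F = false
  copy (x , 1F) 1F = true
  copy (x , 1F) 2F = false

  markedCopy : X × Fin 3 → Bool → X' × Fin 3
  markedCopy (x , 0F) true  = (x , 0F) , 2F
  markedCopy (x , 0F) false = (x , 1F) , 0F
  markedCopy (x , 1F) true  = (x , 0F) , 0F
  markedCopy (x , 1F) false = (x , 0F) , 1F
  markedCopy (x , 2F) true  = (x , 1F) , 1F
  markedCopy (x , 2F) false = (x , 1F) , 2F

  markedCopy-origin : ∀ x i → markedCopy (origin x i) (copy x i) ≡ (x , i)
  markedCopy-origin (x , 0F) 0F = refl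
  markedCopy-origin (x , 0F) 1F = refl
  markedCopy-origin (x , 0F) 2F = refl
  markedCopy-origin (x , 1F) 0F = refl
  markedCopy-origin (x , 1F) 1F = refl
  markedCopy-origin (x , 1F) 2F = refl

  mark : ∀ {Y X : Set} → X × Fin 3 → Triangles Y X
  mark (x , i) = marked x i

  after-marked : ∀ x i → afterD (dart (marked x i)) ≡ copyAfter (mark (origin x i)) (copy x i)
  after-marked (x , 0F) 0F = refl
  after-marked (x , 0F) 1F = refl
  after-marked (x , 0F) 2F = refl
  after-marked (x , 1F) 0F = refl
  after-marked (x , 1F) 1F = refl
  after-marked (x , 1F) 2F = refl

  markedCopy-after : ∀ x i b → afterD (dart (mark (markedCopy (x , i) b))) ≡ copyAfter (marked x i) b
  markedCopy-after x 0F true  = refl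
  markedCopy-after x 0F false = refl
  markedCopy-after x 1F true  = refl
  markedCopy-after x 1F false = refl
  markedCopy-after x 2F true  = refl
  markedCopy-after x 2F false = refl

  two-marked' : ∀ {u x y z i j k} → afterD (dart (marked x i)) ≡ u → afterD (dart (marked y j)) ≡ u →
                afterD (dart (marked z k)) ≡ u → (x , i) ≡ (y , j) ⊎ (x , i) ≡ (z , k) ⊎ (y , j) ≡ (z , k)
  two-marked' {u} {x} {y} {z} {i} {j} {k} p q o
    with two-marked (below x i p) (below y j q) (below z k o)
    where
      below : ∀ x i → afterD (dart (marked x i)) ≡ u → after (mark (origin x i)) ≡ proj₁ u
      below x i p = cong proj₁ (trans (sym (after-marked x i)) p)
  ... | m = pick m
    where
      same : ∀ x i y j → afterD (dart (marked x i)) ≡ u → afterD (dart (marked y j)) ≡ u →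
             origin x i ≡ origin y j → (x , i) ≡ (y , j)
      same x i y j p q e = trans (sym (markedCopy-origin x i)) (trans (cong₂ markedCopy e
        (xor-injective (trans (cong proj₂ (trans (sym (after-marked x i)) (trans p (trans (sym q) (after-marked y j)))))
          (cong (λ k → copy y j xor sign (start (mark k))) (sym e))))) (markedCopy-origin y j))
      pick : origin x i ≡ origin y j ⊎ origin x i ≡ origin z k ⊎ origin y j ≡ origin z k → _
      pick (inj₁ e)        = inj₁ (same x i y j p q e)
      pick (inj₂ (inj₁ e)) = inj₂ (inj₁ (same x i z k p o e))
      pick (inj₂ (inj₂ e)) = inj₂ (inj₂ (same y j z k q o e))

  some-marked' : ∀ u → ∃ λ x → ∃ λ i → afterD (dart (marked x i)) ≡ u
  some-marked' (a , s) with some-marked a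
  ... | x , i , refl = let j = markedCopy (x , i) (s xor sign (start (marked x i))) in
    proj₁ j , proj₂ j , trans (markedCopy-after x i (s xor sign (start (marked x i)))) (cong (a ,_) (xor-solve s _))

  Dart↔ : Dart ↔ K'
  Dart↔ = mk↔ₛ′ dart⁻ dart dart⁻-dart dart-dart⁻

  ι' : K' → K'
  ι' = conj Dart↔ flip

  zig' : ∀ {a b} → ZigD a b → Zig turn turn⁻ ι' (dart⁻ a) (dart⁻ b)
  zig' done = done
  zig' {a} (viaι p) = viaι (subst (λ j → Zig turn turn⁻ ι' j _) (sym (cong (dart⁻ ∘ flip) (dart-dart⁻ a))) (zig' p))
  zig' {a} (viaρ p) = viaρ (subst (λ j → Zig turn turn⁻ ι' j _) (sym eq) (zig' p))
    where
      eq : turn⁻ (ι' (turn (dart⁻ a))) ≡ dart⁻ (spin⁻ (flip (spin a)))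
      eq = trans (sym (dart⁻-dart _)) (cong dart⁻ (trans (dart-turn⁻ _) (cong spin⁻ (trans (dart-dart⁻ _)
             (cong flip (trans (dart-turn (dart⁻ a)) (cong spin (dart-dart⁻ a))))))))

  -- In any hexagon the edge of `p1 x 1F` joins the marked vertex `hex11` to the plain vertex
  -- `hex12`; the old seam only supplies a marked vertex.
  hexagon-seam : ∃ λ (y : Y') → ∃ λ i → ∃ λ (x : X') → ∃ λ j → ι' (plain y i) ≡ marked x j
  hexagon-seam = inj₂ (inj₂ (proj₁ (proj₂ (proj₂ seam)) , 2F)) , 2F , (proj₁ (proj₂ (proj₂ seam)) , 0F) , 1F , refl

  eulerian' : (#Y + (#Y * 3 + #X * 4)) + #X * 2 + (#F + (#E + #X)) ≡ ((#Y + #X) * 3 + ((#Y + #X) * 3 + #X * 3)) + 2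
  eulerian' = begin
    (#Y + (#Y * 3 + #X * 4)) + #X * 2 + (#F + (#E + #X))  ≡⟨ before' #Y #X #F #E ⟩
    (#Y + #X + #F) + #E + (#Y * 3 + #X * 6)                ≡⟨ cong (λ n → n + #E + (#Y * 3 + #X * 6)) eulerian ⟩
    #E + 2 + #E + (#Y * 3 + #X * 6)                        ≡⟨ middle #E (#Y * 3 + #X * 6) ⟩
    (#E + #E) + (2 + (#Y * 3 + #X * 6))                    ≡⟨ cong (_+ (2 + (#Y * 3 + #X * 6))) handshake ⟩
    (#Y + #X) * 3 + (2 + (#Y * 3 + #X * 6))                ≡⟨ after' #Y #X ⟩
    ((#Y + #X) * 3 + ((#Y + #X) * 3 + #X * 3)) + 2         ∎
    where
      open ≡-Reasoning
      before' : ∀ y x f e → (y + (y * 3 + x * 4)) + x * 2 + (f + (e + x)) ≡ (y + x + f) + e + (y * 3 + x * 6)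
      before' = solve-∀
      middle : ∀ e n → e + 2 + e + n ≡ (e + e) + (2 + n)
      middle = solve-∀
      after' : ∀ y x → (y + x) * 3 + (2 + (y * 3 + x * 6)) ≡ ((y + x) * 3 + ((y + x) * 3 + x * 3)) + 2
      after' = solve-∀

  handshake' : ((#Y + #X) * 3 + ((#Y + #X) * 3 + #X * 3)) + ((#Y + #X) * 3 + ((#Y + #X) * 3 + #X * 3))
               ≡ ((#Y + (#Y * 3 + #X * 4)) + #X * 2) * 3
  handshake' = h #Y #X
    where
      h : ∀ y x → ((y + x) * 3 + ((y + x) * 3 + x * 3)) + ((y + x) * 3 + ((y + x) * 3 + x * 3))
          ≡ ((y + (y * 3 + x * 4)) + x * 2) * 3
      h = solve-∀

  infixr 1 _+↔_
  infixr 2 _*↔_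
  _+↔_ : ∀ {A B : Set} {m n} → A ↔ Fin m → B ↔ Fin n → (A ⊎ B) ↔ Fin (m + n)
  f +↔ g = ↔-trans (f ⊎-↔ g) (↔-sym Finₚ.+↔⊎)

  _*↔_ : ∀ {A B : Set} {m n} → A ↔ Fin m → B ↔ Fin n → (A × B) ↔ Fin (m * n)
  f *↔ g = ↔-trans (f ×-↔ g) (↔-sym Finₚ.*↔×)

  double : Saturated
  double = record
    { Y = Y' ; X = X' ; E = E' ; F = F' ; C = C'
    ; Y↔ = Y↔ +↔ Y↔ *↔ ↔-refl +↔ X↔ *↔ ↔-refl
    ; X↔ = X↔ *↔ ↔-refl
    ; E↔ = (Y↔ +↔ X↔) *↔ ↔-refl +↔ ((Y↔ +↔ X↔) *↔ ↔-refl +↔ X↔ *↔ ↔-refl)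
    ; F↔ = F↔ +↔ E↔ +↔ X↔
    ; eulerian = eulerian' ; handshake = handshake'
    ; ι = ι'
    ; ι-ι = λ k → trans (cong (dart⁻ ∘ flip) (dart-dart⁻ _)) (trans (cong dart⁻ (flip-flip _)) (dart⁻-dart k))
    ; edges = orbits-conj Dart↔ ↔-refl edgesD
    ; faces = orbits-cong (λ k → trans (cong dart⁻ (trans (cong spin⁻ (sym (dart-dart⁻ _))) (sym (dart-turn⁻ _)))) (dart⁻-dart _))
                          (orbits-conj Dart↔ ↔-refl facesD)
    ; _≟_ = ≡-dec _≟_ Boolₚ._≟_
    ; start = startD ∘ dart ; end = endD ∘ dart
    ; start-ι = λ k → trans (cong startD (dart-dart⁻ (flip (dart k)))) (startD-flip (dart k))
    ; end-ι = λ k → trans (cong endD (dart-dart⁻ (flip (dart k)))) (endD-flip (dart k))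
    ; end-plain = endD-plain ; end-marked = endD-marked
    ; cross = crossD ∘ dart
    ; zig = λ {k} {j} e → subst₂ (Zig turn turn⁻ ι') (dart⁻-dart k) (dart⁻-dart j) (zig' (zigD {dart k} {dart j} e))
    ; two = λ ne {i} {j} {k} → twoD ne {dart i} {dart j} {dart k}
    ; meet = λ {u} {v} ne → dart⁻ (proj₁ (meetD ne)) , subst (MeetsD u v) (sym (dart-dart⁻ (proj₁ (meetD ne)))) (proj₂ (meetD ne))
    ; two-marked = two-marked' ; some-marked = some-marked'
    ; colour = colourD ∘ dart
    ; colour-ι = λ k → trans (cong colourD (dart-dart⁻ (flip (dart k)))) (colourD-flip (dart k))
    ; colour-turn = λ k e → colourD-spin (dart k) (trans (cong colourD (sym (dart-turn k))) e)
    ; seam = hexagon-seam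
    }

s s⁻ : Fin 5 → Fin 5
s 0F = 1F
s 1F = 2F
s 2F = 3F
s 3F = 4F
s 4F = 0F
s⁻ 0F = 4F
s⁻ 1F = 0F
s⁻ 2F = 1F
s⁻ 3F = 2F
s⁻ 4F = 3F

s-s⁻ : ∀ i → s (s⁻ i) ≡ i
s-s⁻ 0F = refl
s-s⁻ 1F = refl
s-s⁻ 2F = refl
s-s⁻ 3F = refl
s-s⁻ 4F = refl

s⁻-s : ∀ i → s⁻ (s i) ≡ i
s⁻-s 0F = refl
s⁻-s 1F = refl
s⁻-s 2F = refl
s⁻-s 3F = refl
s⁻-s 4F = refl

s-≢ : ∀ i → s i ≢ i
s-≢ 0F ()
s-≢ 1F ()
s-≢ 2F ()
s-≢ 3F ()
s-≢ 4F ()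

-- Parity of 3-colourings

sum-⊎ : ∀ m n (h : Fin m ⊎ Fin n → ℕ) → sum (h ∘ splitAt m) ≡ sum (h ∘ inj₁) + sum {n} (h ∘ inj₂)
sum-⊎ zero    n h = refl
sum-⊎ (suc m) n h = trans (cong (h (inj₁ zero) +_) (trans (sum-cong-≗ shift) (sum-⊎ m n h')))
                          (sym (ℕₚ.+-assoc (h (inj₁ zero)) _ _))
  where
    h' : Fin m ⊎ Fin n → ℕ
    h' (inj₁ i) = h (inj₁ (suc i))
    h' (inj₂ j) = h (inj₂ j)
    shift : ∀ i → h (splitAt (suc m) (suc i)) ≡ h' (splitAt m i)
    shift i with splitAt m i
    ... | inj₁ _ = refl
    ... | inj₂ _ = refl

total : ∀ {A : Set} {n} → A ↔ Fin n → (A → ℕ) → ℕ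
total f h = sum (h ∘ Inverse.from f)

total-cong : ∀ {A : Set} {n} (f : A ↔ Fin n) {h h' : A → ℕ} → (∀ a → h a ≡ h' a) → total f h ≡ total f h'
total-cong {n = n} f {h} {h'} e =
  sum-cong-≗ {n} {h ∘ Inverse.from f} {h' ∘ Inverse.from f} (λ i → e (Inverse.from f i))

total-⊎ : ∀ {A B : Set} {m n} (f : A ↔ Fin m) (g : B ↔ Fin n) (h : A ⊎ B → ℕ) →
  total (↔-trans (f ⊎-↔ g) (↔-sym Finₚ.+↔⊎)) h ≡ total f (h ∘ inj₁) + total g (h ∘ inj₂)
total-⊎ {m = m} {n} f g h = trans
  (sum-cong-≗ {m + n} {h ∘ Inverse.from (f ⊎-↔ g) ∘ splitAt m} {h' ∘ splitAt m} (λ i → eq (splitAt m i))) (sum-⊎ m n h')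
  where
    h' : Fin m ⊎ Fin n → ℕ
    h' (inj₁ i) = h (inj₁ (Inverse.from f i))
    h' (inj₂ j) = h (inj₂ (Inverse.from g j))
    eq : ∀ x → h (Inverse.from (f ⊎-↔ g) x) ≡ h' x
    eq (inj₁ i) = refl
    eq (inj₂ j) = refl

total-independent : ∀ {A : Set} {m n} (f : A ↔ Fin m) (g : A ↔ Fin n) (h : A → ℕ) → total f h ≡ total g h
total-independent {m = m} {n} f g h = trans (sum-permute (h ∘ Inverse.from f) π)
  (sum-cong-≗ {n} {h ∘ Inverse.from f ∘ Inverse.to f ∘ Inverse.from g} {h ∘ Inverse.from g}
    (λ i → cong h (Inverse.strictlyInverseʳ f (Inverse.from g i))))
  where
    π : Permutation n m
    π = ↔-trans (↔-sym g) f

-- Each pair {k, ι k} contributes twice the same value.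
total-even : ∀ {A : Set} {n} (f : A ↔ Fin n) (ι : A → A) → (∀ a → ι (ι a) ≡ a) → (∀ a → ι a ≢ a) →
  (h : A → ℕ) → (∀ a → h (ι a) ≡ h a) → ∃ λ k → total f h ≡ k + k
total-even {A} {n} f ι ι-ι ι-≢ h h-ι = total f low , (begin
    total f h                        ≡⟨ total-cong f split ⟩
    sum (λ i → low (from i) + low (ι (from i))) ≡⟨ ∑-distrib-+ {n} (low ∘ from) (low ∘ ι ∘ from) ⟩
    total f low + total f (low ∘ ι)  ≡⟨ cong (total f low +_) (total-ι low) ⟩
    total f low + total f low        ∎)
  where
    open ≡-Reasoning
    open Inverse f
    -- Of each pair only the member with the smaller index contributes.
    low : A → ℕ
    low a with to a Finₚ.<? to (ι a)
    ... | yes _ = h a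
    ... | no  _ = 0
    split : ∀ a → h a ≡ low a + low (ι a)
    split a with to a Finₚ.<? to (ι a) | to (ι a) Finₚ.<? to (ι (ι a))
    ... | yes p | yes q = ⊥-elim (ℕₚ.<-asym p (subst (λ b → to (ι a) Fin.< to b) (ι-ι a) q))
    ... | yes p | no ¬q = sym (ℕₚ.+-identityʳ (h a))
    ... | no ¬p | yes q = sym (h-ι a)
    ... | no ¬p | no ¬q = ⊥-elim (ι-≢ a (sym (trans (sym (strictlyInverseʳ a)) (trans (cong from
          (Finₚ.toℕ-injective (ℕₚ.≤-antisym (ℕₚ.≮⇒≥ (subst (λ b → ¬ to (ι a) Fin.< to b) (ι-ι a) ¬q)) (ℕₚ.≮⇒≥ ¬p))))
          (strictlyInverseʳ (ι a))))))
    flip : A ↔ A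
    flip = mk↔ₛ′ ι ι ι-ι ι-ι
    total-ι : ∀ g → total f (g ∘ ι) ≡ total f g
    total-ι g = total-independent (↔-trans flip f) f g

triple : ∀ {A : Set} → (A × Fin 3) ↔ (A ⊎ (A ⊎ A))
triple = mk↔ₛ′
  (λ { (a , 0F) → inj₁ a ; (a , 1F) → inj₂ (inj₁ a) ; (a , 2F) → inj₂ (inj₂ a) })
  (λ { (inj₁ a) → a , 0F ; (inj₂ (inj₁ a)) → a , 1F ; (inj₂ (inj₂ a)) → a , 2F })
  (λ { (inj₁ a) → refl ; (inj₂ (inj₁ a)) → refl ; (inj₂ (inj₂ a)) → refl })
  (λ { (a , 0F) → refl ; (a , 1F) → refl ; (a , 2F) → refl })

total-triple : ∀ {A : Set} {n k} (f : A ↔ Fin n) (g : (A × Fin 3) ↔ Fin k) (h : A × Fin 3 → ℕ) →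
  total g h ≡ total f (λ a → h (a , 0F) + (h (a , 1F) + h (a , 2F)))
total-triple {n = n} f g h = begin
  total g h  ≡⟨ total-independent g (↔-trans triple (↔-trans (f ⊎-↔ ff) (↔-sym Finₚ.+↔⊎))) h ⟩
  total (↔-trans (f ⊎-↔ ff) (↔-sym Finₚ.+↔⊎)) (h ∘ Inverse.from triple)
    ≡⟨ total-⊎ f ff (h ∘ Inverse.from triple) ⟩
  total f h₀ + total ff (h ∘ Inverse.from triple ∘ inj₂)
    ≡⟨ cong (total f h₀ +_) (total-⊎ f f (h ∘ Inverse.from triple ∘ inj₂)) ⟩
  total f h₀ + (total f h₁ + total f h₂)
    ≡⟨ cong (total f h₀ +_) (sym (∑-distrib-+ {n} (h₁ ∘ Inverse.from f) (h₂ ∘ Inverse.from f))) ⟩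
  total f h₀ + total f (λ a → h₁ a + h₂ a)
    ≡⟨ sym (∑-distrib-+ {n} (h₀ ∘ Inverse.from f) (λ i → h₁ (Inverse.from f i) + h₂ (Inverse.from f i))) ⟩
  total f (λ a → h₀ a + (h₁ a + h₂ a)) ∎
  where
    open ≡-Reasoning
    ff = ↔-trans (f ⊎-↔ f) (↔-sym Finₚ.+↔⊎)
    h₀ = λ a → h (a , 0F)
    h₁ = λ a → h (a , 1F)
    h₂ = λ a → h (a , 2F)

δ : Fin 3 → Fin 3 → ℕ
δ 0F 0F = 1
δ 1F 1F = 1
δ 2F 2F = 1
δ _  _  = 0

rainbow : ∀ a b d → b ≢ a → d ≢ b → a ≢ d → ∀ c → δ c a + (δ c b + δ c d) ≡ 1
rainbow = toWitness {a? = Finₚ.all? λ a → Finₚ.all? λ b → Finₚ.all? λ d →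
  ¬? (b Finₚ.≟ a) →-dec ¬? (d Finₚ.≟ b) →-dec ¬? (a Finₚ.≟ d) →-dec
  Finₚ.all? λ c → δ c a + (δ c b + δ c d) ℕ.≟ 1} _

even? : ℕ → Bool
even? zero    = true
even? (suc n) = not (even? n)

even?-+ : ∀ m n → even? (m + n) ≡ not (even? m xor even? n)
even?-+ zero    n = sym (Boolₚ.not-involutive (even? n))
even?-+ (suc m) n = trans (cong not (even?-+ m n)) (h (even? m) (even? n))
  where
    h : ∀ a b → not (not (a xor b)) ≡ not (not a xor b)
    h true  true  = refl
    h true  false = refl
    h false true  = refl
    h false false = refl

even?-double : ∀ n → even? (n + n) ≡ true
even?-double n = trans (even?-+ n n) (cong not (Boolₚ.xor-same (even? n)))

-- Written out with the final `0`, so that it is definitionally the `sum` over the five hub darts.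
count : (Fin 5 → Fin 3) → Fin 3 → ℕ
count z c = δ c (z 0F) + (δ c (z 1F) + (δ c (z 2F) + (δ c (z 3F) + (δ c (z 4F) + 0))))

-- A proper 3-colouring of a 5-cycle uses the colours 2, 2 and 1 times.
pentagon : ∀ (z : Fin 5 → Fin 3) → (∀ i → z (s i) ≢ z i) → ∀ b → ¬ (∀ c → even? (count z c) ≡ b)
pentagon z proper b e = h (z 0F) (z 1F) (z 2F) (z 3F) (z 4F) (proper 0F) (proper 1F) (proper 2F) (proper 3F) (proper 4F)
    (trans (e 0F) (sym (e 1F))) (trans (e 1F) (sym (e 2F)))
  where
    v : Fin 3 → Fin 3 → Fin 3 → Fin 3 → Fin 3 → Fin 3 → Bool
    v x₀ x₁ x₂ x₃ x₄ c = even? (δ c x₀ + (δ c x₁ + (δ c x₂ + (δ c x₃ + (δ c x₄ + 0)))))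
    h : ∀ x₀ x₁ x₂ x₃ x₄ → x₁ ≢ x₀ → x₂ ≢ x₁ → x₃ ≢ x₂ → x₄ ≢ x₃ → x₀ ≢ x₄ →
        v x₀ x₁ x₂ x₃ x₄ 0F ≡ v x₀ x₁ x₂ x₃ x₄ 1F → ¬ (v x₀ x₁ x₂ x₃ x₄ 1F ≡ v x₀ x₁ x₂ x₃ x₄ 2F)
    h = toWitness {a? = Finₚ.all? λ x₀ → Finₚ.all? λ x₁ → Finₚ.all? λ x₂ → Finₚ.all? λ x₃ → Finₚ.all? λ x₄ →
      ¬? (x₁ Finₚ.≟ x₀) →-dec ¬? (x₂ Finₚ.≟ x₁) →-dec ¬? (x₃ Finₚ.≟ x₂) →-dec ¬? (x₄ Finₚ.≟ x₃) →-dec ¬? (x₀ Finₚ.≟ x₄) →-dec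
      (v x₀ x₁ x₂ x₃ x₄ 0F Boolₚ.≟ v x₀ x₁ x₂ x₃ x₄ 1F) →-dec ¬? (v x₀ x₁ x₂ x₃ x₄ 1F Boolₚ.≟ v x₀ x₁ x₂ x₃ x₄ 2F)} _

xor-cancelˡ : ∀ a {b c} → a xor b ≡ a xor c → b ≡ c
xor-cancelˡ true  {true}  {true}  e = refl
xor-cancelˡ true  {false} {false} e = refl
xor-cancelˡ false e = e

-- Crowning a pentagon

-- By `p-next`, `p` runs around a face. By `p-after` its five corners lie on different curves, so
-- each of them enters and leaves the circle once; this also rules out degenerate incidences of the
-- pentagon with itself.
module Corona (S : Saturated) (p : Fin 5 → Saturated.K S)
  (p-next : ∀ i → turn⁻ (Saturated.ι S (p i)) ≡ p (s i))
  (p-after : ∀ {i j} → Saturated.after S (p i) ≡ Saturated.after S (p j) → i ≡ j) where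
  open Saturated S

  private module EO = Orbits edges
          module FO = Orbits faces

  ι-nofix : ∀ k → ι k ≢ k
  ι-nofix k e = not-≢ (sym (cong orient (trans (sym (start-ι k)) (cong start e))))

  after-turn⁻ : ∀ k → after (turn⁻ k) ≡ before k
  after-turn⁻ k = trans (sym (before-turn (turn⁻ k))) (cong before (turn-turn⁻ k))

  p-injective : ∀ {i j} → p i ≡ p j → i ≡ j
  p-injective e = p-after (cong after e)

  -- A dart and its opposite lie on the same curve, so by `p-after` only `i` equal to `j` is
  -- possible, and `ι` has no fixed point.
  ιp≢p : ∀ i j → ι (p i) ≢ p j
  ιp≢p i j e with p-after {i} {j} (trans (sym (after-ι (p i))) (cong after e))
  ... | refl = ι-nofix (p i) e

  turn-p : ∀ i → turn (p (s i)) ≡ ι (p i)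
  turn-p i = trans (cong turn (sym (p-next i))) (turn-turn⁻ _)

  ψ-injective : ∀ {j k} → turn⁻ (ι j) ≡ turn⁻ (ι k) → j ≡ k
  ψ-injective {j} {k} e = trans (sym (ι-ι j)) (trans (cong ι (trans (sym (turn-turn⁻ _)) (trans (cong turn e) (turn-turn⁻ _)))) (ι-ι k))

  p-prev : ∀ {k} i → turn⁻ (ι k) ≡ p i → k ≡ p (s⁻ i)
  p-prev i e = ψ-injective (trans e (sym (trans (p-next (s⁻ i)) (cong p (s-s⁻ i)))))

  -- At the vertex of `p i` the pentagon uses `p i` and `turn (p i)`, the latter being
  -- `ι (p (s⁻ i))`; the third dart `turn⁻ (p i)` points outwards. This lemma and the next keep it
  -- off the pentagon.
  turn⁻p≢p : ∀ i j → p j ≢ turn⁻ (p i)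
  turn⁻p≢p i j e = ιp≢p (s⁻ j) i (sym (trans (sym (ι-ι (p i))) (cong ι (p-prev j (trans (cong turn⁻ (ι-ι (p i))) (sym e))))))

  turn⁻p≢ιp : ∀ i j → ι (p j) ≢ turn⁻ (p i)
  turn⁻p≢ιp i j e = ιp≢p (s⁻ i) (s j) (trans (sym (trans (cong (turn ∘ p) (sym (s-s⁻ i))) (turn-p (s⁻ i))))
    (trans (sym (turn⁻-turn⁻ (p i))) (trans (cong turn⁻ (sym e)) (p-next j))))

  _≟K_ : (j k : K) → Dec (j ≡ k)
  _≟K_ = via-injection (↔⇒↣ (↔-trans (↔-trans (Y↔ ⊎-↔ X↔) (↔-sym Finₚ.+↔⊎) ×-↔ ↔-refl) (↔-sym Finₚ.*↔×))) Finₚ._≟_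

  data Site (k : K) : Set where
    at    : ∀ i → p i ≡ k → Site k
    opp   : ∀ i → ι (p i) ≡ k → Site k
    other : (∀ i → p i ≢ k) → (∀ i → ι (p i) ≢ k) → Site k

  abstract
    site : ∀ k → Site k
    site k with Finₚ.any? (λ i → p i ≟K k) | Finₚ.any? (λ i → ι (p i) ≟K k)
    ... | yes (i , e) | _           = at i e
    ... | no ¬e       | yes (i , e) = opp i e
    ... | no ¬e       | no ¬e'      = other (λ i e → ¬e (i , e)) (λ i e → ¬e' (i , e))

  -- Definition by position relative to the pentagon. The three cases exclude each other, so the
  -- value does not depend on the evidence and `site` can stay abstract.
  module _ {A : Set} (a b : Fin 5 → A) (o : A) where
    pick : ∀ {k} → Site k → A
    pick (at i _)    = a i
    pick (opp i _)   = b i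
    pick (other _ _) = o

    pick-at : ∀ i (c : Site (p i)) → pick c ≡ a i
    pick-at i (at j e)    = cong a (p-injective e)
    pick-at i (opp j e)   = ⊥-elim (ιp≢p j i e)
    pick-at i (other n _) = ⊥-elim (n i refl)

    pick-opp : ∀ i (c : Site (ι (p i))) → pick c ≡ b i
    pick-opp i (at j e)    = ⊥-elim (ιp≢p i j (sym e))
    pick-opp i (opp j e)   = cong b (p-injective (trans (sym (ι-ι _)) (trans (cong ι e) (ι-ι _))))
    pick-opp i (other _ n) = ⊥-elim (n i refl)

    pick-other : ∀ {k} → (∀ i → p i ≢ k) → (∀ i → ι (p i) ≢ k) → (c : Site k) → pick c ≡ o
    pick-other n n' (at i e)    = ⊥-elim (n i e)
    pick-other n n' (opp i e)   = ⊥-elim (n' i e)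
    pick-other n n' (other _ _) = refl

  -- Each edge p i of the pentagon is subdivided by a vertex with darts mid i 0F
  -- (towards p i), mid i 1F (towards ι (p i)) and mid i 2F (towards the new
  -- vertex of degree five, whose darts are hub i).
  K⁺ : Set
  K⁺ = K ⊎ ((Fin 5 × Fin 3) ⊎ Fin 5)

  pattern old k   = inj₁ k
  pattern mid i a = inj₂ (inj₁ (i , a))
  pattern hub i   = inj₂ (inj₂ i)

  rot⁺ rot⁺⁻ ι⁺ : K⁺ → K⁺
  rot⁺ (old k)   = old (turn k)
  rot⁺ (mid i a) = mid i (r a)
  rot⁺ (hub i)   = hub (s i)
  rot⁺⁻ (old k)   = old (turn⁻ k)
  rot⁺⁻ (mid i a) = mid i (r⁻ a)
  rot⁺⁻ (hub i)   = hub (s⁻ i)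
  ι⁺ (old k)    = pick (λ i → mid i 0F) (λ i → mid i 1F) (old (ι k)) (site k)
  ι⁺ (mid i 0F) = old (p i)
  ι⁺ (mid i 1F) = old (ι (p i))
  ι⁺ (mid i 2F) = hub i
  ι⁺ (hub i)    = mid i 2F

  ι⁺-at : ∀ i → ι⁺ (old (p i)) ≡ mid i 0F
  ι⁺-at i = pick-at _ _ _ i (site (p i))

  ι⁺-opp : ∀ i → ι⁺ (old (ι (p i))) ≡ mid i 1F
  ι⁺-opp i = pick-opp _ _ _ i (site (ι (p i)))

  ι⁺-other : ∀ {k} → (∀ i → p i ≢ k) → (∀ i → ι (p i) ≢ k) → ι⁺ (old k) ≡ old (ι k)
  ι⁺-other {k} n n' = pick-other _ _ _ n n' (site k)

  other-ι : ∀ {k} → (∀ i → p i ≢ k) → (∀ i → ι (p i) ≢ k) → (∀ i → p i ≢ ι k) × (∀ i → ι (p i) ≢ ι k)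
  other-ι n n' = (λ i e → n' i (trans (cong ι e) (ι-ι _))) ,
                 (λ i e → n i (trans (sym (ι-ι _)) (trans (cong ι e) (ι-ι _))))

  ι⁺-ι⁺ : ∀ k → ι⁺ (ι⁺ k) ≡ k
  ι⁺-ι⁺ (old k) with site k in eq
  ... | at i e    = cong old e
  ... | opp i e   = cong old e
  ... | other n m = trans (ι⁺-other (proj₁ (other-ι n m)) (proj₂ (other-ι n m))) (cong old (ι-ι k))
  ι⁺-ι⁺ (mid i 0F) = ι⁺-at i
  ι⁺-ι⁺ (mid i 1F) = ι⁺-opp i
  ι⁺-ι⁺ (mid i 2F) = refl
  ι⁺-ι⁺ (hub i)    = refl

  ι⁺-nofix : ∀ k → ι⁺ k ≢ k
  ι⁺-nofix (old k) e with site k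
  ι⁺-nofix (old k) () | at i _
  ι⁺-nofix (old k) () | opp i _
  ι⁺-nofix (old k) e  | other _ _ = ι-nofix k (old-injective e)
    where
      old-injective : ∀ {j k} → _≡_ {A = K⁺} (old j) (old k) → j ≡ k
      old-injective refl = refl
  ι⁺-nofix (mid i 0F) ()
  ι⁺-nofix (mid i 1F) ()
  ι⁺-nofix (mid i 2F) ()
  ι⁺-nofix (hub i) ()

  rot⁺-rot⁺⁻ : ∀ k → rot⁺ (rot⁺⁻ k) ≡ k
  rot⁺-rot⁺⁻ (old k)   = cong old (turn-turn⁻ k)
  rot⁺-rot⁺⁻ (mid i a) = cong (λ a → mid i a) (r-r⁻ a)
  rot⁺-rot⁺⁻ (hub i)   = cong (λ i → hub i) (s-s⁻ i)

  rot⁺⁻-rot⁺ : ∀ k → rot⁺⁻ (rot⁺ k) ≡ k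
  rot⁺⁻-rot⁺ (old k)   = cong old (turn⁻-turn k)
  rot⁺⁻-rot⁺ (mid i a) = cong (λ a → mid i a) (r⁻-r a)
  rot⁺⁻-rot⁺ (hub i)   = cong (λ i → hub i) (s⁻-s i)

  -- Cells of the crowned map

  V⁺ E⁺ F⁺ C⁺ : Set
  V⁺ = (Y ⊎ X) ⊎ (Fin 5 ⊎ Fin 1)
  E⁺ = E ⊎ (Fin 5 ⊎ Fin 5)
  F⁺ = F ⊎ Fin 4
  C⁺ = Maybe C

  vertices⁺ : Orbits rot⁺ V⁺
  vertices⁺ = record
    { cls = cls ; rep = rep ; cls-π = cls-π
    ; cls-rep = λ { (inj₁ t) → refl ; (inj₂ (inj₁ i)) → refl ; (inj₂ (inj₂ 0F)) → refl }
    ; reach = reach }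
    where
      cls : K⁺ → V⁺
      cls (old (t , _)) = inj₁ t
      cls (mid i _)     = inj₂ (inj₁ i)
      cls (hub _)       = inj₂ (inj₂ 0F)
      rep : V⁺ → K⁺
      rep (inj₁ t)        = old (t , 0F)
      rep (inj₂ (inj₁ i)) = mid i 0F
      rep (inj₂ (inj₂ _)) = hub 0F
      cls-π : ∀ k → cls (rot⁺ k) ≡ cls k
      cls-π (old k)   = refl
      cls-π (mid i a) = refl
      cls-π (hub i)   = refl
      reach : ∀ k → Leads rot⁺ k (rep (cls k))
      reach (old (t , 0F)) = 0 , refl
      reach (old (t , 1F)) = 2 , refl
      reach (old (t , 2F)) = 1 , refl
      reach (mid i 0F) = 0 , refl
      reach (mid i 1F) = 2 , refl
      reach (mid i 2F) = 1 , refl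
      reach (hub 0F) = 0 , refl
      reach (hub 1F) = 4 , refl
      reach (hub 2F) = 3 , refl
      reach (hub 3F) = 2 , refl
      reach (hub 4F) = 1 , refl

  -- The half of a subdivided edge at `p i` inherits the old index, although it is now a crossing
  -- with the circle; the other half and the spoke receive new indices.
  edge⁺ : K⁺ → E⁺
  edge⁺ (old k)    = pick (λ i → inj₁ (edge (p i))) (λ i → inj₂ (inj₁ i)) (inj₁ (edge k)) (site k)
  edge⁺ (mid i 0F) = inj₁ (edge (p i))
  edge⁺ (mid i 1F) = inj₂ (inj₁ i)
  edge⁺ (mid i 2F) = inj₂ (inj₂ i)
  edge⁺ (hub i)    = inj₂ (inj₂ i)

  edge⁺-at : ∀ i → edge⁺ (old (p i)) ≡ inj₁ (edge (p i))
  edge⁺-at i = pick-at _ _ _ i (site (p i))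

  edge⁺-opp : ∀ i → edge⁺ (old (ι (p i))) ≡ inj₂ (inj₁ i)
  edge⁺-opp i = pick-opp _ _ _ i (site (ι (p i)))

  edge⁺-other : ∀ {k} → (∀ i → p i ≢ k) → (∀ i → ι (p i) ≢ k) → edge⁺ (old k) ≡ inj₁ (edge k)
  edge⁺-other {k} n n' = pick-other _ _ _ n n' (site k)

  edges⁺ : Orbits ι⁺ E⁺
  edges⁺ = record { cls = edge⁺ ; rep = rep ; cls-π = cls-π ; cls-rep = cls-rep ; reach = reach }
    where
      rep : E⁺ → K⁺
      rep (inj₁ e)        = pick (λ i → old (p i)) (λ i → old (p i)) (old (EO.rep e)) (site (EO.rep e))
      rep (inj₂ (inj₁ i)) = mid i 1F
      rep (inj₂ (inj₂ i)) = hub i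
      cls-π : ∀ k → edge⁺ (ι⁺ k) ≡ edge⁺ k
      cls-π (old k) with site k
      ... | at i e    = refl
      ... | opp i e   = refl
      ... | other n m = trans (edge⁺-other (proj₁ (other-ι n m)) (proj₂ (other-ι n m))) (cong inj₁ (EO.cls-π k))
      cls-π (mid i 0F) = edge⁺-at i
      cls-π (mid i 1F) = edge⁺-opp i
      cls-π (mid i 2F) = refl
      cls-π (hub i)    = refl
      cls-rep : ∀ e → edge⁺ (rep e) ≡ e
      cls-rep (inj₁ e) with site (EO.rep e) in eq
      ... | at i q    = trans (edge⁺-at i) (cong inj₁ (trans (cong edge q) (EO.cls-rep e)))
      ... | opp i q   = trans (edge⁺-at i) (cong inj₁ (trans (sym (EO.cls-π (p i))) (trans (cong edge q) (EO.cls-rep e))))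
      ... | other n m = trans (edge⁺-other n m) (cong inj₁ (EO.cls-rep e))
      cls-rep (inj₂ (inj₁ i)) = refl
      cls-rep (inj₂ (inj₂ i)) = refl
      rep-at : ∀ i → rep (inj₁ (edge (p i))) ≡ old (p i)
      rep-at i with involution-class ι-ι edges {EO.rep (edge (p i))} {p i} (EO.cls-rep _)
      ... | inj₁ e rewrite e = pick-at _ _ _ i (site (p i))
      ... | inj₂ e rewrite e = pick-opp _ _ _ i (site (ι (p i)))
      rep-other : ∀ {k} → (∀ i → p i ≢ k) → (∀ i → ι (p i) ≢ k) → Leads ι⁺ (old k) (rep (inj₁ (edge k)))
      rep-other {k} n m with involution-class ι-ι edges {EO.rep (edge k)} {k} (EO.cls-rep _)
      ... | inj₁ e rewrite e = 0 , sym (pick-other _ _ _ n m (site k))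
      ... | inj₂ e rewrite e = 1 , trans (ι⁺-other n m)
              (sym (pick-other _ _ _ (proj₁ (other-ι n m)) (proj₂ (other-ι n m)) (site (ι k))))
      reach : ∀ k → Leads ι⁺ k (rep (edge⁺ k))
      reach (old k) = go (site k)
        where
          go : Site k → Leads ι⁺ (old k) (rep (edge⁺ (old k)))
          go (at i refl)  = 0 , sym (trans (cong rep (edge⁺-at i)) (rep-at i))
          go (opp i refl) = 1 , trans (ι⁺-opp i) (sym (cong rep (edge⁺-opp i)))
          go (other n m)  = subst (Leads ι⁺ (old k) ∘ rep) (sym (edge⁺-other n m)) (rep-other n m)
      reach (mid i 0F) = 1 , sym (rep-at i)
      reach (mid i 1F) = 0 , refl
      reach (mid i 2F) = 1 , refl
      reach (hub i)    = 0 , refl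

  -- The spokes cut the pentagon into five faces; one inherits the old index, so only four are new.
  slot : Fin 5 → F⁺
  slot zero    = inj₁ (FO.cls (p 0F))
  slot (suc i) = inj₂ i

  face⁺ : K⁺ → F⁺
  face⁺ (old k)    = pick slot (λ _ → inj₁ (FO.cls k)) (inj₁ (FO.cls k)) (site k)
  face⁺ (mid i 0F) = inj₁ (FO.cls (ι (p i)))
  face⁺ (mid i 1F) = slot (s i)
  face⁺ (mid i 2F) = slot i
  face⁺ (hub i)    = slot (s i)

  face⁺-at : ∀ i → face⁺ (old (p i)) ≡ slot i
  face⁺-at i = pick-at _ _ _ i (site (p i))

  face⁺-old : ∀ {k} → (∀ i → p i ≢ k) → face⁺ (old k) ≡ inj₁ (FO.cls k)
  face⁺-old {k} n = go (site k)
    where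
      go : (c : Site k) → pick slot (λ _ → inj₁ (FO.cls k)) (inj₁ (FO.cls k)) c ≡ inj₁ (FO.cls k)
      go (at i e)    = ⊥-elim (n i e)
      go (opp i e)   = refl
      go (other _ _) = refl

  -- The step along a face is injective and permutes the pentagon, so a dart off the pentagon never
  -- enters it.
  avoids-ψ : ∀ {k} → (∀ i → p i ≢ k) → ∀ i → p i ≢ turn⁻ (ι k)
  avoids-ψ n i e = n (s⁻ i) (sym (p-prev i (sym e)))

  face-p : ∀ i → FO.cls (p i) ≡ FO.cls (p 0F)
  face-p = λ { 0F → refl ; 1F → one ; 2F → two' ; 3F → three ; 4F → trans (next 3F) three }
    where
      next : ∀ i → FO.cls (p (s i)) ≡ FO.cls (p i)
      next i = trans (cong FO.cls (sym (p-next i))) (FO.cls-π (p i))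
      one   = next 0F
      two'  = trans (next 1F) one
      three = trans (next 2F) two'

  faces⁺ : Orbits (rot⁺⁻ ∘ ι⁺) F⁺
  faces⁺ = record { cls = face⁺ ; rep = rep ; cls-π = cls-π ; cls-rep = cls-rep ; reach = reach }
    where
      ψ⁺ : K⁺ → K⁺
      ψ⁺ = rot⁺⁻ ∘ ι⁺
      rep : F⁺ → K⁺
      rep (inj₁ f) = pick (λ _ → old (p 0F)) (λ _ → old (FO.rep f)) (old (FO.rep f)) (site (FO.rep f))
      rep (inj₂ i) = old (p (suc i))
      cls-π : ∀ k → face⁺ (ψ⁺ k) ≡ face⁺ k
      cls-π (old k) = go (site k)
        where
          go : Site k → face⁺ (ψ⁺ (old k)) ≡ face⁺ (old k)
          go (at i refl)  = trans (cong (face⁺ ∘ rot⁺⁻) (ι⁺-at i)) (sym (face⁺-at i))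
          go (opp i refl) = trans (cong (face⁺ ∘ rot⁺⁻) (ι⁺-opp i)) (sym (face⁺-old (λ j e → ιp≢p i j (sym e))))
          go (other n m)  = trans (cong (face⁺ ∘ rot⁺⁻) (ι⁺-other n m))
            (trans (face⁺-old (avoids-ψ n)) (trans (cong inj₁ (FO.cls-π k)) (sym (face⁺-old n))))
      cls-π (mid i 0F) = trans (face⁺-old (turn⁻p≢p i)) (cong inj₁
        (trans (cong (FO.cls ∘ turn⁻) (sym (ι-ι (p i)))) (FO.cls-π (ι (p i)))))
      cls-π (mid i 1F) = trans (cong (face⁺ ∘ old) (p-next i)) (face⁺-at (s i))
      cls-π (mid i 2F) = cong slot (s-s⁻ i)
      cls-π (hub i)    = refl
      cls-rep : ∀ f → face⁺ (rep f) ≡ f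
      cls-rep (inj₁ f) with site (FO.rep f) in eq
      ... | at i e    = trans (face⁺-at 0F) (cong inj₁ (trans (sym (face-p i)) (trans (cong FO.cls e) (FO.cls-rep f))))
      ... | opp i e   = trans (face⁺-old (λ j e' → ιp≢p i j (trans e (sym e')))) (cong inj₁ (FO.cls-rep f))
      ... | other n m = trans (face⁺-old n) (cong inj₁ (FO.cls-rep f))
      cls-rep (inj₂ i) = face⁺-at (suc i)

      iter-p : ∀ n i → ∃ λ j → p j ≡ iter (turn⁻ ∘ ι) n (p i)
      iter-p zero    i = i , refl
      iter-p (suc n) i with iter-p n i
      ... | j , e = s j , trans (sym (p-next j)) (cong (turn⁻ ∘ ι) e)
      rep-p : rep (inj₁ (FO.cls (p 0F))) ≡ old (p 0F)
      rep-p with FO.reach (p 0F)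
      ... | n , e with iter-p n 0F
      ...   | j , e' with trans e' e
      ...     | e'' rewrite sym e'' = pick-at _ _ _ j (site (p j))
      reach-p : ∀ i → Leads ψ⁺ (old (p i)) (rep (slot i))
      reach-p zero    = 0 , sym rep-p
      reach-p (suc i) = 0 , refl

      step-old : ∀ {k} → (∀ i → p i ≢ k) → Leads ψ⁺ (old k) (old (turn⁻ (ι k)))
      step-old {k} n = go (site k)
        where
          go : Site k → Leads ψ⁺ (old k) (old (turn⁻ (ι k)))
          go (at i e)     = ⊥-elim (n i e)
          go (opp i refl) = 2 , trans (cong (ψ⁺ ∘ rot⁺⁻) (ι⁺-opp i)) (cong (old ∘ turn⁻) (sym (ι-ι (p i))))
          go (other n m)  = 1 , cong rot⁺⁻ (ι⁺-other n m)
      iter-old : ∀ n {k} → (∀ i → p i ≢ k) → (∀ i → p i ≢ iter (turn⁻ ∘ ι) n k) × Leads ψ⁺ (old k) (old (iter (turn⁻ ∘ ι) n k))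
      iter-old zero    a = a , 0 , refl
      iter-old (suc n) a with iter-old n a
      ... | a' , l = avoids-ψ a' , leads-trans ψ⁺ l (step-old a')
      reach-old : ∀ {k} → (∀ i → p i ≢ k) → Leads ψ⁺ (old k) (rep (inj₁ (FO.cls k)))
      reach-old {k} a with FO.reach k
      ... | n , e with iter-old n a
      ...   | a' , l rewrite e = subst (Leads ψ⁺ (old k)) (sym (go (site (FO.rep (FO.cls k))))) l
        where
          go : (c : Site (FO.rep (FO.cls k))) → pick (λ _ → old (p 0F)) (λ _ → old (FO.rep (FO.cls k))) (old (FO.rep (FO.cls k))) c ≡ old (FO.rep (FO.cls k))
          go (at i e)    = ⊥-elim (a' i e)
          go (opp i e)   = refl
          go (other _ _) = refl
      reach : ∀ k → Leads ψ⁺ k (rep (face⁺ k))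
      reach (old k) = go (site k)
        where
          go : Site k → Leads ψ⁺ (old k) (rep (face⁺ (old k)))
          go (at i refl)  = subst (Leads ψ⁺ (old (p i)) ∘ rep) (sym (face⁺-at i)) (reach-p i)
          go (opp i refl) = subst (Leads ψ⁺ (old (ι (p i))) ∘ rep) (sym (face⁺-old (λ j e → ιp≢p i j (sym e)))) (reach-old (λ j e → ιp≢p i j (sym e)))
          go (other n m)  = subst (Leads ψ⁺ (old k) ∘ rep) (sym (face⁺-old n)) (reach-old n)
      reach (mid i 0F) = leads-trans ψ⁺ (1 , refl) (subst (λ f → Leads ψ⁺ (old (turn⁻ (p i))) (rep (inj₁ f)))
        (trans (cong (FO.cls ∘ turn⁻) (sym (ι-ι (p i)))) (FO.cls-π (ι (p i)))) (reach-old (turn⁻p≢p i)))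
      reach (mid i 1F) = leads-trans ψ⁺ (1 , cong old (p-next i)) (reach-p (s i))
      reach (mid i 2F) = leads-trans ψ⁺ (3 , cong old (trans (p-next (s⁻ i)) (cong p (s-s⁻ i)))) (reach-p i)
      reach (hub i)    = leads-trans ψ⁺ (2 , cong old (p-next i)) (reach-p (s i))

  -- `nothing` is the circle. It takes over the arc `p i` in each corner of the pentagon; the curve
  -- displaced from there continues through `hub (s⁻ i)`.
  lab⁺ : K⁺ → C⁺
  lab⁺ (old k)    = pick (λ _ → nothing) (λ _ → just (after k)) (just (after k)) (site k)
  lab⁺ (mid i 0F) = nothing
  lab⁺ (mid i 1F) = just (after (p i))
  lab⁺ (mid i 2F) = just (after (p (s i)))
  lab⁺ (hub i)    = just (after (p (s i)))

  lab⁺-at : ∀ i → lab⁺ (old (p i)) ≡ nothing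
  lab⁺-at i = pick-at _ _ _ i (site (p i))

  lab⁺-old : ∀ {k} → (∀ i → p i ≢ k) → lab⁺ (old k) ≡ just (after k)
  lab⁺-old {k} n = go (site k)
    where
      go : (c : Site k) → pick (λ _ → nothing) (λ _ → just (after k)) (just (after k)) c ≡ just (after k)
      go (at i e)    = ⊥-elim (n i e)
      go (opp i e)   = refl
      go (other _ _) = refl

  lab⁺-opp : ∀ i → lab⁺ (old (ι (p i))) ≡ just (after (p i))
  lab⁺-opp i = trans (lab⁺-old (λ j e → ιp≢p i j (sym e))) (cong just (after-ι (p i)))

  after-turn⁻p : ∀ i → after (turn⁻ (p i)) ≡ after (p (s i))
  after-turn⁻p i = trans (after-turn⁻ (p i)) (trans (sym (before-ι (p i))) (trans (sym (after-turn⁻ (ι (p i)))) (cong after (p-next i))))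

  lab⁺-turn⁻p : ∀ i → lab⁺ (old (turn⁻ (p i))) ≡ just (after (p (s i)))
  lab⁺-turn⁻p i = trans (lab⁺-old (turn⁻p≢p i)) (cong just (after-turn⁻p i))

  other-turn⁻ : ∀ {k} → (∀ i → ι (p i) ≢ k) → ∀ i → p i ≢ turn⁻ k
  other-turn⁻ m i e = m (s⁻ i) (trans (sym (turn-p (s⁻ i))) (trans (cong (turn ∘ p) (s-s⁻ i)) (trans (cong turn e) (turn-turn⁻ _))))

  lab⁺-ι : ∀ k → lab⁺ (ι⁺ k) ≡ lab⁺ k
  lab⁺-ι (old k) = go (site k)
    where
      go : Site k → lab⁺ (ι⁺ (old k)) ≡ lab⁺ (old k)
      go (at i refl)  = trans (cong lab⁺ (ι⁺-at i)) (sym (lab⁺-at i))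
      go (opp i refl) = trans (cong lab⁺ (ι⁺-opp i)) (sym (lab⁺-opp i))
      go (other n m)  = trans (cong lab⁺ (ι⁺-other n m))
        (trans (lab⁺-old (proj₁ (other-ι n m))) (trans (cong just (after-ι k)) (sym (lab⁺-old n))))
  lab⁺-ι (mid i 0F) = lab⁺-at i
  lab⁺-ι (mid i 1F) = lab⁺-opp i
  lab⁺-ι (mid i 2F) = refl
  lab⁺-ι (hub i)    = refl

  lab⁺-ρ : ∀ k → lab⁺ (rot⁺⁻ (ι⁺ k)) ≡ lab⁺ (rot⁺⁻ k)
  lab⁺-ρ (old k) = go (site k)
    where
      go : Site k → lab⁺ (rot⁺⁻ (ι⁺ (old k))) ≡ lab⁺ (old (turn⁻ k))
      go (at i refl)  = trans (cong (lab⁺ ∘ rot⁺⁻) (ι⁺-at i)) (sym (lab⁺-turn⁻p i))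
      go (opp i refl) = trans (cong (lab⁺ ∘ rot⁺⁻) (ι⁺-opp i)) (sym (trans (cong (lab⁺ ∘ old) (p-next i)) (lab⁺-at (s i))))
      go (other n m)  = trans (cong (lab⁺ ∘ rot⁺⁻) (ι⁺-other n m)) (trans (lab⁺-old (avoids-ψ n))
        (trans (cong just (trans (after-turn⁻ (ι k)) (trans (before-ι k) (sym (after-turn⁻ k))))) (sym (lab⁺-old (other-turn⁻ m)))))
  lab⁺-ρ (mid i 0F) = lab⁺-turn⁻p i
  lab⁺-ρ (mid i 1F) = trans (cong (lab⁺ ∘ old) (p-next i)) (lab⁺-at (s i))
  lab⁺-ρ (mid i 2F) = cong (just ∘ after ∘ p) (s-s⁻ i)
  lab⁺-ρ (hub i)    = cong (just ∘ after ∘ p) (sym (s-s⁻ i))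

  -- spoke is an old crossing on the pentagon, enter and leave are crossings with the new circle.
  data Crossing (k : K⁺) : Set where
    away : ∀ o → lab⁺ k ≡ just (after o) → lab⁺ (rot⁺⁻ k) ≡ just (before o) →
            (∀ i → p i ≢ o) → (∀ i → ι (p i) ≢ o) → edge⁺ k ≡ inj₁ (edge o) → Crossing k
    spoke : ∀ i → lab⁺ k ≡ just (after (p (s i))) → lab⁺ (rot⁺⁻ k) ≡ just (after (p i)) →
            edge⁺ k ≡ inj₂ (inj₂ i) → Crossing k
    enter : ∀ i → lab⁺ k ≡ nothing → lab⁺ (rot⁺⁻ k) ≡ just (after (p (s i))) → edge⁺ k ≡ inj₁ (edge (p i)) → Crossing k
    leave : ∀ i → lab⁺ k ≡ just (after (p i)) → lab⁺ (rot⁺⁻ k) ≡ nothing → edge⁺ k ≡ inj₂ (inj₁ i) → Crossing k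

  crossing⁺ : ∀ k → Crossing k
  crossing⁺ (old k) = go (site k)
    where
      go : Site k → Crossing (old k)
      go (at i refl)  = enter i (lab⁺-at i) (lab⁺-turn⁻p i) (edge⁺-at i)
      go (opp i refl) = leave i (lab⁺-opp i) (trans (cong (lab⁺ ∘ old) (p-next i)) (lab⁺-at (s i))) (edge⁺-opp i)
      go (other n m)  = away k (lab⁺-old n) (trans (lab⁺-old (other-turn⁻ m)) (cong just (after-turn⁻ k))) n m (edge⁺-other n m)
  crossing⁺ (mid i 0F) = enter i refl refl refl
  crossing⁺ (mid i 1F) = leave i refl refl refl
  crossing⁺ (mid i 2F) = spoke i refl refl refl
  crossing⁺ (hub i)    = spoke i refl (cong (just ∘ after ∘ p) (s-s⁻ i)) refl

  lab⁺-≢ : ∀ k → lab⁺ k ≢ lab⁺ (rot⁺⁻ k)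
  lab⁺-≢ k e with crossing⁺ k
  ... | away o a b _ _ _ = cross o (just-injective (trans (sym a) (trans e b)))
  ... | spoke i a b _     = s-≢ i (p-after (just-injective (trans (sym a) (trans e b))))
  ... | enter i a b _     with () ← trans (sym a) (trans e b)
  ... | leave i a b _     with () ← trans (sym a) (trans e b)

  Meets⁺ : C⁺ → C⁺ → K⁺ → Set
  Meets⁺ a b k = (lab⁺ k ≡ a × lab⁺ (rot⁺⁻ k) ≡ b) ⊎ (lab⁺ k ≡ b × lab⁺ (rot⁺⁻ k) ≡ a)

  before-p : ∀ i → before (p i) ≡ after (p (s i))
  before-p i = trans (sym (after-turn⁻ (p i))) (after-turn⁻p i)

  -- Where an old crossing is found now: those on the pentagon have moved to the spokes.
  edge⁺-old : K → E⁺
  edge⁺-old o = pick (λ i → inj₂ (inj₂ i)) (λ i → inj₂ (inj₂ i)) (inj₁ (edge o)) (site o)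

  edge⁺-old-ι : ∀ o → edge⁺-old (ι o) ≡ edge⁺-old o
  edge⁺-old-ι o = go (site o)
    where
      go : Site o → edge⁺-old (ι o) ≡ edge⁺-old o
      go (at i refl)  = trans (pick-opp _ _ _ i (site _)) (sym (pick-at _ _ _ i (site _)))
      go (opp i refl) = trans (cong edge⁺-old (ι-ι (p i))) (trans (pick-at _ _ _ i (site _)) (sym (pick-opp _ _ _ i (site _))))
      go (other n m)  = trans (pick-other _ _ _ (proj₁ (other-ι n m)) (proj₂ (other-ι n m)) (site _))
        (trans (cong inj₁ (EO.cls-π o)) (sym (pick-other _ _ _ n m (site _))))

  edge⁺-old-cong : ∀ {j k} → edge j ≡ edge k → edge⁺-old j ≡ edge⁺-old k
  edge⁺-old-cong {j} {k} e with involution-class ι-ι edges {j} {k} e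
  ... | inj₁ refl = refl
  ... | inj₂ refl = edge⁺-old-ι k

  below : ∀ {a b} k → Meets⁺ (just a) (just b) k → ∃ λ o → Meets a b o × edge⁺ k ≡ edge⁺-old o
  below {a} {b} k m with crossing⁺ k
  below k (inj₁ (p , q)) | away o u v n m e = o ,
    inj₁ (just-injective (trans (sym u) p) , just-injective (trans (sym v) q)) , trans e (sym (pick-other _ _ _ n m (site o)))
  below k (inj₂ (p , q)) | away o u v n m e = o ,
    inj₂ (just-injective (trans (sym u) p) , just-injective (trans (sym v) q)) , trans e (sym (pick-other _ _ _ n m (site o)))
  below k (inj₁ (x , y)) | spoke i u v e = p i ,
    inj₂ (just-injective (trans (sym v) y) , trans (before-p i) (just-injective (trans (sym u) x))) , trans e (sym (pick-at _ _ _ i (site (p i))))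
  below k (inj₂ (x , y)) | spoke i u v e = p i ,
    inj₁ (just-injective (trans (sym v) y) , trans (before-p i) (just-injective (trans (sym u) x))) , trans e (sym (pick-at _ _ _ i (site (p i))))
  below k (inj₁ (x , y)) | enter i u v e with () ← trans (sym u) x
  below k (inj₂ (x , y)) | enter i u v e with () ← trans (sym u) x
  below k (inj₁ (x , y)) | leave i u v e with () ← trans (sym v) y
  below k (inj₂ (x , y)) | leave i u v e with () ← trans (sym v) y

  data Ring (a : C) (e : E⁺) : Set where
    enter : ∀ i → after (p (s i)) ≡ a → e ≡ inj₁ (edge (p i)) → Ring a e
    leave : ∀ i → after (p i) ≡ a → e ≡ inj₂ (inj₁ i) → Ring a e

  ring : ∀ {a} k → Meets⁺ nothing (just a) k → Ring a (edge⁺ k)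
  ring k m with crossing⁺ k
  ring k (inj₁ (x , y)) | away o u v _ _ e with () ← trans (sym u) x
  ring k (inj₂ (x , y)) | away o u v _ _ e with () ← trans (sym v) y
  ring k (inj₁ (x , y)) | spoke i u v e with () ← trans (sym u) x
  ring k (inj₂ (x , y)) | spoke i u v e with () ← trans (sym v) y
  ring k (inj₁ (x , y)) | enter i u v e = enter i (just-injective (trans (sym v) y)) e
  ring k (inj₂ (x , y)) | enter i u v e with () ← trans (sym u) x
  ring k (inj₁ (x , y)) | leave i u v e with () ← trans (sym u) x
  ring k (inj₂ (x , y)) | leave i u v e = leave i (just-injective (trans (sym u) x)) e

  s-injective : ∀ {i j} → s i ≡ s j → i ≡ j
  s-injective {i} {j} e = trans (sym (s⁻-s i)) (trans (cong s⁻ e) (s⁻-s j))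

  enter-unique : ∀ {a} {e f : E⁺} i j → after (p (s i)) ≡ a → after (p (s j)) ≡ a → e ≡ inj₁ (edge (p i)) → f ≡ inj₁ (edge (p j)) → e ≡ f
  enter-unique i j x y u v = trans u (trans (cong (inj₁ ∘ edge ∘ p) (s-injective (p-after (trans x (sym y))))) (sym v))

  leave-unique : ∀ {a} {e f : E⁺} i j → after (p i) ≡ a → after (p j) ≡ a → e ≡ inj₂ (inj₁ i) → f ≡ inj₂ (inj₁ j) → e ≡ f
  leave-unique i j x y u v = trans u (trans (cong {B = E⁺} (λ i → inj₂ (inj₁ i)) (p-after (trans x (sym y)))) (sym v))

  -- A curve has at most one entrance and one exit, and among three crossings two are of the same
  -- sort.
  ring-two : ∀ {a e f g} → Ring a e → Ring a f → Ring a g → e ≡ f ⊎ e ≡ g ⊎ f ≡ g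
  ring-two (enter i x u) (enter j y v) _             = inj₁ (enter-unique i j x y u v)
  ring-two (leave i x u) (leave j y v) _             = inj₁ (leave-unique i j x y u v)
  ring-two (enter i x u) (leave j y v) (enter k z w) = inj₂ (inj₁ (enter-unique i k x z u w))
  ring-two (leave i x u) (enter j y v) (leave k z w) = inj₂ (inj₁ (leave-unique i k x z u w))
  ring-two (enter i x u) (leave j y v) (leave k z w) = inj₂ (inj₂ (leave-unique j k y z v w))
  ring-two (leave i x u) (enter j y v) (enter k z w) = inj₂ (inj₂ (enter-unique j k y z v w))

  swap⁺ : ∀ {a b k} → Meets⁺ a b k → Meets⁺ b a k
  swap⁺ (inj₁ m) = inj₂ m
  swap⁺ (inj₂ m) = inj₁ m

  two⁺ : ∀ {a b} → a ≢ b → ∀ {i j k} → Meets⁺ a b i → Meets⁺ a b j → Meets⁺ a b k →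
         edge⁺ i ≡ edge⁺ j ⊎ edge⁺ i ≡ edge⁺ k ⊎ edge⁺ j ≡ edge⁺ k
  two⁺ {nothing} {nothing} ne _ _ _ = ⊥-elim (ne refl)
  two⁺ {nothing} {just b}  ne {i} {j} {k} mi mj mk = ring-two (ring i mi) (ring j mj) (ring k mk)
  two⁺ {just a}  {nothing} ne {i} {j} {k} mi mj mk = ring-two (ring i (swap⁺ {k = i} mi)) (ring j (swap⁺ {k = j} mj)) (ring k (swap⁺ {k = k} mk))
  two⁺ {just a}  {just b}  ne {i} {j} {k} mi mj mk with below i mi | below j mj | below k mk
  ... | i' , mi' , ei | j' , mj' , ej | k' , mk' , ek with two (λ e → ne (cong just e)) mi' mj' mk'
  ...   | inj₁ e        = inj₁ (trans ei (trans (edge⁺-old-cong e) (sym ej)))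
  ...   | inj₂ (inj₁ e) = inj₂ (inj₁ (trans ei (trans (edge⁺-old-cong e) (sym ek))))
  ...   | inj₂ (inj₂ e) = inj₂ (inj₂ (trans ej (trans (edge⁺-old-cong e) (sym ek))))

  meet⁺ : ∀ {a b} → a ≢ b → a ≢ nothing → b ≢ nothing → ∃ (Meets⁺ a b)
  meet⁺ {nothing} ne na nb = ⊥-elim (na refl)
  meet⁺ {just a} {nothing} ne na nb = ⊥-elim (nb refl)
  meet⁺ {just a} {just b} ne _ _ with meet (λ e → ne (cong just e))
  ... | k , m = above (site k) m
    where
      hub-meets : ∀ i {x y} → after (p i) ≡ x → before (p i) ≡ y → lab⁺ (hub i) ≡ just y × lab⁺ (rot⁺⁻ (hub i)) ≡ just x
      hub-meets i u v = cong just (trans (sym (before-p i)) v) , cong just (trans (cong (after ∘ p) (s-s⁻ i)) u)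
      above : Site k → Meets a b k → ∃ (Meets⁺ (just a) (just b))
      above (at i refl)  (inj₁ (u , v)) = hub i , inj₂ (hub-meets i u v)
      above (at i refl)  (inj₂ (u , v)) = hub i , inj₁ (hub-meets i u v)
      above (opp i refl) (inj₁ (u , v)) = hub i , inj₂ (hub-meets i (trans (sym (after-ι _)) u) (trans (sym (before-ι _)) v))
      above (opp i refl) (inj₂ (u , v)) = hub i , inj₁ (hub-meets i (trans (sym (after-ι _)) u) (trans (sym (before-ι _)) v))
      above (other n n') (inj₁ (u , v)) = old k , inj₁ (trans (lab⁺-old n) (cong just u) , trans (lab⁺-old (other-turn⁻ n')) (cong just (trans (after-turn⁻ k) v)))
      above (other n n') (inj₂ (u , v)) = old k , inj₂ (trans (lab⁺-old n) (cong just u) , trans (lab⁺-old (other-turn⁻ n')) (cong just (trans (after-turn⁻ k) v)))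

  -- Zigzags of the crowned map

  Zig⁺ : K⁺ → K⁺ → Set
  Zig⁺ = Zig rot⁺ rot⁺⁻ ι⁺

  zig⁺-sym : ∀ {j k} → Zig⁺ j k → Zig⁺ k j
  zig⁺-sym = zig-sym ι⁺-ι⁺ rot⁺-rot⁺⁻ rot⁺⁻-rot⁺

  by-ι : ∀ {k j} → ι⁺ k ≡ j → Zig⁺ k j
  by-ι refl = viaι done

  by-ρ : ∀ {k j l} → ι⁺ (rot⁺ k) ≡ l → rot⁺⁻ l ≡ j → Zig⁺ k j
  by-ρ refl refl = viaρ done

  -- An arc of the new map on the same curve; arcs lost to the circle are replaced by their detour
  -- at the hub.
  lift : K → K⁺
  lift k = pick (λ i → hub (s⁻ i)) (λ _ → old k) (old k) (site k)

  lift-at : ∀ i → lift (p i) ≡ hub (s⁻ i)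
  lift-at i = pick-at _ _ _ i (site (p i))

  lift-old : ∀ {k} → (∀ i → p i ≢ k) → lift k ≡ old k
  lift-old {k} n = go (site k)
    where
      go : (c : Site k) → pick (λ i → hub (s⁻ i)) (λ _ → old k) (old k) c ≡ old k
      go (at i e)    = ⊥-elim (n i e)
      go (opp i e)   = refl
      go (other _ _) = refl

  lift-opp : ∀ i → Zig⁺ (old (ι (p i))) (hub (s⁻ i))
  lift-opp i = zig-trans (by-ι (ι⁺-opp i)) (by-ρ refl refl)

  lift-ι : ∀ k → Zig⁺ (lift k) (lift (ι k))
  lift-ι k = go (site k)
    where
      opposite : ∀ i → Zig⁺ (lift (ι (p i))) (lift (p i))
      opposite i = subst₂ Zig⁺ (sym (lift-old (λ j e → ιp≢p i j (sym e)))) (sym (lift-at i)) (lift-opp i)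
      go : Site k → Zig⁺ (lift k) (lift (ι k))
      go (at i refl)  = zig⁺-sym (opposite i)
      go (opp i refl) = subst (λ j → Zig⁺ (lift (ι (p i))) (lift j)) (sym (ι-ι (p i))) (opposite i)
      go (other n m)  = subst₂ Zig⁺ (sym (lift-old n)) (sym (lift-old (proj₁ (other-ι n m)))) (by-ι (ι⁺-other n m))

  lift-ρ' : ∀ k → Zig⁺ (lift (turn⁻ k)) (lift (turn⁻ (ι k)))
  lift-ρ' k = go (site k)
    where
      hub-at : ∀ i → lift (turn⁻ (ι (p i))) ≡ hub i
      hub-at i = trans (cong lift (p-next i)) (trans (lift-at (s i)) (cong (λ i → hub i) (s⁻-s i)))
      around : ∀ i → Zig⁺ (lift (turn⁻ (p i))) (lift (turn⁻ (ι (p i))))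
      around i = subst₂ Zig⁺ (sym (lift-old (turn⁻p≢p i))) (sym (hub-at i))
        (zig-trans (by-ρ {l = mid i 0F} (trans (cong (ι⁺ ∘ old) (turn-turn⁻ (p i))) (ι⁺-at i)) refl) (by-ι refl))
      go : Site k → Zig⁺ (lift (turn⁻ k)) (lift (turn⁻ (ι k)))
      go (at i refl)  = around i
      go (opp i refl) = subst (λ j → Zig⁺ (lift (turn⁻ (ι (p i)))) (lift (turn⁻ j))) (sym (ι-ι (p i))) (zig⁺-sym (around i))
      go (other n m)  = subst₂ Zig⁺ (sym (lift-old (other-turn⁻ m))) (sym (lift-old (avoids-ψ n)))
        (by-ρ (trans (cong (ι⁺ ∘ old) (turn-turn⁻ k)) (ι⁺-other n m)) refl)

  lift-zig : ∀ {j k} → Zig turn turn⁻ ι j k → Zig⁺ (lift j) (lift k)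
  lift-zig done = done
  lift-zig (viaι z) = zig-trans (lift-ι _) (lift-zig z)
  lift-zig {j} (viaρ z) = zig-trans (subst (λ i → Zig⁺ (lift i) (lift (turn⁻ (ι (turn j))))) (turn⁻-turn j) (lift-ρ' (turn j))) (lift-zig z)

  to-lift : ∀ {a} k → lab⁺ k ≡ just a → ∃ λ j → after j ≡ a × Zig⁺ k (lift j)
  to-lift (old k) = go (site k)
    where
      go : ∀ {a} → Site k → lab⁺ (old k) ≡ just a → ∃ λ j → after j ≡ a × Zig⁺ (old k) (lift j)
      go (at i refl)  e with () ← trans (sym (lab⁺-at i)) e
      go (opp i refl) e = p i , just-injective (trans (sym (lab⁺-opp i)) e) , subst (Zig⁺ _) (sym (lift-at i)) (lift-opp i)
      go (other n m)  e = k , just-injective (trans (sym (lab⁺-old n)) e) , subst (Zig⁺ (old k)) (sym (lift-old n)) done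
  to-lift (mid i 0F) ()
  to-lift (mid i 1F) refl = p i , refl , subst (Zig⁺ _) (sym (lift-at i)) (by-ρ refl refl)
  to-lift (mid i 2F) refl = p (s i) , refl , subst (Zig⁺ _) (sym (trans (lift-at (s i)) (cong (λ i → hub i) (s⁻-s i)))) (by-ι refl)
  to-lift (hub i)    refl = p (s i) , refl , subst (Zig⁺ _) (sym (trans (lift-at (s i)) (cong (λ i → hub i) (s⁻-s i)))) done

  -- The circle is one closed curve: it passes from each subdividing vertex to the next through the
  -- corner between them.
  to-ring : ∀ k → lab⁺ k ≡ nothing → Zig⁺ k (old (p 0F))
  to-ring = λ
    { (old k) → start⁺ (site k) ; (mid i 0F) _ → enter⁺ i ; (mid i 1F) () ; (mid i 2F) () ; (hub i) () }
    where
      next : ∀ i → Zig⁺ (mid i 0F) (mid (s i) 0F)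
      next i = zig-trans (by-ρ refl (cong old (p-next i))) (by-ι (ι⁺-at (s i)))
      enter⁺ : ∀ i → Zig⁺ (mid i 0F) (old (p 0F))
      enter⁺ 0F = by-ι refl
      enter⁺ 4F = zig-trans (next 4F) (by-ι refl)
      enter⁺ 3F = zig-trans (next 3F) (zig-trans (next 4F) (by-ι refl))
      enter⁺ 2F = zig-trans (next 2F) (zig-trans (next 3F) (zig-trans (next 4F) (by-ι refl)))
      enter⁺ 1F = zig-trans (next 1F) (zig-trans (next 2F) (zig-trans (next 3F) (zig-trans (next 4F) (by-ι refl))))
      start⁺ : ∀ {k} → Site k → lab⁺ (old k) ≡ nothing → Zig⁺ (old k) (old (p 0F))
      start⁺ (at i refl)  e = zig-trans (by-ι (ι⁺-at i)) (enter⁺ i)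
      start⁺ (opp i refl) e with () ← trans (sym (lab⁺-opp i)) e
      start⁺ (other n m)  e with () ← trans (sym (lab⁺-old n)) e

  zig⁺ : ∀ {j k} → lab⁺ j ≡ lab⁺ k → Zig⁺ j k
  zig⁺ {j} {k} e with lab⁺ k in eq
  ... | nothing = zig-trans (to-ring j e) (zig⁺-sym (to-ring k eq))
  ... | just a with to-lift j e | to-lift k eq
  ...   | j' , u , z | k' , v , w = zig-trans z (zig-trans (lift-zig (zig (trans u (sym v)))) (zig⁺-sym w))

  T↔ : (Y ⊎ X) ↔ Fin (#Y + #X)
  T↔ = ↔-trans (Y↔ ⊎-↔ X↔) (↔-sym Finₚ.+↔⊎)

  K↔ : K ↔ Fin ((#Y + #X) * 3)
  K↔ = ↔-trans (T↔ ×-↔ ↔-refl) (↔-sym Finₚ.*↔×)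

  M↔ : (Fin 5 × Fin 3) ↔ Fin 15
  M↔ = ↔-sym Finₚ.*↔×

  N↔ : ((Fin 5 × Fin 3) ⊎ Fin 5) ↔ Fin 20
  N↔ = ↔-trans (M↔ ⊎-↔ ↔-refl) (↔-sym Finₚ.+↔⊎)

  K⁺↔ : K⁺ ↔ Fin ((#Y + #X) * 3 + 20)
  K⁺↔ = ↔-trans (K↔ ⊎-↔ N↔) (↔-sym Finₚ.+↔⊎)

  -- Every vertex of degree three sees each colour once and every edge is seen
  -- twice, so all colours occur with the same parity around the hub.
  not-three : ¬ ∃ λ (g : K⁺ → Fin 3) → (∀ k → g (ι⁺ k) ≡ g k) × (∀ k → g (rot⁺ k) ≢ g k)
  not-three (g , g-ι , g-rot) = pentagon (λ i → g (hub i)) (λ i → g-rot (hub i)) (even? (N + 5)) parity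
    where
      N : ℕ
      N = total T↔ (λ _ → 1)
      at-old : ∀ c → total K↔ (λ k → δ c (g (old k))) ≡ N
      at-old c = trans (total-triple T↔ K↔ (λ k → δ c (g (old k)))) (total-cong T↔ λ t →
        rainbow _ _ _ (g-rot (old (t , 0F))) (g-rot (old (t , 1F))) (g-rot (old (t , 2F))) c)
      at-mid : ∀ c → total M↔ (λ k → δ c (g (inj₂ (inj₁ k)))) ≡ 5
      at-mid c = trans (total-triple ↔-refl M↔ (λ k → δ c (g (inj₂ (inj₁ k))))) (total-cong (↔-refl {A = Fin 5}) λ i →
        rainbow _ _ _ (g-rot (mid i 0F)) (g-rot (mid i 1F)) (g-rot (mid i 2F)) c)
      all : ∀ c → total K⁺↔ (δ c ∘ g) ≡ (N + 5) + count (λ i → g (hub i)) c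
      all c = trans (total-⊎ K↔ N↔ (δ c ∘ g)) (trans (cong₂ _+_ (at-old c)
        (trans (total-⊎ M↔ ↔-refl (δ c ∘ g ∘ inj₂)) (cong (_+ count (λ i → g (hub i)) c) (at-mid c))))
        (sym (ℕₚ.+-assoc N 5 _)))
      even : ∀ c → even? ((N + 5) + count (λ i → g (hub i)) c) ≡ true
      even c with total-even K⁺↔ ι⁺ ι⁺-ι⁺ ι⁺-nofix (δ c ∘ g) (λ k → cong (δ c) (g-ι k))
      ... | n , e = trans (cong even? (trans (sym (all c)) e)) (even?-double n)
      parity : ∀ c → even? (count (λ i → g (hub i)) c) ≡ even? (N + 5)
      parity c = xor-cancelˡ (even? (N + 5)) (trans (xor-false (trans (sym (even?-+ (N + 5) _)) (even c)))
        (sym (Boolₚ.xor-same (even? (N + 5)))))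
        where
          xor-false : ∀ {b} → not b ≡ true → b ≡ false
          xor-false {false} e = refl

  -- A proper 4-colouring of the crowned map

  outerColour : Fin 5 → Fin 4
  outerColour i = colour (turn⁻ (p i))

  -- Greedy choice. The halves of the subdivided edges form a cycle of length ten, from `B₀`, `A₁`,
  -- `B₁` on to `A₀`, each member of which also avoids one outer edge; repeated arguments of `avoid`
  -- stand for absent constraints. `B₁` avoids `B₀` too, so that the second spoke can take `B₀`;
  -- then the four neighbours of `Z₀` show only three colours.
  colourA colourB colourZ : Fin 5 → Fin 4
  private
    B₀ = avoid (outerColour 1F) (outerColour 1F) (outerColour 1F)
    A₁ = avoid (outerColour 1F) B₀ B₀
    B₁ = avoid (outerColour 2F) A₁ B₀
    A₂ = avoid (outerColour 2F) B₁ B₁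
    B₂ = avoid (outerColour 3F) A₂ A₂
    A₃ = avoid (outerColour 3F) B₂ B₂
    B₃ = avoid (outerColour 4F) A₃ A₃
    A₄ = avoid (outerColour 4F) B₃ B₃
    B₄ = avoid (outerColour 0F) A₄ A₄
    A₀ = avoid (outerColour 0F) B₄ B₀
    Z₂ = avoid A₂ B₂ B₀
    Z₃ = avoid A₃ B₃ Z₂
    Z₄ = avoid A₄ B₄ Z₃
    Z₀ = avoid A₀ B₀ Z₄
  colourA = λ { 0F → A₀ ; 1F → A₁ ; 2F → A₂ ; 3F → A₃ ; 4F → A₄ }
  colourB = λ { 0F → B₀ ; 1F → B₁ ; 2F → B₂ ; 3F → B₃ ; 4F → B₄ }
  -- The colour B₀ is not used at the second spoke, which makes the cycle of spokes colourable.
  colourZ = λ { 0F → Z₀ ; 1F → B₀ ; 2F → Z₂ ; 3F → Z₃ ; 4F → Z₄ }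

  private
    avoid₁ : ∀ a b d → avoid a b d ≢ a
    avoid₁ a b d = proj₁ (avoid-≢ a b d)
    avoid₂ : ∀ a b d → avoid a b d ≢ b
    avoid₂ a b d = proj₁ (proj₂ (avoid-≢ a b d))
    avoid₃ : ∀ a b d → avoid a b d ≢ d
    avoid₃ a b d = proj₂ (proj₂ (avoid-≢ a b d))

  A-outer : ∀ i → colourA i ≢ outerColour i
  A-outer 0F = avoid₁ _ _ _
  A-outer 1F = avoid₁ _ _ _
  A-outer 2F = avoid₁ _ _ _
  A-outer 3F = avoid₁ _ _ _
  A-outer 4F = avoid₁ _ _ _

  B-outer : ∀ i → colourB i ≢ outerColour (s i)
  B-outer 0F = avoid₁ _ _ _
  B-outer 1F = avoid₁ _ _ _
  B-outer 2F = avoid₁ _ _ _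
  B-outer 3F = avoid₁ _ _ _
  B-outer 4F = avoid₁ _ _ _

  B-A : ∀ i → colourB i ≢ colourA i
  B-A 0F = avoid₃ (outerColour 0F) B₄ B₀ ∘ sym
  B-A 1F = avoid₂ (outerColour 2F) _ _
  B-A 2F = avoid₂ (outerColour 3F) _ _
  B-A 3F = avoid₂ (outerColour 4F) _ _
  B-A 4F = avoid₂ (outerColour 0F) _ _

  A-B : ∀ i → colourA (s i) ≢ colourB i
  A-B 0F = avoid₂ (outerColour 1F) _ _
  A-B 1F = avoid₂ (outerColour 2F) _ _
  A-B 2F = avoid₂ (outerColour 3F) _ _
  A-B 3F = avoid₂ (outerColour 4F) _ _
  A-B 4F = avoid₂ (outerColour 0F) _ _

  Z-A : ∀ i → colourZ i ≢ colourA i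
  Z-A 0F = avoid₁ _ _ _
  Z-A 1F = A-B 0F ∘ sym
  Z-A 2F = avoid₁ _ _ _
  Z-A 3F = avoid₁ _ _ _
  Z-A 4F = avoid₁ _ _ _

  Z-B : ∀ i → colourZ i ≢ colourB i
  Z-B 0F = avoid₂ A₀ _ _
  Z-B 1F = avoid₃ (outerColour 2F) A₁ B₀ ∘ sym
  Z-B 2F = avoid₂ A₂ _ _
  Z-B 3F = avoid₂ A₃ _ _
  Z-B 4F = avoid₂ A₄ _ _

  Z-Z : ∀ i → colourZ (s i) ≢ colourZ i
  Z-Z 0F = Z-B 0F ∘ sym
  Z-Z 1F = avoid₃ A₂ B₂ _
  Z-Z 2F = avoid₃ A₃ B₃ _
  Z-Z 3F = avoid₃ A₄ B₄ _
  Z-Z 4F = avoid₃ A₀ B₀ _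

  colour⁺ : K⁺ → Fin 4
  colour⁺ (old k)    = pick colourA colourB (colour k) (site k)
  colour⁺ (mid i 0F) = colourA i
  colour⁺ (mid i 1F) = colourB i
  colour⁺ (mid i 2F) = colourZ i
  colour⁺ (hub i)    = colourZ i

  colour⁺-at : ∀ i → colour⁺ (old (p i)) ≡ colourA i
  colour⁺-at i = pick-at _ _ _ i (site (p i))

  colour⁺-opp : ∀ i → colour⁺ (old (ι (p i))) ≡ colourB i
  colour⁺-opp i = pick-opp _ _ _ i (site (ι (p i)))

  colour⁺-other : ∀ {k} → (∀ i → p i ≢ k) → (∀ i → ι (p i) ≢ k) → colour⁺ (old k) ≡ colour k
  colour⁺-other {k} n m = pick-other _ _ _ n m (site k)

  colour⁺-outer : ∀ i → colour⁺ (old (turn⁻ (p i))) ≡ outerColour i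
  colour⁺-outer i = colour⁺-other (turn⁻p≢p i) (turn⁻p≢ιp i)

  colour⁺-ι : ∀ k → colour⁺ (ι⁺ k) ≡ colour⁺ k
  colour⁺-ι (old k) = go (site k)
    where
      go : Site k → colour⁺ (ι⁺ (old k)) ≡ colour⁺ (old k)
      go (at i refl)  = trans (cong colour⁺ (ι⁺-at i)) (sym (colour⁺-at i))
      go (opp i refl) = trans (cong colour⁺ (ι⁺-opp i)) (sym (colour⁺-opp i))
      go (other n m)  = trans (cong colour⁺ (ι⁺-other n m)) (trans (colour⁺-other (proj₁ (other-ι n m)) (proj₂ (other-ι n m)))
        (trans (colour-ι k) (sym (colour⁺-other n m))))
  colour⁺-ι (mid i 0F) = colour⁺-at i
  colour⁺-ι (mid i 1F) = colour⁺-opp i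
  colour⁺-ι (mid i 2F) = refl
  colour⁺-ι (hub i)    = refl

  colour⁺-rot : ∀ k → colour⁺ (rot⁺ k) ≢ colour⁺ k
  colour⁺-rot (old k) = go (site k)
    where
      turn-p' : ∀ i → turn (p i) ≡ ι (p (s⁻ i))
      turn-p' i = trans (cong (turn ∘ p) (sym (s-s⁻ i))) (turn-p (s⁻ i))
      turn-ιp : ∀ i → turn (ι (p i)) ≡ turn⁻ (p (s i))
      turn-ιp i = trans (cong turn (sym (turn-p i))) (turn-turn (p (s i)))
      beside : ∀ {k} → (∀ i → p i ≢ k) → (∀ i → ι (p i) ≢ k) → Site (turn k) → colour⁺ (old (turn k)) ≢ colour⁺ (old k)
      beside n m (at i e) eq = A-outer i (trans (sym (colour⁺-at i)) (trans (cong (colour⁺ ∘ old) e)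
        (trans eq (trans (cong (colour⁺ ∘ old) (trans (sym (turn⁻-turn _)) (cong turn⁻ (sym e)))) (colour⁺-outer i)))))
      beside n m (opp i e) eq = n (s i) (trans (sym (p-next i)) (trans (cong turn⁻ e) (turn⁻-turn _)))
      beside n m (other n' m') eq = colour-turn _ (trans (sym (colour⁺-other n' m')) (trans eq (colour⁺-other n m)))
      go : Site k → colour⁺ (old (turn k)) ≢ colour⁺ (old k)
      go (at i refl) eq = A-B (s⁻ i) (trans (cong colourA (s-s⁻ i)) (trans (sym (colour⁺-at i)) (trans (sym eq)
        (trans (cong (colour⁺ ∘ old) (turn-p' i)) (colour⁺-opp (s⁻ i))))))
      go (opp i refl) eq = B-outer i (trans (sym (colour⁺-opp i)) (trans (sym eq)
        (trans (cong (colour⁺ ∘ old) (turn-ιp i)) (colour⁺-outer (s i)))))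
      go (other n m) = beside n m (site (turn k))
  colour⁺-rot (mid i 0F) = B-A i
  colour⁺-rot (mid i 1F) = Z-B i
  colour⁺-rot (mid i 2F) = Z-A i ∘ sym
  colour⁺-rot (hub i)    = Z-Z i

  eulerian⁺ : (#Y + #X + (5 + 1)) + (#F + 4) ≡ (#E + (5 + 5)) + 2
  eulerian⁺ = trans (h (#Y + #X) #F) (trans (cong (_+ 10) eulerian) (h' #E))
    where
      h : ∀ t f → (t + 6) + (f + 4) ≡ (t + f) + 10
      h = solve-∀
      h' : ∀ e → (e + 2) + 10 ≡ (e + 10) + 2
      h' = solve-∀

  #K⁺ : (#Y + #X) * 3 + 20 ≡ (#E + (5 + 5)) + (#E + (5 + 5))
  #K⁺ = trans (cong (_+ 20) (sym handshake)) (h #E)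
    where
      h : ∀ e → (e + e) + 20 ≡ (e + 10) + (e + 10)
      h = solve-∀

  crowned : PlaneMap
  crowned = record
    { K = K⁺ ; V = V⁺ ; E = E⁺ ; F = F⁺ ; C = C⁺
    ; K↔ = subst (λ n → K⁺ ↔ Fin n) #K⁺ K⁺↔
    ; V↔ = ↔-trans (T↔ ⊎-↔ ↔-sym (Finₚ.+↔⊎ {5} {1})) (↔-sym Finₚ.+↔⊎)
    ; E↔ = ↔-trans (E↔ ⊎-↔ ↔-sym (Finₚ.+↔⊎ {5} {5})) (↔-sym Finₚ.+↔⊎)
    ; F↔ = ↔-trans (F↔ ⊎-↔ ↔-refl) (↔-sym Finₚ.+↔⊎)
    ; eulerian = eulerian⁺
    ; rot = rot⁺ ; rot⁻ = rot⁺⁻ ; ι = ι⁺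
    ; rot-rot⁻ = rot⁺-rot⁺⁻ ; rot⁻-rot = rot⁺⁻-rot⁺ ; ι-ι = ι⁺-ι⁺ ; ι-nofix = ι⁺-nofix
    ; vertices = vertices⁺ ; edges = edges⁺ ; faces = faces⁺
    ; _≟_ = maybe-dec _≟_
    ; lab = lab⁺ ; lab-ι = lab⁺-ι ; lab-ρ = lab⁺-ρ ; lab-≢ = lab⁺-≢
    ; zig = zig⁺ ; two = two⁺ ; c = nothing ; meet = meet⁺
    ; meet-c = just (after (p 1F)) , (λ ()) , old (p 0F) , inj₁ (lab⁺-at 0F , lab⁺-turn⁻p 0F)
    }

  chromatic-4 : ChromaticNumber (Medial.arrangement crowned) 4
  chromatic-4 = Medial.chromatic crowned (colour⁺ , colour⁺-ι , colour⁺-rot) not-three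

-- A pentagon in the doubled map

module CrownedDoubling (S : Saturated) where
  open Saturated S
  open Doubling S

  module _ (a b e : C) (t u w : Bool) where

    -- The face in place of an edge is bounded by both copies of each zigzag crossing there; at the
    -- plain end, one copy of the third zigzag of that vertex joins them.
    five : Fin 5 → C × Bool
    five 0F = a , t
    five 1F = b , not u
    five 2F = a , not t
    five 3F = b , u
    five 4F = e , w

    five-injective : a ≢ b → a ≢ e → b ≢ e → ∀ i j → five i ≡ five j → i ≡ j
    five-injective ab ae be 0F 0F q = refl
    five-injective ab ae be 0F 1F q = ⊥-elim (ab (cong proj₁ q))
    five-injective ab ae be 0F 2F q = ⊥-elim (not-≢ (cong proj₂ q))
    five-injective ab ae be 0F 3F q = ⊥-elim (ab (cong proj₁ q))
    five-injective ab ae be 0F 4F q = ⊥-elim (ae (cong proj₁ q))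
    five-injective ab ae be 1F 0F q = ⊥-elim (ab (sym (cong proj₁ q)))
    five-injective ab ae be 1F 1F q = refl
    five-injective ab ae be 1F 2F q = ⊥-elim (ab (sym (cong proj₁ q)))
    five-injective ab ae be 1F 3F q = ⊥-elim (not-≢ (sym (cong proj₂ q)))
    five-injective ab ae be 1F 4F q = ⊥-elim (be (cong proj₁ q))
    five-injective ab ae be 2F 0F q = ⊥-elim (not-≢ (sym (cong proj₂ q)))
    five-injective ab ae be 2F 1F q = ⊥-elim (ab (cong proj₁ q))
    five-injective ab ae be 2F 2F q = refl
    five-injective ab ae be 2F 3F q = ⊥-elim (ab (cong proj₁ q))
    five-injective ab ae be 2F 4F q = ⊥-elim (ae (cong proj₁ q))
    five-injective ab ae be 3F 0F q = ⊥-elim (ab (sym (cong proj₁ q)))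
    five-injective ab ae be 3F 1F q = ⊥-elim (not-≢ (cong proj₂ q))
    five-injective ab ae be 3F 2F q = ⊥-elim (ab (sym (cong proj₁ q)))
    five-injective ab ae be 3F 3F q = refl
    five-injective ab ae be 3F 4F q = ⊥-elim (be (cong proj₁ q))
    five-injective ab ae be 4F 0F q = ⊥-elim (ae (sym (cong proj₁ q)))
    five-injective ab ae be 4F 1F q = ⊥-elim (be (sym (cong proj₁ q)))
    five-injective ab ae be 4F 2F q = ⊥-elim (ae (sym (cong proj₁ q)))
    five-injective ab ae be 4F 3F q = ⊥-elim (be (sym (cong proj₁ q)))
    five-injective ab ae be 4F 4F q = refl

  y : Y
  y = proj₁ seam

  i : Fin 3
  i = proj₁ (proj₂ seam)

  x : X
  x = proj₁ (proj₂ (proj₂ seam))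

  j : Fin 3
  j = proj₁ (proj₂ (proj₂ (proj₂ seam)))

  ι-k : ι (plain y i) ≡ marked x j
  ι-k = proj₂ (proj₂ (proj₂ (proj₂ seam)))

  k : K
  k = plain y i

  -- The face that replaces an edge between a plain and a marked vertex is a pentagon.
  pentagonD : Fin 5 → Dart
  pentagonD 0F = nD (plain y (r⁻ i))
  pentagonD 1F = z1 x j
  pentagonD 2F = nD (marked x (r⁻ j))
  pentagonD 3F = sD y i
  pentagonD 4F = cD y (r⁻ i)

  follow-pentagon : ∀ n → follow (pentagonD n) ≡ pentagonD (s n)
  follow-pentagon 0F = cong (spin⁻ ∘ eD) (trans (cong ι (turn-turn⁻ k)) ι-k)
  follow-pentagon 1F = refl
  follow-pentagon 2F = cong (spin⁻ ∘ eD) (trans (cong ι (turn-turn⁻ (marked x j))) (trans (cong ι (sym ι-k)) (ι-ι k)))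
  follow-pentagon 3F = refl
  follow-pentagon 4F = refl

  copyBefore-plain : copyBefore k ≡ name (inner (start (turn⁻ k)))
  copyBefore-plain = trans (cong copyBefore (sym (turn-turn⁻ k))) (cong (λ a → name a , sign a) (end-plain y (r⁻ i)))

  names : Fin 5 → C'
  names = five (after k) (before k) (after (turn k)) (sign (start k)) (sign (end k)) (sign (start (turn k)))

  pentagon-names : ∀ n → afterD (pentagonD n) ≡
    names n
  pentagon-names 0F = cong (name ∘ inner ∘ start) (turn-turn⁻ k)
  pentagon-names 1F = trans (sym (before-marked x (r⁻ j))) (trans (cong copyBefore (trans (turn-turn⁻ (marked x j)) (sym ι-k))) (copies-ι k))
  pentagon-names 2F = trans (cong (name ∘ inner ∘ start) (trans (turn-turn⁻ (marked x j)) (sym ι-k)))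
    (trans (cong (name ∘ inner) (start-ι k)) (cong name (inner-reverse (start k))))
  pentagon-names 3F = sym copyBefore-plain
  pentagon-names 4F = cong (λ i → name (inner (start (plain y i)))) (r⁻-r⁻ i)

  -- Any two of the three arcs at a cubic vertex are consecutive, so `cross` separates all three
  -- curves.
  before≢ : before k ≢ after (turn k)
  before≢ e = after-turn (turn k) (trans (cong (λ i → after (plain y i)) (r-r i))
    (trans (sym (cong proj₁ copyBefore-plain)) e))

  pentagon⁺ : Fin 5 → K'
  pentagon⁺ = dart⁻ ∘ pentagonD

  pentagon⁺-next : ∀ n → turn⁻ (ι' (pentagon⁺ n)) ≡ pentagon⁺ (s n)
  pentagon⁺-next n = trans (sym (dart⁻-dart _)) (cong dart⁻ (trans (dart-turn⁻ (ι' (pentagon⁺ n)))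
    (trans (cong spin⁻ (trans (dart-dart⁻ (flip (dart (pentagon⁺ n)))) (cong flip (dart-dart⁻ (pentagonD n))))) (follow-pentagon n))))

  pentagon⁺-after : ∀ {m n} → afterD (dart (pentagon⁺ m)) ≡ afterD (dart (pentagon⁺ n)) → m ≡ n
  pentagon⁺-after {m} {n} e = five-injective (after k) (before k) (after (turn k)) (sign (start k)) (sign (end k)) (sign (start (turn k)))
    (cross k) (after-turn k ∘ sym) before≢ m n (trans (sym (at m)) (trans e (at n)))
    where
      at : ∀ n → afterD (dart (pentagon⁺ n)) ≡ names n
      at n = trans (cong afterD (dart-dart⁻ (pentagonD n))) (pentagon-names n)

  module Crown = Corona double pentagon⁺ pentagon⁺-next pentagon⁺-after

-- The infinite family

module Tetrahedron where
  K : Set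
  K = Triangles (Fin 2) (Fin 2)

  every : (P : K → Set) →
    P (plain 0F 0F) →
    P (plain 0F 1F) →
    P (plain 0F 2F) →
    P (plain 1F 0F) →
    P (plain 1F 1F) →
    P (plain 1F 2F) →
    P (marked 0F 0F) →
    P (marked 0F 1F) →
    P (marked 0F 2F) →
    P (marked 1F 0F) →
    P (marked 1F 1F) →
    P (marked 1F 2F) →
    ∀ k → P k
  every P p0 p1 p2 p3 p4 p5 p6 p7 p8 p9 p10 p11 (plain 0F 0F) = p0
  every P p0 p1 p2 p3 p4 p5 p6 p7 p8 p9 p10 p11 (plain 0F 1F) = p1
  every P p0 p1 p2 p3 p4 p5 p6 p7 p8 p9 p10 p11 (plain 0F 2F) = p2
  every P p0 p1 p2 p3 p4 p5 p6 p7 p8 p9 p10 p11 (plain 1F 0F) = p3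
  every P p0 p1 p2 p3 p4 p5 p6 p7 p8 p9 p10 p11 (plain 1F 1F) = p4
  every P p0 p1 p2 p3 p4 p5 p6 p7 p8 p9 p10 p11 (plain 1F 2F) = p5
  every P p0 p1 p2 p3 p4 p5 p6 p7 p8 p9 p10 p11 (marked 0F 0F) = p6
  every P p0 p1 p2 p3 p4 p5 p6 p7 p8 p9 p10 p11 (marked 0F 1F) = p7
  every P p0 p1 p2 p3 p4 p5 p6 p7 p8 p9 p10 p11 (marked 0F 2F) = p8
  every P p0 p1 p2 p3 p4 p5 p6 p7 p8 p9 p10 p11 (marked 1F 0F) = p9
  every P p0 p1 p2 p3 p4 p5 p6 p7 p8 p9 p10 p11 (marked 1F 1F) = p10
  every P p0 p1 p2 p3 p4 p5 p6 p7 p8 p9 p10 p11 (marked 1F 2F) = p11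

  ι : K → K
  ι (plain 0F 0F) = plain 1F 0F
  ι (plain 0F 1F) = marked 0F 0F
  ι (plain 0F 2F) = marked 1F 0F
  ι (plain 1F 0F) = plain 0F 0F
  ι (plain 1F 1F) = marked 1F 2F
  ι (plain 1F 2F) = marked 0F 1F
  ι (marked 0F 0F) = plain 0F 1F
  ι (marked 0F 1F) = plain 1F 2F
  ι (marked 0F 2F) = marked 1F 1F
  ι (marked 1F 0F) = plain 0F 2F
  ι (marked 1F 1F) = marked 0F 2F
  ι (marked 1F 2F) = plain 1F 1F

  -- The three zigzags are the Hamiltonian 4-cycles, and the medial arrangement is the octahedron.
  -- Each zigzag has one arc at every vertex, so marking two vertices gives it two marked arcs.
  start end : K → Attr (Fin 3)
  start (plain 0F 0F) = attr 0F true true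
  start (plain 0F 1F) = attr 1F true true
  start (plain 0F 2F) = attr 2F true true
  start (plain 1F 0F) = attr 0F false true
  start (plain 1F 1F) = attr 1F true false
  start (plain 1F 2F) = attr 2F false true
  start (marked 0F 0F) = attr 1F false true
  start (marked 0F 1F) = attr 2F true true
  start (marked 0F 2F) = attr 0F false false
  start (marked 1F 0F) = attr 2F false true
  start (marked 1F 1F) = attr 0F true false
  start (marked 1F 2F) = attr 1F false false
  end (plain y i)  = start (plain y (r⁻ i))
  end (marked x i) = twist (start (marked x (r⁻ i)))

  edge : K → Fin 6
  edge (plain 0F 0F) = 0F
  edge (plain 0F 1F) = 1F
  edge (plain 0F 2F) = 2F
  edge (plain 1F 0F) = 0F
  edge (plain 1F 1F) = 4F
  edge (plain 1F 2F) = 3F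
  edge (marked 0F 0F) = 1F
  edge (marked 0F 1F) = 3F
  edge (marked 0F 2F) = 5F
  edge (marked 1F 0F) = 2F
  edge (marked 1F 1F) = 5F
  edge (marked 1F 2F) = 4F

  face : K → Fin 4
  face (plain 0F 0F) = 0F
  face (plain 0F 1F) = 1F
  face (plain 0F 2F) = 2F
  face (plain 1F 0F) = 2F
  face (plain 1F 1F) = 3F
  face (plain 1F 2F) = 0F
  face (marked 0F 0F) = 0F
  face (marked 0F 1F) = 3F
  face (marked 0F 2F) = 1F
  face (marked 1F 0F) = 1F
  face (marked 1F 1F) = 3F
  face (marked 1F 2F) = 2F

  edges : Orbits ι (Fin 6)
  edges = record
    { cls = edge ; rep = rep ; cls-π = every _ refl refl refl refl refl refl refl refl refl refl refl refl
    ; cls-rep = λ { 0F → refl ; 1F → refl ; 2F → refl ; 3F → refl ; 4F → refl ; 5F → refl }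
    ; reach = every _ (0 , refl) (0 , refl) (0 , refl) (1 , refl) (0 , refl) (0 , refl) (1 , refl) (1 , refl) (0 , refl) (1 , refl) (1 , refl) (1 , refl) }
    where
      rep : Fin 6 → K
      rep 0F = plain 0F 0F
      rep 1F = plain 0F 1F
      rep 2F = plain 0F 2F
      rep 3F = plain 1F 2F
      rep 4F = plain 1F 1F
      rep 5F = marked 0F 2F

  faces : Orbits (turn⁻ ∘ ι) (Fin 4)
  faces = record
    { cls = face ; rep = rep ; cls-π = every _ refl refl refl refl refl refl refl refl refl refl refl refl
    ; cls-rep = λ { 0F → refl ; 1F → refl ; 2F → refl ; 3F → refl }
    ; reach = every _ (0 , refl) (0 , refl) (0 , refl) (1 , refl) (0 , refl) (2 , refl) (1 , refl) (1 , refl) (2 , refl) (1 , refl) (2 , refl) (2 , refl) }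
    where
      rep : Fin 4 → K
      rep 0F = plain 0F 0F
      rep 1F = plain 0F 1F
      rep 2F = plain 0F 2F
      rep 3F = plain 1F 1F

  after before : K → Fin 3
  after  = name ∘ start
  before = name ∘ end

  before-after : ∀ k → before k ≡ r⁻ (after k)
  before-after = every _ refl refl refl refl refl refl refl refl refl refl refl refl

  to-start : ∀ k → Zig turn turn⁻ ι k (plain 0F (after k))
  to-start = every _ done done done (viaι done) (viaι (viaρ done)) (viaρ done) (viaι done) (viaι (viaρ done)) (viaρ done) (viaι done) (viaι (viaρ done)) (viaρ done)

  ι-ι : ∀ k → ι (ι k) ≡ k
  ι-ι = every _ refl refl refl refl refl refl refl refl refl refl refl refl

  Meets : Fin 3 → Fin 3 → K → Set
  Meets a b k = (after k ≡ a × before k ≡ b) ⊎ (after k ≡ b × before k ≡ a)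

  -- The curves follow each other in the same cyclic order at all vertices, so an unordered pair of
  -- them determines the one after the dart, and with it a pair of opposite edges.
  meets-after : ∀ {a b} i j → Meets a b i → Meets a b j → after i ≡ after j
  meets-after i j (inj₁ (p , _)) (inj₁ (q , _)) = trans p (sym q)
  meets-after i j (inj₂ (p , _)) (inj₂ (q , _)) = trans p (sym q)
  meets-after i j (inj₁ (p , q)) (inj₂ (p' , q')) = ⊥-elim (r⁻≢r (after i)
    (trans (sym (before-after i)) (trans q (trans (sym p') (sym (back j (after i) (trans q' (sym p))))))))
    where
      back : ∀ j a → before j ≡ a → r a ≡ after j
      back j a refl = trans (cong r (before-after j)) (r-r⁻ (after j))
      r⁻≢r : ∀ a → r⁻ a ≢ r a
      r⁻≢r 0F ()
      r⁻≢r 1F ()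
      r⁻≢r 2F ()
  meets-after i j (inj₂ m) (inj₁ n) = sym (meets-after j i (inj₁ n) (inj₂ m))

  kind : Fin 6 → Fin 3
  kind 0F = 0F
  kind 1F = 1F
  kind 2F = 2F
  kind 3F = 2F
  kind 4F = 1F
  kind 5F = 0F

  kind-edge : ∀ k → kind (edge k) ≡ after k
  kind-edge = every _ refl refl refl refl refl refl refl refl refl refl refl refl

  two-of-a-kind : ∀ d e f → kind d ≡ kind e → kind d ≡ kind f → d ≡ e ⊎ d ≡ f ⊎ e ≡ f
  two-of-a-kind = toWitness {a? = Finₚ.all? λ d → Finₚ.all? λ e → Finₚ.all? λ f →
    kind d Finₚ.≟ kind e →-dec kind d Finₚ.≟ kind f →-dec
    (d Finₚ.≟ e ⊎-dec d Finₚ.≟ f ⊎-dec e Finₚ.≟ f)} _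

  two : ∀ {a b} → a ≢ b → ∀ {i j k} → Meets a b i → Meets a b j → Meets a b k →
        edge i ≡ edge j ⊎ edge i ≡ edge k ⊎ edge j ≡ edge k
  two _ {i} {j} {k} p q o = two-of-a-kind (edge i) (edge j) (edge k)
    (trans (kind-edge i) (trans (meets-after i j p q) (sym (kind-edge j))))
    (trans (kind-edge i) (trans (meets-after i k p o) (sym (kind-edge k))))

  meet : ∀ {a b} → a ≢ b → ∃ (Meets a b)
  meet {0F} {0F} ne = ⊥-elim (ne refl)
  meet {0F} {1F} ne = plain 0F 1F , inj₂ (refl , refl)
  meet {0F} {2F} ne = plain 0F 0F , inj₁ (refl , refl)
  meet {1F} {0F} ne = plain 0F 1F , inj₁ (refl , refl)
  meet {1F} {1F} ne = ⊥-elim (ne refl)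
  meet {1F} {2F} ne = plain 0F 2F , inj₂ (refl , refl)
  meet {2F} {0F} ne = plain 0F 0F , inj₂ (refl , refl)
  meet {2F} {1F} ne = plain 0F 2F , inj₁ (refl , refl)
  meet {2F} {2F} ne = ⊥-elim (ne refl)

  two-marked : ∀ x i y j z k → after (marked x i) ≡ after (marked y j) → after (marked x i) ≡ after (marked z k) →
    (x , i) ≡ (y , j) ⊎ (x , i) ≡ (z , k) ⊎ (y , j) ≡ (z , k)
  two-marked = toWitness {a? =
    Finₚ.all? λ x → Finₚ.all? λ i → Finₚ.all? λ y → Finₚ.all? λ j → Finₚ.all? λ z → Finₚ.all? λ k →
    after (marked x i) Finₚ.≟ after (marked y j) →-dec after (marked x i) Finₚ.≟ after (marked z k) →-dec
    (≡-dec Finₚ._≟_ Finₚ._≟_ (x , i) (y , j) ⊎-dec ≡-dec Finₚ._≟_ Finₚ._≟_ (x , i) (z , k)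
      ⊎-dec ≡-dec Finₚ._≟_ Finₚ._≟_ (y , j) (z , k))} _

  tetrahedron : Saturated
  tetrahedron = record
    { Y = Fin 2 ; X = Fin 2 ; E = Fin 6 ; F = Fin 4 ; C = Fin 3
    ; Y↔ = ↔-refl ; X↔ = ↔-refl ; E↔ = ↔-refl ; F↔ = ↔-refl
    ; eulerian = refl ; handshake = refl
    ; ι = ι ; ι-ι = ι-ι ; edges = edges ; faces = faces
    ; _≟_ = Finₚ._≟_ ; start = start ; end = end
    ; start-ι = every _ refl refl refl refl refl refl refl refl refl refl refl refl
    ; end-ι = every _ refl refl refl refl refl refl refl refl refl refl refl refl
    ; end-plain = λ y i → cong (λ i → start (plain y i)) (r⁻-r i)
    ; end-marked = λ x i → cong (λ i → twist (start (marked x i))) (r⁻-r i)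
    ; cross = every _ (λ ()) (λ ()) (λ ()) (λ ()) (λ ()) (λ ()) (λ ()) (λ ()) (λ ()) (λ ()) (λ ()) (λ ())
    ; zig = λ {k} {j} e → zig-trans (to-start k) (subst (λ a → Zig turn turn⁻ ι (plain 0F a) j) (sym e)
        (zig-sym ι-ι turn-turn⁻ turn⁻-turn (to-start j)))
    ; two = two ; meet = meet
    ; two-marked = λ {a} {x} {y} {z} {i} {j} {k} p q o → two-marked x i y j z k (trans p (sym q)) (trans p (sym o))
    ; some-marked = λ { 0F → 0F , 2F , refl ; 1F → 0F , 0F , refl ; 2F → 0F , 1F , refl }
    -- The Tait colouring by the three perfect matchings: opposite edges share the curve `after`.
    ; colour = inject₁ ∘ after
    ; colour-ι = every _ refl refl refl refl refl refl refl refl refl refl refl refl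
    ; colour-turn = every _ (λ ()) (λ ()) (λ ()) (λ ()) (λ ()) (λ ()) (λ ()) (λ ()) (λ ()) (λ ()) (λ ()) (λ ())
    ; seam = 0F , 1F , 0F , 0F , refl
    }

stage : ℕ → Saturated
stage zero    = Tetrahedron.tetrahedron
stage (suc n) = Doubling.double (stage n)

stage-grows : ∀ n → n < Saturated.#X (stage n)
stage-grows zero    = s≤s z≤n
stage-grows (suc n) = ℕₚ.≤-trans (ℕₚ.+-mono-≤ (s≤s z≤n) (stage-grows n))
  (ℕₚ.≤-trans (ℕₚ.+-monoˡ-≤ x (ℕₚ.≤-trans (s≤s z≤n) (stage-grows n))) (ℕₚ.≤-reflexive (sym (h x))))
  where
    x = Saturated.#X (stage n)
    h : ∀ x → x * 2 ≡ x + x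
    h = solve-∀

theorem3 : (N : ℕ) → ∃ λ m → N < m × ∃ λ (A : ArrangementMap m) →
    ChromaticNumber A 4 × IntersectingPlusOne A
-- The circle is added to the doubling of stage `N`, where the seam of that stage has become a
-- pentagon. Stage `n` has `3 * 2 ^ n` curves, so there are `3 * 2 ^ (N + 1) + 1` here; counting
-- marked vertices already bounds the size.
theorem3 N = _ , large , Medial.arrangement crowned , chromatic-4 , Medial.intersecting crowned
  where
    open CrownedDoubling.Crown (stage N)
    open Saturated (Doubling.double (stage N)) using (#Y; #X; #E)
    large : N < ((#E + (5 + 5)) + (#E + (5 + 5))) * 2
    large = begin-strict
      N                                          <⟨ stage-grows N ⟩
      Saturated.#X (stage N)                     ≤⟨ ℕₚ.m≤m*n _ 2 ⟩
      #X                                         ≤⟨ ℕₚ.m≤n+m #X #Y ⟩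
      #Y + #X                                    ≤⟨ ℕₚ.m≤m*n _ 3 ⟩
      (#Y + #X) * 3                              ≤⟨ ℕₚ.m≤m+n _ 20 ⟩
      (#Y + #X) * 3 + 20                         ≡⟨ #K⁺ ⟩
      (#E + (5 + 5)) + (#E + (5 + 5))            ≤⟨ ℕₚ.m≤m*n _ 2 ⟩
      ((#E + (5 + 5)) + (#E + (5 + 5))) * 2      ∎
      where open ℕₚ.≤-Reasoning
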